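{- A word $w$ in $X$ is a shifted tableau word if and only if it can be written as $w=u_lu_{l-1}\cdots u_1$ where (1) each $u_i$ is a hook word, and (2) for $1\le i\le l-1$, $u_i$ is a hook subword of maximum length in $u_lu_{l-1}\cdots u_i$ (i.e. no subsequence of $u_l\cdots u_i$ that is a hook word is longer than $u_i$). Furthermore, writing $\lambda_i=|u_i|$, for $1\le i\le l$ the shape of $P_{\mathrm{mix}}(u_l\cdots u_{i+1}u_i)$ is $(\lambda_i,\lambda_{i+1},\dots,\lambda_l)$. In particular $\mathrm{shape}(P_{\mathrm{mix}}(w))=\lambda=(\lambda_1,\dots,\lambda_l)$.
   Context: $X=\{1<2<\cdots\}$, $X'=\{1'<1<2'<2<\cdots\}$; words are finite sequences in $X$. A hook word is a word $w_1\cdots w_r$ such that for some $1\le k\le r$, $w_1>w_2>\cdots>w_k\le w_{k+1}\le\cdots\le w_r$. A hook subword of a word is a (not necessarily contiguous) subsequence which is a hook word. A strict partition $\lambda$ has shifted diagram with $\lambda_i$ cells in row $i$, row $i$ shifted $i-1$ units right. A shifted Young tableau is a filling with letters of $X'$, rows and columns weakly increasing, each unprimed $k$ at most once per column, each primed $k'$ at most once per row, no primed entries on the main diagonal. A standard shifted (skew) tableau contains $1,\dots,N$ once each, rows and columns increasing. Mixed insertion of $w=w_1\cdots w_n$: starting from the empty pair, insert letters successively. A letter is inserted into the first row, bumping the smallest entry $a$ strictly greater than it (order of $X'$), or placed at the end of the row if none. Whenever $a$ is bumped: if off the main diagonal and unprimed, insert it into the next row likewise; if off the diagonal and primed, insert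 it into the next column to the right, bumping the smallest strictly greater entry there (or placing it at the end); if on the main diagonal, prime it and insert $a'$ into the next column to the right. Stop when a letter is placed at the end of a row or column. $P_{\mathrm{mix}}(w)$ is the resulting tableau and $Q_{\mathrm{mix}}(w)$ records by $i$ the box added at step $i$; $w\mapsto(P_{\mathrm{mix}},Q_{\mathrm{mix}})$ is a bijection onto pairs (shifted Young tableau, standard shifted tableau of the same shape). A vee is a standard skew shifted tableau with entries $i,\dots,k$ whose shape is a (possibly disconnected) border strip such that for some $i\le j\le k$: entries $i,\dots,j$ form a vertical strip increasing downward; entries $j,\dots,k$ form a horizontal strip increasing left to right; each box of the vertical strip is left of the boxes of the horizontal strip in the same row; connected if its shape is. The special recording tableau of shape $\lambda=(\lambda_1,\dots,\lambda_l)$ is the unique standard shifted tableau of shape $\lambda$ in which for each $i$ the entries $\lambda_l+\cdots+\lambda_{i+1}+1,\dots,\lambda_l+\cdots+\lambda_{i}$ form a connected vee. $\mathrm{mread}(T)$ is the word $w$ with $P_{\mathrm{mix}}(w)=T$ and $Q_{\mathrm{mix}}(w)$ the special recording tableau of shape $\mathrm{shape}(T)$; a shifted tableau word is a word $\mathrm{mread}(T)$ for some shifted Young tableau $T$. -}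

module Defs where

open import Data.Fin.Base using (toℕ)
open import Data.List.Base using (List; []; _∷_; [_]; _++_; _∷ʳ_; concat; drop; head; length; applyUpTo; map; lookup; mapMaybe; reverse; foldl; takeWhile; upTo)
open import Data.List.Relation.Binary.Permutation.Propositional using (_↭_)
open import Data.List.Relation.Binary.Sublist.Propositional using (_⊆_)
open import Data.List.Relation.Unary.All using (All)
open import Data.List.Relation.Unary.Linked using (Linked)
open import Data.Maybe.Base using (Maybe; just; nothing)
open import Data.Nat.Base using (ℕ; zero; suc; _+_; _*_; _≤_; _<_; _>_; NonZero; ∣_-_∣)
open import Data.Nat.ListAction using (sum)
open import Data.Nat.Properties using (_≤?_; _≟_)
open import Data.Product.Base using (_×_; _,_; ∃-syntax; proj₁; proj₂)
open import Relation.Binary.Construct.Closure.ReflexiveTransitive using (Star)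
open import Relation.Binary.PropositionalEquality using (_≡_; _≢_)
open import Relation.Nullary using (¬_; Dec; yes; no)

------------------------------------------------------------------------
-- Alphabets and words

record X : Set where
  constructor letter
  field
    value         : ℕ
    .{{positive}} : NonZero value
open X public

_≤ˣ_ _>ˣ_ : X → X → Set
x ≤ˣ y = value x ≤ value y
x >ˣ y = value x > value y

data X′ : Set where
  primed unprimed : X → X′

-- The order 1′ < 1 < 2′ < 2 < ⋯ is the order of the ranks 2 < 3 < 4 < 5 < ⋯.
rank : X′ → ℕ
rank (primed x)   = 2 * value x
rank (unprimed x) = suc (2 * value x)

_≤′_ : X′ → X′ → Set
x ≤′ y = rank x ≤ rank y

_≤′?_ : (x y : X′) → Dec (x ≤′ y)
x ≤′? y = rank x ≤? rank y

Word : Set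
Word = List X

------------------------------------------------------------------------
-- Hook words

HookWord : Word → Set
HookWord w = ∃[ ds ] ∃[ x ] ∃[ is ]
  (w ≡ ds ++ x ∷ is × Linked _>ˣ_ (ds ∷ʳ x) × Linked _≤ˣ_ (x ∷ is))

record IsHookSubword (u w : Word) : Set where
  field
    subsequence : u ⊆ w
    hook        : HookWord u

record IsMaximumHookSubword (u w : Word) : Set where
  field
    isHookSubword : IsHookSubword u w
    maximum       : ∀ v → IsHookSubword v w → length v ≤ length u

------------------------------------------------------------------------
-- Fillings of shifted diagrams

-- A filling is the list of its rows, from top to bottom.  Rows and columns
-- are numbered from 0, and row r starts in column r, so that the boxes
-- (r , r) form the main diagonal.
Filling : Set → Set
Filling A = List (List A)

Box : Set
Box = ℕ × ℕ

module _ {A : Set} where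

  entry : Filling A → Box → Maybe A
  entry []      _               = nothing
  entry (ρ ∷ _) (zero  , c)     = head (drop c ρ)
  entry (_ ∷ _) (suc _ , zero)  = nothing
  entry (_ ∷ T) (suc r , suc c) = entry T (r , c)

  shape : Filling A → List ℕ
  shape = map length

  size : Filling A → ℕ
  size T = length (concat T)

  row : Filling A → ℕ → List A
  row []      _       = []
  row (ρ ∷ _) zero    = ρ
  row (_ ∷ T) (suc r) = row T r

  column : Filling A → ℕ → List A
  column T c = mapMaybe (λ r → entry T (r , c)) (upTo (suc c))

  putInRow : List A → ℕ → A → List A
  putInRow []       _       x = [ x ]
  putInRow (_ ∷ ys) zero    x = x ∷ ys
  putInRow (y ∷ ys) (suc c) x = y ∷ putInRow ys c x

  -- put T b x writes x into the box b, which is meant to be a box of T or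
  -- a box whose addition to T gives a shifted diagram.
  put : Filling A → Box → A → Filling A
  put []      _               x = [ [ x ] ]
  put (ρ ∷ T) (zero  , c)     x = putInRow ρ c x ∷ T
  put (ρ ∷ T) (suc r , zero)  x = ρ ∷ T
  put (ρ ∷ T) (suc r , suc c) x = ρ ∷ put T (r , c) x

------------------------------------------------------------------------
-- Tableaux

StrictPartition : List ℕ → Set
StrictPartition λs = All NonZero λs × Linked _>_ λs

record IsShiftedYoungTableau (T : Filling X′) : Set where
  field
    strict : StrictPartition (shape T)
    rows-increasing : ∀ {r c c′ x y} → c < c′ →
      entry T (r , c) ≡ just x → entry T (r , c′) ≡ just y → x ≤′ y
    columns-increasing : ∀ {r r′ c x y} → r < r′ →
      entry T (r , c) ≡ just x → entry T (r′ , c) ≡ just y → x ≤′ y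
    unprimed-once-per-column : ∀ {r r′ c k} →
      entry T (r , c) ≡ just (unprimed k) →
      entry T (r′ , c) ≡ just (unprimed k) → r ≡ r′
    primed-once-per-row : ∀ {r c c′ k} →
      entry T (r , c) ≡ just (primed k) →
      entry T (r , c′) ≡ just (primed k) → c ≡ c′
    diagonal-unprimed : ∀ {r k} → entry T (r , r) ≢ just (primed k)

record IsStandardShiftedTableau (Q : Filling ℕ) : Set where
  field
    strict   : StrictPartition (shape Q)
    contents : concat Q ↭ applyUpTo suc (size Q)
    rows-increasing : ∀ {r c c′ x y} → c < c′ →
      entry Q (r , c) ≡ just x → entry Q (r , c′) ≡ just y → x < y
    columns-increasing : ∀ {r r′ c x y} → r < r′ →
      entry Q (r , c) ≡ just x → entry Q (r′ , c) ≡ just y → x < y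

------------------------------------------------------------------------
-- Mixed insertion

data Line : Set where
  inRow inColumn : ℕ → Line

-- The first box of the line whose entry is greater than x or, if there is
-- none, the box at the end of the line.  As lines are weakly increasing,
-- the former holds the smallest entry greater than x.
target : Filling X′ → Line → X′ → Box
target T (inRow r)    x = r , r + length (takeWhile (_≤′? x) (row T r))
target T (inColumn c) x = length (takeWhile (_≤′? x) (column T c)) , c

-- Where, and in which form, an entry bumped from a box is inserted next.
next : Box → X′ → Line × X′
next (r , c) (primed a) = inColumn (suc c) , primed a
next (r , c) (unprimed a) with r ≟ c
... | yes _ = inColumn (suc c) , primed a
... | no  _ = inRow (suc r) , unprimed a

-- The first argument bounds the number of steps.  Each bump lowers the
-- number of entries of the tableau greater than the letter in hand, so that
-- suc (size T) steps always suffice and the clause for zero is not reached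
-- from insert.  The result includes the box added to the shape.
insertFrom : ℕ → Filling X′ → Line → X′ → Filling X′ × Box
insertFrom zero    T _ _ = T , (0 , 0)
insertFrom (suc n) T ℓ x with target T ℓ x
... | b with entry T b
...   | nothing = put T b x , b
...   | just a  = insertFrom n (put T b x) (proj₁ (next b a)) (proj₂ (next b a))

insert : Filling X′ → X → Filling X′ × Box
insert T x = insertFrom (suc (size T)) T (inRow 0) (unprimed x)

mixStep : Filling X′ × Filling ℕ → X → Filling X′ × Filling ℕ
mixStep (P , Q) x with insert P x
... | P′ , b = P′ , put Q b (suc (size Q))

mix : Word → Filling X′ × Filling ℕ
mix = foldl mixStep ([] , [])

Pmix : Word → Filling X′
Pmix w = proj₁ (mix w)

Qmix : Word → Filling ℕ
Qmix w = proj₂ (mix w)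

------------------------------------------------------------------------
-- Vees

Adjacent : Box → Box → Set
Adjacent (r , c) (r′ , c′) = ∣ r - r′ ∣ + ∣ c - c′ ∣ ≡ 1

-- The boxes of a filling Q with entries in i, …, k.  If Q is a standard
-- shifted tableau, they form a standard skew shifted tableau.
module _ (Q : Filling ℕ) where

  _∈[_,_]_ : Box → ℕ → ℕ → ℕ → Set
  b ∈[ i , k ] e = entry Q b ≡ just e × i ≤ e × e ≤ k

  InStrip : ℕ → ℕ → Box → Set
  InStrip i k b = ∃[ e ] b ∈[ i , k ] e

  IsBorderStrip : ℕ → ℕ → Set
  IsBorderStrip i k = ∀ r c →
    ¬ (InStrip i k (r , c)     × InStrip i k (r , suc c) ×
       InStrip i k (suc r , c) × InStrip i k (suc r , suc c))

  record IsIncreasingVerticalStrip (i j : ℕ) : Set where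
    field
      one-per-row : ∀ {r c c′} →
        InStrip i j (r , c) → InStrip i j (r , c′) → c ≡ c′
      downward : ∀ {r c r′ c′ e e′} → r < r′ →
        (r , c) ∈[ i , j ] e → (r′ , c′) ∈[ i , j ] e′ → e < e′

  record IsIncreasingHorizontalStrip (j k : ℕ) : Set where
    field
      one-per-column : ∀ {r r′ c} →
        InStrip j k (r , c) → InStrip j k (r′ , c) → r ≡ r′
      rightward : ∀ {r c r′ c′ e e′} → c < c′ →
        (r , c) ∈[ j , k ] e → (r′ , c′) ∈[ j , k ] e′ → e < e′

  -- The box with entry j lies in both strips, which is why its position
  -- is compared weakly in left-of; distinct boxes are compared strictly.
  record IsVee (i k : ℕ) : Set where
    field
      borderStrip : IsBorderStrip i k
      j           : ℕ
      i≤j         : i ≤ j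
      j≤k         : j ≤ k
      vertical    : IsIncreasingVerticalStrip i j
      horizontal  : IsIncreasingHorizontalStrip j k
      left-of     : ∀ {r c c′} →
        InStrip i j (r , c) → InStrip j k (r , c′) → c ≤ c′

  IsConnected : ℕ → ℕ → Set
  IsConnected i k = ∀ {b b′} → InStrip i k b → InStrip i k b′ →
    Star (λ p q → InStrip i k p × InStrip i k q × Adjacent p q) b b′

  record IsConnectedVee (i k : ℕ) : Set where
    field
      isVee     : IsVee i k
      connected : IsConnected i k

------------------------------------------------------------------------
-- Shifted tableau words

-- The entries λ_l + ⋯ + λ_{i+1} + 1, …, λ_l + ⋯ + λ_i, with i numbered
-- from 0.
record IsSpecialRecordingTableau (λs : List ℕ) (Q : Filling ℕ) : Set where
  field
    isStandard : IsStandardShiftedTableau Q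
    hasShape   : shape Q ≡ λs
    vees       : ∀ i → i < length λs →
      IsConnectedVee Q (suc (sum (drop (suc i) λs))) (sum (drop i λs))

-- As w ↦ (Pmix w , Qmix w) is injective and there is exactly one special
-- recording tableau of each shape, this says that w is the word mread T.
IsMread : Filling X′ → Word → Set
IsMread T w = Pmix w ≡ T × IsSpecialRecordingTableau (shape T) (Qmix w)

IsShiftedTableauWord : Word → Set
IsShiftedTableauWord w = ∃[ T ] (IsShiftedYoungTableau T × IsMread T w)

-- u_l u_{l-1} ⋯ u_1 for the list of words u_1, …, u_l.
descendingProduct : List Word → Word
descendingProduct us = concat (reverse us)

-- The list us is u_1, …, u_l, so drop (toℕ i) us is u_{i+1}, …, u_l.
record IsMaximumHookFactorization (us : List Word) (w : Word) : Set where
  field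
    factorization : w ≡ descendingProduct us
    hooks         : ∀ i → HookWord (lookup us i)
    maximum       : ∀ i → suc (toℕ i) < length us →
      IsMaximumHookSubword (lookup us i) (descendingProduct (drop (toℕ i) us))

{-# OPTIONS --safe #-}
module Submission where

-- Insert a letter in mixed insertion by scanning the cells of P in increasing
-- order of their entries: the new letter takes the end of the first row, and
-- whenever the box just taken is that of a later cell, the latter moves to the
-- end of the next row or column.  Read along one cell instead, this says how a
-- new last occurrence of the maximal letter changes the boxes added by the
-- other letters, so that facts about words follow by removing such letters.
--
-- Two facts are obtained in this way.  First, w and the sequence of boxes have
-- peaks (x ≤ y > z in w; a box to the right, then one below) at the same
-- places, whence hook words give vees and conversely.  Secondly, doubling the
-- shifted diagram (reflecting (r , c) to (1 + c , r)) turns the growth into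
-- that of ordinary row insertion of the word in which each letter x is
-- replaced by x, -x.  Here a new maximum moves from row to row and a new
-- minimum from column to column; since such moves commute, the letters may be
-- added in increasing order instead, and the first row is seen to be as long
-- as a longest increasing subsequence, that is, a longest hook subword of w.
--
-- If w = w′ u, where u is a hook word as long as the first row of P(w), then
-- the boxes added by u lie on distinct diagonals c - r, of which there are
-- only |u|.  So each diagonal gains one box, which means that the shape of
-- P(w) is that of P(w′) with a row of length |u| put on top.

open import Defs
open import Data.Empty using (⊥; ⊥-elim)
open import Data.Fin.Base as Fin using (Fin; zero; suc; toℕ; fromℕ<)
open import Data.Fin.Properties as Fin using (pigeonhole; fromℕ<-injective; toℕ<n; toℕ-injective)
import Data.Integer.Base as ℤ
import Data.Integer.Properties as ℤ
open import Data.List.Base as List using (List; []; _∷_; _++_; [_]; _∷ʳ_; length; map; foldl; head; drop; take; takeWhile; mapMaybe; applyUpTo; concat; reverse; lookup)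
open import Data.List.Membership.Propositional using (_∈_)
open import Data.List.Membership.Propositional.Properties using (∈-++⁻; ∈-++⁺ˡ; ∈-++⁺ʳ)
open import Data.List.Properties using (length-++; ++-assoc; ++-identityʳ; length-map; map-++; map-∘; ∷-injectiveˡ; ∷-injectiveʳ; unfold-reverse; concat-++; take++drop≡id; length-take)
open import Data.List.Relation.Binary.Permutation.Propositional using (_↭_; ↭-sym; ↭-trans; ↭-refl; prep)
open import Data.List.Relation.Binary.Permutation.Propositional.Properties using (shift; ∈-resp-↭; ↭-length)
open import Data.List.Relation.Binary.Sublist.Propositional as ⊆ using (_⊆_; []; _∷_; ⊆-refl; ⊆-trans) renaming (_∷ʳ_ to _∷ˢ_)
import Data.List.Relation.Binary.Sublist.Propositional.Properties as ⊆
open import Data.List.Relation.Unary.All as All using (All; []; _∷_)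
import Data.List.Relation.Unary.All.Properties as All
open import Data.List.Relation.Unary.AllPairs as AllPairs using (AllPairs; []; _∷_)
import Data.List.Relation.Unary.AllPairs.Properties as AllPairs
open import Data.List.Relation.Unary.Any using (here; there)
open import Data.List.Relation.Unary.Linked as Linked using (Linked; []; [-]; _∷_)
open import Data.List.Relation.Unary.Linked.Properties using (Linked⇒AllPairs; AllPairs⇒Linked)
open import Data.Maybe.Base using (Maybe; just; nothing)
open import Data.Maybe.Properties using (just-injective)
open import Data.Nat.Base hiding (_≤′_)
open import Data.Nat.ListAction using (sum)
open import Data.Nat.Properties hiding (_≤′?_)
open import Data.Product.Base hiding (map)
open import Data.Product.Properties using (≡-dec)
open import Data.Sum.Base using (_⊎_; inj₁; inj₂)
open import Data.Unit.Base using (⊤; tt)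
open import Function.Base using (_∘_; id; case_of_)
open import Function.Bundles using (_⇔_; mk⇔)
open import Level using (0ℓ)
open import Relation.Binary.Construct.Closure.ReflexiveTransitive using (Star; ε; _◅_; _◅◅_)
open import Relation.Binary.Definitions using (tri<; tri≈; tri>)
open import Relation.Binary.PropositionalEquality hiding ([_])
open import Relation.Nullary using (¬_; Dec; yes; no; contradiction)
open import Relation.Unary using (Pred; Decidable)

-- The order in which letters are added is the main obstacle. A mixed insertion enlarges the doubled
-- word by a new maximum and a new minimum at a time, whereas the recursion for longest increasing
-- subsequences strips off maxima only and so meets words that are not doubles. `Grown` therefore
-- leaves the order open, and the commutation of `Insert` in opposite directions is what lets one
-- order be traded for another. All statements on words concern traces, that is, sequences of boxes,
-- in which a letter can be inserted or removed without knowing the other entries of a tableau.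
-- Tableaux enter late, through `mix-simulates`. There bumping compares ranks, so equal letters
-- matter, while the doubled word needs distinct letters; hence the labels on traces and the
-- relation `≼` on cells.

⊥-<-refl : ∀ {n} {A : Set} → n < n → A
⊥-<-refl l = contradiction l (<-irrefl refl)

_≟ᵇ_ : (a b : Box) → Dec (a ≡ b)
_≟ᵇ_ = ≡-dec _≟_ _≟_

-- Ordinary Young diagrams

-- Row and column lengths are two independent functions, tied together only by `IsYoung`.
-- Transposition is then a swap of fields, and a fact about columns is the fact about rows for the
-- transpose.
record Diagram : Set where
  constructor diagram
  field
    rowEnd colEnd : ℕ → ℕ
open Diagram public

δ : ℕ → ℕ → ℕ
δ i j with i ≟ j
... | yes _ = 1
... | no  _ = 0

δ-refl : ∀ i → δ i i ≡ 1
δ-refl i with i ≟ i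
... | yes _ = refl
... | no ¬p = contradiction refl ¬p

δ-≢ : ∀ {i j} → i ≢ j → δ i j ≡ 0
δ-≢ {i} {j} i≢j with i ≟ j
... | yes p = contradiction p i≢j
... | no  _ = refl

∅ : Diagram
∅ = diagram (λ _ → 0) (λ _ → 0)

infixl 5 _⊕_

_⊕_ : Diagram → Box → Diagram
S ⊕ (r , c) = diagram (λ i → δ r i + rowEnd S i) (λ j → δ c j + colEnd S j)

transpose : Diagram → Diagram
transpose S = diagram (colEnd S) (rowEnd S)

infix 4 _≈_

_≈_ : Diagram → Diagram → Set
S ≈ S′ = (∀ i → rowEnd S i ≡ rowEnd S′ i) × (∀ j → colEnd S j ≡ colEnd S′ j)

≈-refl : ∀ {S} → S ≈ S
≈-refl = (λ _ → refl) , (λ _ → refl)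

≈-sym : ∀ {S S′} → S ≈ S′ → S′ ≈ S
≈-sym (p , q) = (λ i → sym (p i)) , (λ j → sym (q j))

≈-trans : ∀ {S S′ S″} → S ≈ S′ → S′ ≈ S″ → S ≈ S″
≈-trans (p , q) (p′ , q′) = (λ i → trans (p i) (p′ i)) , (λ j → trans (q j) (q′ j))

⊕-cong : ∀ {S S′} b → S ≈ S′ → S ⊕ b ≈ S′ ⊕ b
⊕-cong (r , c) (p , q) = (λ i → cong (δ r i +_) (p i)) , (λ j → cong (δ c j +_) (q j))

swap-+ : ∀ a b c → a + (b + c) ≡ b + (a + c)
swap-+ a b c = trans (sym (+-assoc a b c)) (trans (cong (_+ c) (+-comm a b)) (+-assoc b a c))

⊕-comm : ∀ S a b → S ⊕ a ⊕ b ≈ S ⊕ b ⊕ a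
⊕-comm S a b = (λ i → swap-+ (δ (proj₁ b) i) (δ (proj₁ a) i) (rowEnd S i))
             , (λ j → swap-+ (δ (proj₂ b) j) (δ (proj₂ a) j) (colEnd S j))

rowEnd-⊕ : ∀ S b {i} → proj₁ b ≡ i → rowEnd (S ⊕ b) i ≡ suc (rowEnd S i)
rowEnd-⊕ S (r , _) refl rewrite δ-refl r = refl

rowEnd-⊕-≢ : ∀ S b {i} → proj₁ b ≢ i → rowEnd (S ⊕ b) i ≡ rowEnd S i
rowEnd-⊕-≢ S b p rewrite δ-≢ p = refl

colEnd-⊕ : ∀ S b {j} → proj₂ b ≡ j → colEnd (S ⊕ b) j ≡ suc (colEnd S j)
colEnd-⊕ S b = rowEnd-⊕ (transpose S) (swap b)

colEnd-⊕-≢ : ∀ S b {j} → proj₂ b ≢ j → colEnd (S ⊕ b) j ≡ colEnd S j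
colEnd-⊕-≢ S b = rowEnd-⊕-≢ (transpose S) (swap b)

rowEnd-mono : ∀ S b i → rowEnd S i ≤ rowEnd (S ⊕ b) i
rowEnd-mono S (r , _) i = m≤n+m _ (δ r i)

record IsYoung (S : Diagram) : Set where
  field
    row⇒col : ∀ {r c} → c < rowEnd S r → r < colEnd S c
    col⇒row : ∀ {r c} → r < colEnd S c → c < rowEnd S r
open IsYoung public

Addable : Diagram → Box → Set
Addable S (r , c) = rowEnd S r ≡ c × colEnd S c ≡ r

IsYoung-transpose : ∀ {S} → IsYoung S → IsYoung (transpose S)
IsYoung-transpose y = record { row⇒col = col⇒row y ; col⇒row = row⇒col y }

IsYoung-∅ : IsYoung ∅
IsYoung-∅ = record { row⇒col = λ () ; col⇒row = λ () }

IsYoung-≈ : ∀ {S S′} → S ≈ S′ → IsYoung S → IsYoung S′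
IsYoung-≈ (p , q) y = record
  { row⇒col = λ {r} {c} l → subst (r <_) (q c) (row⇒col y (subst (c <_) (sym (p r)) l))
  ; col⇒row = λ {r} {c} l → subst (c <_) (p r) (col⇒row y (subst (r <_) (sym (q c)) l)) }

Addable-≈ : ∀ {S S′} b → S ≈ S′ → Addable S b → Addable S′ b
Addable-≈ (r , c) (p , q) (x , y) = trans (sym (p r)) x , trans (sym (q c)) y

private
  row⇒col-⊕ : ∀ {S} b → IsYoung S → Addable S b → ∀ {r c} →
    c < rowEnd (S ⊕ b) r → r < colEnd (S ⊕ b) c
  row⇒col-⊕ {S} (r₀ , c₀) y (p , q) {r} {c} l with r₀ ≟ r
  ... | no _ = ≤-trans (row⇒col y l) (m≤n+m _ (δ c₀ c))
  ... | yes refl with m≤n⇒m<n∨m≡n (s≤s⁻¹ l)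
  ...   | inj₁ l′ = ≤-trans (row⇒col y l′) (m≤n+m _ (δ c₀ c))
  ...   | inj₂ refl rewrite p | δ-refl c₀ | q = ≤-refl

IsYoung-⊕ : ∀ {S} b → IsYoung S → Addable S b → IsYoung (S ⊕ b)
IsYoung-⊕ b y a@(p , q) = record
  { row⇒col = row⇒col-⊕ b y a
  ; col⇒row = row⇒col-⊕ (swap b) (IsYoung-transpose y) (q , p) }

Addable-sameRow : ∀ {S a b} → Addable S a → Addable S b → proj₁ a ≡ proj₁ b → a ≡ b
Addable-sameRow {a = r , c} (p , _) (p′ , _) refl = cong (r ,_) (trans (sym p) p′)

Addable-sameCol : ∀ {S a b} → Addable S a → Addable S b → proj₂ a ≡ proj₂ b → a ≡ b
Addable-sameCol {a = r , c} (_ , p) (_ , p′) refl = cong (_, c) (trans (sym p) p′)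

Addable-⊕ : ∀ {S a b} → Addable S a → Addable S b → a ≢ b → Addable (S ⊕ a) b
Addable-⊕ {S} {a} {b} A B a≢b =
    trans (rowEnd-⊕-≢ S a (a≢b ∘ Addable-sameRow {S} A B)) (proj₁ B)
  , trans (colEnd-⊕-≢ S a (a≢b ∘ Addable-sameCol {S} A B)) (proj₂ B)

∈⇒¬Addable : ∀ {S r c} → Addable S (r , c) → ¬ (c < rowEnd S r)
∈⇒¬Addable (refl , _) l = <-irrefl refl l

-- Moves of an extreme letter from line to line

data Direction : Set where
  downward rightward : Direction

data Opposite : Direction → Direction → Set where
  ↓→ : Opposite downward rightward
  →↓ : Opposite rightward downward

below : Diagram → Box → Box
below S (r , c) = suc r , rowEnd S (suc r)

next→ : Direction → Diagram → Box → Box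
next→ downward  S b = below S b
next→ rightward S b = swap (below (transpose S) (swap b))

first→ : Direction → Diagram → Box
first→ downward  S = 0 , rowEnd S 0
first→ rightward S = colEnd S 0 , 0

next→-≈ : ∀ κ {S S′} b → S ≈ S′ → next→ κ S b ≡ next→ κ S′ b
next→-≈ downward  (r , c) (p , q) = cong (suc r ,_) (p (suc r))
next→-≈ rightward (r , c) (p , q) = cong (_, suc c) (q (suc c))

first→-≈ : ∀ κ {S S′} → S ≈ S′ → first→ κ S ≡ first→ κ S′
first→-≈ downward  (p , q) = cong (0 ,_) (p 0)
first→-≈ rightward (p , q) = cong (_, 0) (q 0)

≤-from-< : ∀ {m n} → (∀ {k} → k < m → k < n) → m ≤ n
≤-from-< {zero}  f = z≤n
≤-from-< {suc m} f = f ≤-refl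

-- If two consecutive rows have equal length, the end of the lower one is blocked in `S`; then `b`
-- itself supplies the missing box above it.
below-Addable : ∀ {S} b → IsYoung S → Addable S b → Addable (S ⊕ b) (below S b)
below-Addable {S} (r , c) y (p , q) = fst , snd
  where
  c′ = rowEnd S (suc r)
  y′ = IsYoung-⊕ (r , c) y (p , q)
  fst : rowEnd (S ⊕ (r , c)) (suc r) ≡ c′
  fst = rowEnd-⊕-≢ S (r , c) (1+n≢n ∘ sym)
  c′≤c : c′ ≤ c
  c′≤c = ≤-from-< λ {k} k<c′ →
    subst (k <_) p (col⇒row y (<-trans (n<1+n r) (row⇒col y k<c′)))
  lower : r < colEnd (S ⊕ (r , c)) c′
  lower = row⇒col y′ (subst (c′ <_) (sym (trans (rowEnd-⊕ S (r , c) refl) (cong suc p))) (s≤s c′≤c))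
  upper : ¬ (suc r < colEnd (S ⊕ (r , c)) c′)
  upper l = <-irrefl refl (subst (c′ <_) fst (col⇒row y′ l))
  snd : colEnd (S ⊕ (r , c)) c′ ≡ suc r
  snd = ≤-antisym (≮⇒≥ upper) lower

next→-Addable : ∀ κ {S} b → IsYoung S → Addable S b → Addable (S ⊕ b) (next→ κ S b)
next→-Addable downward  b y A = below-Addable b y A
next→-Addable rightward b y (p , q) = swap (below-Addable (swap b) (IsYoung-transpose y) (q , p))

first→-Addable : ∀ κ {S} → IsYoung S → Addable S (first→ κ S)
first→-Addable downward {S} y = refl , n≤0⇒n≡0 (≮⇒≥ λ l → <-irrefl refl (col⇒row y l))
first→-Addable rightward {S} y = n≤0⇒n≡0 (≮⇒≥ λ l → <-irrefl refl (row⇒col y l)) , refl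

-- Step κ S a b b′ a′: while the diagram S grows by a, a larger letter in
-- the box b moves to b′, and the diagram with that letter grows by a′.
data Step (κ : Direction) (S : Diagram) (a : Box) : Box → Box → Box → Set where
  miss : ∀ {b} → b ≢ a → Step κ S a b b a
  hit  : ∀ {b′} → b′ ≡ next→ κ S a → Step κ S a a b′ b′

step : ∀ κ S a b → ∃[ b′ ] ∃[ a′ ] Step κ S a b b′ a′
step κ S a b with b ≟ᵇ a
... | yes refl = _ , _ , hit refl
... | no  p    = _ , _ , miss p

Step-deterministic : ∀ {κ S a b b₁ a₁ b₂ a₂} →
  Step κ S a b b₁ a₁ → Step κ S a b b₂ a₂ → b₁ ≡ b₂ × a₁ ≡ a₂
Step-deterministic (miss _)   (miss _)   = refl , refl
Step-deterministic (miss p)   (hit _)    = contradiction refl p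
Step-deterministic (hit _)    (miss p)   = contradiction refl p
Step-deterministic (hit refl) (hit refl) = refl , refl

Step-≈ : ∀ {κ S S′ a b b′ a′} → S ≈ S′ → Step κ S a b b′ a′ → Step κ S′ a b b′ a′
Step-≈ e (miss p) = miss p
Step-≈ {κ} {a = a} e (hit q) = hit (trans q (next→-≈ κ a e))

Step-transpose : ∀ {κ κ′ S a b b′ a′} → Opposite κ κ′ → Step κ S a b b′ a′ →
  Step κ′ (transpose S) (swap a) (swap b) (swap b′) (swap a′)
Step-transpose _  (miss p)   = miss (p ∘ cong swap)
Step-transpose ↓→ (hit refl) = hit refl
Step-transpose →↓ (hit refl) = hit refl

Step-Addable : ∀ {κ S a b b′ a′} → IsYoung S → Addable S a → Addable S b →
  Step κ S a b b′ a′ → Addable (S ⊕ a) b′ × Addable (S ⊕ b) a′ × (S ⊕ a ⊕ b′ ≈ S ⊕ b ⊕ a′)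
Step-Addable {S = S} {a} {b} y A B (miss p) =
  Addable-⊕ {S} A B (p ∘ sym) , Addable-⊕ {S} B A p , ⊕-comm S a b
Step-Addable {κ} {S} {a} y A B (hit refl) =
  next→-Addable κ a y A , next→-Addable κ a y A , ≈-refl

-- Local rules for a downward and a rightward letter

east south : Box → Box
east  (r , c) = r , suc c
south (r , c) = suc r , c

-- b and c are the boxes of the downward and the rightward letter in a
-- diagram with neither, b̃ and c̃ those in the diagram with the other one.
data Interplay (S : Diagram) : (b c b̃ c̃ : Box) → Set where
  apart  : ∀ {b c} → b ≢ c → Interplay S b c b c
  beside : ∀ {p} → Addable (S ⊕ p) (east p)  → Interplay S p p (east p)  (east p)
  under  : ∀ {p} → Addable (S ⊕ p) (south p) → Interplay S p p (south p) (south p)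

Interplay-transpose : ∀ {S b c b̃ c̃} → Interplay S b c b̃ c̃ →
  Interplay (transpose S) (swap c) (swap b) (swap c̃) (swap b̃)
Interplay-transpose (apart p)        = apart (p ∘ sym ∘ cong swap)
Interplay-transpose (beside (p , q)) = under (q , p)
Interplay-transpose (under (p , q))  = beside (q , p)

Between : ∀ {κ κ′} → Opposite κ κ′ → Diagram → (b c b̃ c̃ : Box) → Set
Between ↓→ S b c b̃ c̃ = Interplay S b c b̃ c̃
Between →↓ S b c b̃ c̃ = Interplay S c b c̃ b̃

-- The faces of a cube whose edges at `S` are `a`, `b` and `c`: the interplay of `b` and `c` before
-- the growth is the input, `between` is the one after it, and the other four faces are steps. That
-- both ways of adding the two letters end in the same `a₁₂` is the commutation.
record Cube {κ κ′} (o : Opposite κ κ′) (S : Diagram) (a b c b̃ c̃ : Box) : Set where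
  field
    {b₁ a₁ c₁ a₂ b̃₁ c̃₁ a₁₂} : Box
    step-b  : Step κ S a b b₁ a₁
    step-c  : Step κ′ S a c c₁ a₂
    step-b̃  : Step κ (S ⊕ c) a₂ b̃ b̃₁ a₁₂
    step-c̃  : Step κ′ (S ⊕ b) a₁ c̃ c̃₁ a₁₂
    between : Between o (S ⊕ a) b₁ c₁ b̃₁ c̃₁

Cube-transpose : ∀ {S a b c b̃ c̃} → Cube ↓→ S a b c b̃ c̃ →
  Cube ↓→ (transpose S) (swap a) (swap c) (swap b) (swap c̃) (swap b̃)
Cube-transpose C = record
  { step-b = Step-transpose →↓ step-c ; step-c = Step-transpose ↓→ step-b
  ; step-b̃ = Step-transpose →↓ step-c̃ ; step-c̃ = Step-transpose ↓→ step-b̃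
  ; between = Interplay-transpose between }
  where open Cube C

private
  cube-apart : ∀ {S b c} → IsYoung S → Addable S b → Addable S c → b ≢ c →
    Cube ↓→ S b b c b c
  cube-apart {S} {b@(r , k)} {c} y B C b≢c with below S b ≟ᵇ c
  ... | no p = record
    { step-b = hit refl ; step-c = miss (b≢c ∘ sym)
    ; step-b̃ = hit (cong (suc r ,_) (sym (rowEnd-⊕-≢ S c λ e →
                 p (Addable-sameRow {S ⊕ b} (below-Addable b y B) (Addable-⊕ {S} B C b≢c) (sym e)))))
    ; step-c̃ = miss (p ∘ sym) ; between = apart p }
  -- The bumped downward letter arrives in the box `c` of the rightward one. As `c` is addable to
  -- `S`, row `r` is strictly longer than the next (`k′<k`), so `east c` has a box above it and the
  -- two letters together add `c` and `east c`.
  ... | yes refl = record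
    { step-b = hit refl ; step-c = miss (b≢c ∘ sym)
    ; step-b̃ = hit {b′ = east c} (cong (suc r ,_) (sym (rowEnd-⊕ S c refl)))
    ; step-c̃ = hit {b′ = east c} (cong (_, suc k′) (sym colk′))
    ; between = beside (e₁ , e₂) }
    where
    k′ = rowEnd S (suc r)
    y′ = IsYoung-⊕ b y B
    k′<k : k′ < k
    k′<k = ≤∧≢⇒< (≮⇒≥ λ k<k′ → contradiction (<-trans (n<1+n r) (row⇒col y k<k′))
                               (<-irrefl (sym (proj₂ B))))
                 λ { refl → 1+n≢n (trans (sym (proj₂ C)) (proj₂ B)) }
    colk′ : colEnd (S ⊕ b) (suc k′) ≡ suc r
    colk′ = ≤-antisym
      (≮⇒≥ λ l → <-irrefl refl (<-trans (n<1+n k′)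
        (subst (suc k′ <_) (rowEnd-⊕-≢ S b (1+n≢n ∘ sym)) (col⇒row y′ l))))
      (row⇒col y′ (subst (suc k′ <_) (sym (trans (rowEnd-⊕ S b refl) (cong suc (proj₁ B)))) (s≤s k′<k)))
    e₁ : rowEnd (S ⊕ b ⊕ c) (suc r) ≡ suc k′
    e₁ = trans (rowEnd-⊕ (S ⊕ b) c refl) (cong suc (rowEnd-⊕-≢ S b (1+n≢n ∘ sym)))
    e₂ : colEnd (S ⊕ b ⊕ c) (suc k′) ≡ suc r
    e₂ = trans (colEnd-⊕-≢ (S ⊕ b) c (1+n≢n ∘ sym)) colk′

  -- Two letters sharing `p` part when `p` is taken: the downward one goes to the next row, the
  -- rightward one to `east p`, since that column already ends in the row of `p`.
  cube-beside : ∀ {S a p} → IsYoung S → Addable S a → Addable S p → Addable (S ⊕ p) (east p) →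
    Cube ↓→ S a p p (east p) (east p)
  cube-beside {S} {a} {p@(r , k)} y A P E with p ≟ᵇ a
  ... | yes refl = record
    { step-b = hit refl
    ; step-c = hit {b′ = east p} (cong (_, suc k) (sym colk))
    ; step-b̃ = hit (cong (suc r ,_) (sym (rowEnd-⊕-≢ S p (1+n≢n ∘ sym))))
    ; step-c̃ = miss ne
    ; between = apart (ne ∘ sym) }
    where
    colk : colEnd S (suc k) ≡ r
    colk = trans (sym (colEnd-⊕-≢ S p (1+n≢n ∘ sym))) (proj₂ E)
    ne : east p ≢ below S p
    ne e = 1+n≢n (sym (cong proj₁ e))
  ... | no p≢a = record
    { step-b = miss p≢a ; step-c = miss p≢a ; step-b̃ = miss ne ; step-c̃ = miss ne
    ; between = beside (Addable-≈ (east p) (⊕-comm S p a)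
        (Addable-⊕ {S ⊕ p} (Addable-⊕ {S} P A p≢a) E (ne ∘ sym))) }
    where
    ne : east p ≢ a
    ne refl = 1+n≢n (trans (sym (proj₁ A)) (proj₁ P))

  cube↓→ : ∀ {S a b c b̃ c̃} → IsYoung S → Addable S a → Addable S b → Addable S c →
    Interplay S b c b̃ c̃ → Cube ↓→ S a b c b̃ c̃
  cube↓→ {S} {a} {b} {c} y A B C (apart b≢c) with b ≟ᵇ a | c ≟ᵇ a
  ... | yes refl | _ = cube-apart y A C b≢c
  ... | no _ | yes refl = Cube-transpose
    (cube-apart (IsYoung-transpose y) (swap C) (swap B) (b≢c ∘ sym ∘ cong swap))
  ... | no p | no q = record
    { step-b = miss p ; step-c = miss q ; step-b̃ = miss p ; step-c̃ = miss q ; between = apart b≢c }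
  cube↓→ y A B C (beside E) = cube-beside y A B E
  cube↓→ {S} {a} {p} y A B C (under E) = Cube-transpose
    (cube-beside (IsYoung-transpose y) (swap A) (swap B) (swap E))

cube : ∀ {κ κ′} (o : Opposite κ κ′) {S a b c b̃ c̃} →
  IsYoung S → Addable S a → Addable S b → Addable S c → Between o S b c b̃ c̃ → Cube o S a b c b̃ c̃
cube ↓→ y A B C I = cube↓→ y A B C I
cube →↓ y A B C I = record
  { step-b = step-c ; step-c = step-b ; step-b̃ = step-c̃ ; step-c̃ = step-b̃ ; between = between }
  where open Cube (cube↓→ y A C B I)

private
  -- A new minimum starts at the end of the first column. A downward letter standing there goes to
  -- the next row, which is empty; it stays in the first column, so the two boxes are one under the
  -- other.
  start↓→ : ∀ {S b} → IsYoung S → Addable S b → let c = first→ rightward S in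
    ∃[ b̃ ] Step downward S c b b̃ (first→ rightward (S ⊕ b)) ×
           Interplay S b c b̃ (first→ rightward (S ⊕ b))
  start↓→ {S} {b} y B with b ≟ᵇ first→ rightward S
  ... | no p = b , subst (λ z → Step downward S (first→ rightward S) b b z × Interplay S b (first→ rightward S) b z)
                         (cong (_, 0) (sym (colEnd-⊕-≢ S b ne))) (miss p , apart p)
    where
    ne : proj₂ b ≢ 0
    ne = p ∘ Addable-sameCol {S} B (first→-Addable rightward y)
  ... | yes refl = south b , subst (λ z → Step downward S b b (south b) z × Interplay S b b (south b) z)
                         (cong (_, 0) (sym (colEnd-⊕ S b refl)))
                         (hit eq , under (subst (Addable (S ⊕ b)) (sym eq) (below-Addable b y B)))
    where
    eq : south b ≡ below S b
    eq = cong (suc (colEnd S 0) ,_) (sym (n≤0⇒n≡0 (≮⇒≥ λ l →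
           <-irrefl refl (<-trans (n<1+n _) (row⇒col y l)))))

start : ∀ {κ κ′} (o : Opposite κ κ′) {S b} → IsYoung S → Addable S b →
  ∃[ b̃ ] Step κ S (first→ κ′ S) b b̃ (first→ κ′ (S ⊕ b)) ×
         Between o S b (first→ κ′ S) b̃ (first→ κ′ (S ⊕ b))
start ↓→ y B = start↓→ y B
start →↓ y B with start↓→ (IsYoung-transpose y) (swap B)
... | b̃ , s , i = swap b̃ , Step-transpose ↓→ s , Interplay-transpose i

-- Commuting insertions of maximal and minimal letters

Trace : Set → Set
Trace A = List (A × Box)

infixl 5 _⊕*_

_⊕*_ : ∀ {A} → Diagram → Trace A → Diagram
S ⊕* []            = S
S ⊕* ((_ , b) ∷ L) = S ⊕ b ⊕* L

data Addable* {A : Set} : Diagram → Trace A → Set where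
  []  : ∀ {S} → Addable* S []
  _∷_ : ∀ {S x b L} → Addable S b → Addable* (S ⊕ b) L → Addable* S ((x , b) ∷ L)

-- The moving letter starts in `b`; `L` has the boxes added by the other letters in its absence,
-- `L′` those added in its presence.
data Run {A : Set} (κ : Direction) : Diagram → Box → Trace A → Trace A → Set where
  []  : ∀ {S b} → Run κ S b [] []
  _∷_ : ∀ {S b b′ x a a′ L L′} → Step κ S a b b′ a′ → Run κ (S ⊕ a) b′ L L′ →
        Run κ S b ((x , a) ∷ L) ((x , a′) ∷ L′)

-- The position of `here` is the place of the new letter in the word: earlier boxes are unaffected,
-- later ones pass through `Run`.
data Insert {A : Set} (κ : Direction) (m : A) : Diagram → Trace A → Trace A → Set where
  here  : ∀ {S b L L′} → b ≡ first→ κ S → Run κ S b L L′ → Insert κ m S L ((m , b) ∷ L′)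
  there : ∀ {S x b L L′} → Insert κ m (S ⊕ b) L L′ → Insert κ m S ((x , b) ∷ L) ((x , b) ∷ L′)

Addable*-≈ : ∀ {A S S′} {L : Trace A} → S ≈ S′ → Addable* S L → Addable* S′ L
Addable*-≈ e []               = []
Addable*-≈ e (_∷_ {b = b} A L) = Addable-≈ b e A ∷ Addable*-≈ (⊕-cong b e) L

Run-≈ : ∀ {A κ S S′ b} {L L′ : Trace A} → S ≈ S′ → Run κ S b L L′ → Run κ S′ b L L′
Run-≈ e []                = []
Run-≈ e (_∷_ {a = a} s r) = Step-≈ e s ∷ Run-≈ (⊕-cong a e) r

Insert-≈ : ∀ {A κ S S′} {m : A} {L L′} → S ≈ S′ → Insert κ m S L L′ → Insert κ m S′ L L′
Insert-≈ {κ = κ} e (here p r)            = here (trans p (first→-≈ κ e)) (Run-≈ e r)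
Insert-≈ e (there {b = b} i)     = there (Insert-≈ (⊕-cong b e) i)

run : ∀ {A} κ S b (L : Trace A) → ∃[ L′ ] Run κ S b L L′
run κ S b []            = [] , []
run κ S b ((x , a) ∷ L) with step κ S a b
... | b′ , a′ , s with run κ (S ⊕ a) b′ L
...   | L′ , r = (x , a′) ∷ L′ , s ∷ r

Run-Addable* : ∀ {A κ S b} {L L′ : Trace A} → IsYoung S → Addable S b → Addable* S L →
  Run κ S b L L′ → Addable* (S ⊕ b) L′
Run-Addable* y B []       []      = []
Run-Addable* {S = S} {b} y B (_∷_ {b = a} A As) (s ∷ r) with Step-Addable y A B s
... | B′ , A′ , e = A′ ∷ Addable*-≈ e (Run-Addable* (IsYoung-⊕ a y A) B′ As r)

Insert-Addable* : ∀ {A κ S} {m : A} {L L′} → IsYoung S → Addable* S L →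
  Insert κ m S L L′ → Addable* S L′
Insert-Addable* {κ = κ} y As (here refl r) = first→-Addable κ y ∷ Run-Addable* y (first→-Addable κ y) As r
Insert-Addable* y (_∷_ {b = b} A As) (there i) = A ∷ Insert-Addable* (IsYoung-⊕ b y A) As i

-- One cube for each letter of the trace; the last face of a cube is the interplay from which the
-- next one starts.
Run-commute : ∀ {A κ κ′} (o : Opposite κ κ′) {S b c b̃ c̃} {L L₁ L₁₂ : Trace A} →
  IsYoung S → Addable* S L → Addable S b → Addable S c → Between o S b c b̃ c̃ →
  Run κ S b L L₁ → Run κ′ (S ⊕ b) c̃ L₁ L₁₂ →
  ∃[ L₂ ] Run κ′ S c L L₂ × Run κ (S ⊕ c) b̃ L₂ L₁₂
Run-commute o y [] B C I [] [] = [] , [] , []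
Run-commute o y (A ∷ As) B C I (s ∷ r) (s′ ∷ r′) with cube o y A B C I
... | record { step-b = p ; step-c = q ; step-b̃ = p̃ ; step-c̃ = q̃ ; between = I′ }
  with Step-deterministic s p
... | refl , refl with Step-deterministic s′ q̃
... | refl , refl with Step-Addable y A B p | Step-Addable y A C q
... | B₁ , _ , e | C₁ , _ , e′ with
  Run-commute o (IsYoung-⊕ _ y A) As B₁ C₁ I′ r (Run-≈ (≈-sym e) r′)
... | L₂ , t , t′ = _ , q ∷ t , p̃ ∷ Run-≈ e′ t′

Run-Insert-commute : ∀ {A κ κ′} (o : Opposite κ κ′) {S b} {m : A} {L L₁ L₁₂} →
  IsYoung S → Addable* S L → Addable S b →
  Run κ S b L L₁ → Insert κ′ m (S ⊕ b) L₁ L₁₂ →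
  ∃[ L₂ ] Insert κ′ m S L L₂ × Run κ S b L₂ L₁₂
Run-Insert-commute {κ′ = κ′} o y As B r (here refl r′) with start o y B
... | b̃ , s , I with Run-commute o y As B (first→-Addable κ′ y) I r r′
... | L₂ , t , t′ = _ , here refl t , s ∷ t′
Run-Insert-commute o y (_∷_ {b = a} A As) B (s ∷ r) (there i) with Step-Addable y A B s
... | B₁ , _ , e with Run-Insert-commute o (IsYoung-⊕ a y A) As B₁ r (Insert-≈ (≈-sym e) i)
... | L₂ , t , t′ = _ , there t , s ∷ t′

Opposite-sym : ∀ {κ κ′} → Opposite κ κ′ → Opposite κ′ κ
Opposite-sym ↓→ = →↓
Opposite-sym →↓ = ↓→

Insert-Run-commute : ∀ {A κ κ′} (o : Opposite κ κ′) {S c} {m : A} {L L₁ L₁₂} →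
  IsYoung S → Addable* S L → Addable S c →
  Insert κ m S L L₁ → Run κ′ S c L₁ L₁₂ →
  ∃[ L₂ ] Run κ′ S c L L₂ × Insert κ m (S ⊕ c) L₂ L₁₂
Insert-Run-commute {κ = κ} o {S} {c} y As C (here refl r) (s ∷ r′) with start (Opposite-sym o) y C
... | c̃ , q , I with Step-deterministic s q
... | refl , refl with Run-commute o y As (first→-Addable κ y) C (back o I) r r′
  where
  back : ∀ {κ κ′} (o : Opposite κ κ′) {S b c b̃ c̃} →
    Between (Opposite-sym o) S c b c̃ b̃ → Between o S b c b̃ c̃
  back ↓→ I = I
  back →↓ I = I
... | L₂ , t , t′ = _ , t , here refl t′
Insert-Run-commute o y (_∷_ {b = a} A As) C (there i) (s ∷ r) with Step-Addable y A C s
... | C₁ , _ , e with Insert-Run-commute o (IsYoung-⊕ a y A) As C₁ i r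
... | L₂ , t , t′ = _ , s ∷ t , there (Insert-≈ e t′)

-- Up to the later of the two places only one new letter is present. At that place `start` provides
-- the interplay, and cubes carry it on.
Insert-commute : ∀ {A κ κ′} (o : Opposite κ κ′) {S} {m n : A} {L L₁ L₁₂} →
  IsYoung S → Addable* S L → Insert κ m S L L₁ → Insert κ′ n S L₁ L₁₂ →
  ∃[ L₂ ] Insert κ′ n S L L₂ × Insert κ m S L₂ L₁₂
Insert-commute {κ′ = κ′} o y As i (here refl r) with
  Insert-Run-commute o y As (first→-Addable κ′ y) i r
... | L₂ , t , t′ = _ , here refl t , there t′
Insert-commute {κ = κ} o y As (here refl r) (there i) with
  Run-Insert-commute o y As (first→-Addable κ y) r i
... | L₂ , t , t′ = _ , t , here refl t′
Insert-commute o y (_∷_ {b = a} A As) (there i) (there j) with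
  Insert-commute o (IsYoung-⊕ a y A) As i j
... | L₂ , t , t′ = _ , there t , there t′

letters : ∀ {A} → Trace A → List A
letters = map proj₁

Run-letters : ∀ {A κ S b} {L L′ : Trace A} → Run κ S b L L′ → letters L′ ≡ letters L
Run-letters []      = refl
Run-letters (_ ∷ r) = cong (_ ∷_) (Run-letters r)

Insert-split : ∀ {A κ S} {m : A} {L L′} → Insert κ m S L L′ →
  ∃[ p ] ∃[ q ] ∃[ q′ ] ∃[ b ]
    (L ≡ p ++ q × L′ ≡ p ++ (m , b) ∷ q′ × b ≡ first→ κ (S ⊕* p) × Run κ (S ⊕* p) b q q′)
Insert-split (here e r) = [] , _ , _ , _ , refl , refl , e , r
Insert-split (there {x = x} {b} i) with Insert-split i
... | p , q , q′ , b′ , refl , refl , e , r = (x , b) ∷ p , q , q′ , b′ , refl , refl , e , r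

Insert-letters : ∀ {A κ S} {m : A} {L L′} → Insert κ m S L L′ →
  ∃[ xs ] ∃[ ys ] (letters L ≡ xs ++ ys × letters L′ ≡ xs ++ m ∷ ys)
Insert-letters (here _ r) = [] , _ , refl , cong (_ ∷_) (Run-letters r)
Insert-letters (there {x = x} i) with Insert-letters i
... | xs , ys , e , e′ = x ∷ xs , ys , cong (x ∷_) e , cong (x ∷_) e′

All-insert⁻ : ∀ {A : Set} {P : A → Set} xs {m ys} → All P (xs ++ m ∷ ys) → P m × All P (xs ++ ys)
All-insert⁻ []       (p ∷ ps) = p , ps
All-insert⁻ (x ∷ xs) (p ∷ ps) with All-insert⁻ xs ps
... | q , qs = q , p ∷ qs

All-insert⁺ : ∀ {A : Set} {P : A → Set} xs {m ys} → P m → All P (xs ++ ys) → All P (xs ++ m ∷ ys)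
All-insert⁺ []       q ps       = q ∷ ps
All-insert⁺ (x ∷ xs) q (p ∷ ps) = p ∷ All-insert⁺ xs q ps

-- Row insertion of words of distinct integers

Extreme : Direction → ℤ.ℤ → List ℤ.ℤ → Set
Extreme downward  m = All (ℤ._< m)
Extreme rightward m = All (m ℤ.<_)

-- The boxes added by row insertion of a word; the letters may be added in any
-- order in which each is a new maximum or minimum.
data Grown : Trace ℤ.ℤ → Set where
  []  : Grown []
  add : ∀ {κ m L L′} → Grown L → Extreme κ m (letters L) → Insert κ m ∅ L L′ → Grown L′

Grown-Addable* : ∀ {L} → Grown L → Addable* ∅ L
Grown-Addable* []          = []
Grown-Addable* (add g _ i) = Insert-Addable* IsYoung-∅ (Grown-Addable* g) i

private
  Insert-prefix : ∀ {A κ S} {m : A} {L} p q → Insert κ m S L (p ++ q) →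
    (∃[ q₀ ] L ≡ p ++ q₀) ⊎ (∃[ p₀ ] ∃[ q₀ ] (L ≡ p₀ ++ q₀ × Insert κ m S p₀ p))
  Insert-prefix []      q i = inj₁ (_ , refl)
  Insert-prefix (_ ∷ p) q (here e r) with Run-prefix p q r
    where
    Run-prefix : ∀ {A κ S b} {L : Trace A} p q → Run κ S b L (p ++ q) →
      ∃[ p₀ ] ∃[ q₀ ] (L ≡ p₀ ++ q₀ × Run κ S b p₀ p)
    Run-prefix []      q r       = [] , _ , refl , []
    Run-prefix (x ∷ p) q (s ∷ r) with Run-prefix p q r
    ... | p₀ , q₀ , refl , r′ = _ ∷ p₀ , q₀ , refl , s ∷ r′
  ... | p₀ , q₀ , e′ , r′ = inj₂ (p₀ , q₀ , e′ , here e r′)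
  Insert-prefix (x ∷ p) q (there i) with Insert-prefix p q i
  ... | inj₁ (q₀ , refl)          = inj₁ (q₀ , refl)
  ... | inj₂ (p₀ , q₀ , refl , j) = inj₂ (x ∷ p₀ , q₀ , refl , there j)

Extreme-prefix : ∀ κ {m} (p q : Trace ℤ.ℤ) → Extreme κ m (letters (p ++ q)) → Extreme κ m (letters p)
Extreme-prefix downward  p q x rewrite map-++ proj₁ p q = All.++⁻ˡ (letters p) x
Extreme-prefix rightward p q x rewrite map-++ proj₁ p q = All.++⁻ˡ (letters p) x

-- For the part of a word before its greatest letter, which enters the recursion for longest
-- increasing subsequences.
Grown-prefix : ∀ p {q L} → Grown L → L ≡ p ++ q → Grown p
Grown-prefix []      g           e    = []
Grown-prefix (x ∷ p) []          ()
Grown-prefix p@(_ ∷ _) {q} (add {κ} g x i) refl with Insert-prefix p q i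
... | inj₁ (q₀ , e)             = Grown-prefix p g e
... | inj₂ (p₀ , q₀ , refl , j) = add (Grown-prefix p₀ g refl) (Extreme-prefix κ p₀ q₀ x) j

-- Reorders the additions so that the greatest letter comes last. If another letter was added last,
-- it was added as a minimum, and this addition commutes with that of the greatest letter.
Grown-max : ∀ {m L′} → Grown L′ → m ∈ letters L′ → All (ℤ._≤ m) (letters L′) →
  ∃[ L ] (Grown L × Extreme downward m (letters L) × Insert downward m ∅ L L′)
Grown-max [] () _
Grown-max {m} (add {κ} {n} {L} g x i) m∈ ≤m with Insert-letters i
... | xs , ys , e , e′ rewrite e′ with ∈-insert xs m∈
  where
  ∈-insert : ∀ xs {ys} → m ∈ xs ++ n ∷ ys → m ≡ n ⊎ m ∈ xs ++ ys
  ∈-insert []       (here p)  = inj₁ p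
  ∈-insert []       (there p) = inj₂ p
  ∈-insert (x ∷ xs) (here p)  = inj₂ (here p)
  ∈-insert (x ∷ xs) (there p) with ∈-insert xs p
  ... | inj₁ q = inj₁ q
  ... | inj₂ q = inj₂ (there q)
Grown-max (add {downward} g x i) m∈ ≤m | xs , ys , e , e′ | inj₁ refl = _ , g , x , i
Grown-max (add {downward} g x i) m∈ ≤m | xs , ys , e , e′ | inj₂ m∈′ =
  contradiction (ℤ.<-≤-trans (All.lookup x (subst (_ ∈_) (sym e) m∈′)) (proj₁ (All-insert⁻ xs ≤m)))
                (ℤ.<-irrefl refl)
-- A minimum that is also the greatest letter is the only one, and both directions start in the same
-- box of `∅`.
Grown-max (add {rightward} {L = []} g x (here refl [])) m∈ ≤m | xs , ys , e , e′ | inj₁ refl =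
  [] , [] , [] , here refl []
Grown-max (add {rightward} {L = _ ∷ _} g (m< ∷ _) i) m∈ ≤m | xs , ys , e , e′ | inj₁ refl =
  contradiction (ℤ.<-≤-trans m< (All.head (subst (All _) (sym e) (proj₂ (All-insert⁻ xs ≤m)))))
                (ℤ.<-irrefl refl)
Grown-max {m} (add {rightward} {n} g x i) m∈ ≤m | xs , ys , e , e′ | inj₂ m∈′ with
  Grown-max g (subst (m ∈_) (sym e) m∈′) (subst (All _) (sym e) (proj₂ (All-insert⁻ xs ≤m)))
... | L₀ , g₀ , x₀ , i₀ with Insert-commute ↓→ IsYoung-∅ (Grown-Addable* g₀) i₀ i
... | L₂ , j , j₀ with Insert-letters i₀ | Insert-letters j
... | us , vs , f , f′ | us′ , vs′ , h , h′ =
  L₂ , add g₀ n<L₀ j , subst (All (ℤ._< m)) (sym h′) (All-insert⁺ us′ n<m (subst (All _) h x₀)) , j₀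
  where
  n<m : n ℤ.< m
  n<m = All.lookup x (subst (m ∈_) (sym e) m∈′)
  n<L₀ : All (n ℤ.<_) (letters L₀)
  n<L₀ = subst (All _) (sym f) (proj₂ (All-insert⁻ us (subst (All _) f′ x)))

-- Longest increasing subsequences

topLength : ∀ {A} → Trace A → ℕ
topLength []                      = 0
topLength ((_ , zero  , _) ∷ L) = suc (topLength L)
topLength ((_ , suc _ , _) ∷ L) = topLength L

topLength-++ : ∀ {A} (L M : Trace A) → topLength (L ++ M) ≡ topLength L + topLength M
topLength-++ []                    M = refl
topLength-++ ((_ , zero  , _) ∷ L) M = cong suc (topLength-++ L M)
topLength-++ ((_ , suc _ , _) ∷ L) M = topLength-++ L M

topLength-rowEnd : ∀ {A} S (L : Trace A) → rowEnd (S ⊕* L) 0 ≡ topLength L + rowEnd S 0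
topLength-rowEnd S [] = refl
topLength-rowEnd S ((_ , zero  , c) ∷ L) =
  trans (topLength-rowEnd _ L) (trans (cong (topLength L +_) (rowEnd-⊕ S (0 , c) refl)) (+-suc (topLength L) _))
topLength-rowEnd S ((_ , suc r , c) ∷ L) =
  trans (topLength-rowEnd _ L) (cong (topLength L +_) (rowEnd-⊕-≢ S (suc r , c) λ ()))

private
  topLength-Run-suc : ∀ {A S r c} {L L′ : Trace A} → Run downward S (suc r , c) L L′ →
    topLength L′ ≡ topLength L
  topLength-Run-suc [] = refl
  topLength-Run-suc (hit refl ∷ r) = topLength-Run-suc r
  topLength-Run-suc (_∷_ {a = zero  , _} (miss _) r) = cong suc (topLength-Run-suc r)
  topLength-Run-suc (_∷_ {a = suc _ , _} (miss _) r) = topLength-Run-suc r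

  -- The maximum stays in the first row until a letter takes its box. In `L′` that letter adds a box
  -- to the second row instead, and from then on both traces agree in the first row. So the maximum
  -- lengthens the first row only if no letter of `L` does.
  topLength-Run : ∀ {A S c} {L L′ : Trace A} → IsYoung S → Addable S (0 , c) → Addable* S L →
    Run downward S (0 , c) L L′ → suc (topLength L′) ≡ 1 ⊔ topLength L
  topLength-Run y B [] [] = refl
  topLength-Run y B (A ∷ As) (hit refl ∷ r) = cong suc (topLength-Run-suc r)
  topLength-Run {S = S} y B (A ∷ As) (_∷_ {a = zero , _} (miss b≢a) r) =
    contradiction (Addable-sameRow {S} B A refl) b≢a
  topLength-Run {S = S} y B (A ∷ As) (_∷_ {a = a@(suc _ , _)} (miss b≢a) r) =
    topLength-Run (IsYoung-⊕ a y A) (Addable-⊕ {S} A B (b≢a ∘ sym)) As r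

Increasing : List ℤ.ℤ → Set
Increasing = AllPairs ℤ._<_

record IsLongest (k : ℕ) (W : List ℤ.ℤ) : Set where
  field
    attained : ∃[ v ] (v ⊆ W × Increasing v × length v ≡ k)
    bound    : ∀ v → v ⊆ W → Increasing v → length v ≤ k
open IsLongest public

⊆-insert⁻ : ∀ {A : Set} {v : List A} xs {m ys} → v ⊆ xs ++ m ∷ ys →
  v ⊆ xs ++ ys ⊎ (∃[ v₁ ] ∃[ v₂ ] (v ≡ v₁ ++ m ∷ v₂ × v₁ ⊆ xs × v₂ ⊆ ys))
⊆-insert⁻ []       (_ ∷ˢ s)   = inj₁ s
⊆-insert⁻ []       (refl ∷ s) = inj₂ ([] , _ , refl , [] , s)
⊆-insert⁻ (x ∷ xs) (.x ∷ˢ s) with ⊆-insert⁻ xs s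
... | inj₁ t = inj₁ (x ∷ˢ t)
... | inj₂ (v₁ , v₂ , e , t , t′) = inj₂ (v₁ , v₂ , e , x ∷ˢ t , t′)
⊆-insert⁻ (x ∷ xs) (refl ∷ s) with ⊆-insert⁻ xs s
... | inj₁ t = inj₁ (refl ∷ t)
... | inj₂ (v₁ , v₂ , e , t , t′) = inj₂ (x ∷ v₁ , v₂ , cong (x ∷_) e , refl ∷ t , t′)

∷-⊆⁻ : ∀ {A : Set} {x : A} {v W : List A} → x ∷ v ⊆ W → x ∈ W
∷-⊆⁻ s = ⊆.to∈ (⊆-trans (refl ∷ ⊆.minimum _) s)

AllPairs-++⁻ : ∀ {A : Set} {R : A → A → Set} (a : List A) {b} →
  AllPairs R (a ++ b) → AllPairs R a × AllPairs R b
AllPairs-++⁻ []      rs       = [] , rs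
AllPairs-++⁻ (x ∷ a) (r ∷ rs) with AllPairs-++⁻ a rs
... | p , q = All.++⁻ˡ a r ∷ p , q

private
  -- An increasing subsequence through the greatest letter ends there, so it is one of `xs` extended
  -- by `m`.
  longest-insert : ∀ {k l} xs {m ys} → All (ℤ._< m) (xs ++ ys) →
    IsLongest k xs → IsLongest l (xs ++ ys) → IsLongest (suc k ⊔ l) (xs ++ m ∷ ys)
  longest-insert {k} {l} xs {m} {ys} <m p q = record { attained = att (≤-total (suc k) l) ; bound = bnd }
    where
    att : suc k ≤ l ⊎ l ≤ suc k → _
    att (inj₁ le) with attained q
    ... | v , s , inc , e = v , ⊆-trans s (⊆.++⁺ (⊆-refl {x = xs}) (m ∷ˢ ⊆-refl)) , inc , trans e (sym (m≤n⇒m⊔n≡n le))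
    att (inj₂ le) with attained p
    ... | v , s , inc , e = v ++ [ m ] , ⊆.++⁺ s (refl ∷ ⊆.minimum ys)
      , AllPairs.++⁺ inc ([] ∷ []) (All.map (_∷ []) (⊆.All-resp-⊆ s (All.++⁻ˡ xs <m)))
      , trans (length-++ v) (trans (+-comm _ 1) (trans (cong suc e) (sym (m≥n⇒m⊔n≡m le))))
    bnd : ∀ v → v ⊆ xs ++ m ∷ ys → Increasing v → length v ≤ suc k ⊔ l
    bnd v s inc with ⊆-insert⁻ xs s
    ... | inj₁ t = ≤-trans (bound q v t inc) (m≤n⊔m (suc k) l)
    ... | inj₂ (v₁ , z ∷ v₂ , refl , t , t′) = contradiction
      (ℤ.<-trans (All.head (AllPairs.head (proj₂ (AllPairs-++⁻ v₁ inc))))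
                 (All.lookup (All.++⁻ʳ xs <m) (∷-⊆⁻ t′)))
      (ℤ.<-irrefl refl)
    ... | inj₂ (v₁ , [] , refl , t , t′) = ≤-trans
      (≤-reflexive (trans (length-++ v₁) (+-comm _ 1)))
      (≤-trans (s≤s (bound p v₁ t (proj₁ (AllPairs-++⁻ v₁ inc)))) (m≤m⊔n (suc k) l))

  greatest : ∀ (x : ℤ.ℤ) xs → ∃[ m ] (m ∈ x ∷ xs × All (ℤ._≤ m) (x ∷ xs))
  greatest x [] = x , here refl , ℤ.≤-refl ∷ []
  greatest x (y ∷ xs) with greatest y xs
  ... | m , m∈ , ≤m with ℤ.≤-total x m
  ...   | inj₁ x≤m = m , there m∈ , x≤m ∷ ≤m
  ...   | inj₂ m≤x = x , here refl , ℤ.≤-refl ∷ All.map (λ p → ℤ.≤-trans p m≤x) ≤m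

  -- Both quantities obey the same recursion: for a word `p m q` with greatest letter `m`, the value
  -- is the larger of that of `p` plus one and that of `p q`. Neither word is a structural part of
  -- the given one, hence the induction on a bound for the length.
  Grown-longest′ : ∀ n {L} → length L ≤ n → Grown L → IsLongest (topLength L) (letters L)
  Grown-longest′ n {[]} _ g = record
    { attained = [] , [] , [] , refl ; bound = λ { .[] [] _ → z≤n } }
  Grown-longest′ (suc n) {z ∷ Z} (s≤s le) g with greatest (proj₁ z) (letters Z)
  ... | m , m∈ , ≤m with Grown-max g m∈ ≤m
  ... | L₀ , g₀ , x , i with Insert-split i
  ... | p , q , q′ , b , refl , e′ , refl , r = subst₂ IsLongest
      (trans (⊔-eq) (trans (sym (topLength-++ p _)) (cong topLength (sym e′))))
      (trans (sym (cong (letters p ++_) (cong (m ∷_) (Run-letters r))))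
        (trans (sym (map-++ proj₁ p _)) (cong letters (sym e′))))
      (longest-insert (letters p) (subst (All _) (map-++ proj₁ p q) x)
        (Grown-longest′ n (≤-trans lp (≤-trans (≤-reflexive (sym (length-++ p))) len)) (Grown-prefix p g₀ refl))
        (subst (IsLongest _) (map-++ proj₁ p q)
          (Grown-longest′ n len g₀)))
    where
    As = Grown-Addable* g₀
    Addable*-++ : ∀ {A S} (p : Trace A) {q} → IsYoung S → Addable* S (p ++ q) → IsYoung (S ⊕* p) × Addable* (S ⊕* p) q
    Addable*-++ []      y As       = y , As
    Addable*-++ (_ ∷ p) y (A ∷ As) = Addable*-++ p (IsYoung-⊕ _ y A) As
    Run-length : ∀ {A κ S b} {L L′ : Trace A} → Run κ S b L L′ → length L ≡ length L′
    Run-length []      = refl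
    Run-length (_ ∷ r) = cong suc (Run-length r)
    lp : length p ≤ length p + length q
    lp = m≤m+n _ _
    len : length (p ++ q) ≤ n
    len = ≤-trans (≤-reflexive (suc-injective (trans (sym (trans (length-++ p)
            (trans (+-suc _ _) (cong suc (trans (cong (length p +_) (sym (Run-length r))) (sym (length-++ p)))))))
            (cong length (sym e′))))) le
    ⊔-eq : suc (topLength p) ⊔ topLength (p ++ q) ≡ topLength p + suc (topLength q′)
    ⊔-eq = begin
      suc (topLength p) ⊔ topLength (p ++ q)             ≡⟨ cong₂ _⊔_ (+-comm 1 _) (topLength-++ p q) ⟩
      (topLength p + 1) ⊔ (topLength p + topLength q)    ≡⟨ sym (+-distribˡ-⊔ (topLength p) 1 _) ⟩
      topLength p + (1 ⊔ topLength q)                    ≡⟨ cong (topLength p +_) (sym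
        (topLength-Run (proj₁ yA) (first→-Addable downward (proj₁ yA)) (proj₂ yA) r)) ⟩
      topLength p + suc (topLength q′)                   ∎
      where
      open ≡-Reasoning
      yA = Addable*-++ p IsYoung-∅ As

Grown-longest : ∀ {L} → Grown L → IsLongest (topLength L) (letters L)
Grown-longest g = Grown-longest′ _ ≤-refl g

-- Shifted diagrams, doubled by reflecting each box (r , c) to (1 + c , r)

infix 4 _∈ᵈ_

_∈ᵈ_ : Box → Diagram → Set
(r , c) ∈ᵈ S = c < rowEnd S r

∈-⊕⁻ : ∀ {S b} x → Addable S b → x ∈ᵈ S ⊕ b → x ∈ᵈ S ⊎ x ≡ b
∈-⊕⁻ {S} {r₀ , c₀} (r , c) (p , _) l with r₀ ≟ r
... | no _ = inj₁ l
... | yes refl with m≤n⇒m<n∨m≡n (s≤s⁻¹ l)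
...   | inj₁ l′   = inj₁ l′
...   | inj₂ refl = inj₂ (cong (r ,_) p)

∈-⊕⁺ : ∀ {S} b x → x ∈ᵈ S → x ∈ᵈ S ⊕ b
∈-⊕⁺ {S} b (r , _) l = ≤-trans l (rowEnd-mono S b r)

∈-⊕-new : ∀ {S} b → Addable S b → b ∈ᵈ S ⊕ b
∈-⊕-new {S} b (p , _) = ≤-reflexive (sym (trans (rowEnd-⊕ S b refl) (cong suc p)))

-- The offset by one row gives diagonal boxes an image of their own, so that a shifted diagram and
-- its reflection are disjoint.
τ : Box → Box
τ (r , c) = suc c , r

infixl 5 _⊞_

_⊞_ : Diagram → Box → Diagram
S ⊞ b = S ⊕ b ⊕ τ b

record IsShifted (S : Diagram) : Set where
  field
    isYoung  : IsYoung S
    reflect⁺ : ∀ {r c} → r ≤ c → (r , c) ∈ᵈ S → (suc c , r) ∈ᵈ S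
    reflect⁻ : ∀ {r c} → r ≤ c → (suc c , r) ∈ᵈ S → (r , c) ∈ᵈ S
open IsShifted public

AddableΔ : Diagram → Box → Set
AddableΔ S b = proj₁ b ≤ proj₂ b × Addable S b

-- For a diagonal box, `τ b` lies directly below `b`; this is why `b` has to be added first.
τ-Addable : ∀ {S} b → IsShifted S → AddableΔ S b → Addable (S ⊕ b) (τ b)
τ-Addable {S} b@(r , c) σ (r≤c , B@(p , q)) = trans row₁ row₂ , ≤-antisym ub lb
  where
  y′ = IsYoung-⊕ b (isYoung σ) B
  row₁ : rowEnd (S ⊕ b) (suc c) ≡ rowEnd S (suc c)
  row₁ = rowEnd-⊕-≢ S b λ e → <⇒≢ (s≤s r≤c) e
  row₂ : rowEnd S (suc c) ≡ r
  row₂ = ≤-antisym (≮⇒≥ λ l → <-irrefl (sym p) (reflect⁻ σ r≤c l))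
    (≤-from-< λ {k} k<r → reflect⁺ σ (≤-trans (<⇒≤ k<r) r≤c) (col⇒row (isYoung σ) (subst (k <_) (sym q) k<r)))
  ub : colEnd (S ⊕ b) r ≤ suc c
  ub = ≮⇒≥ λ l → <-irrefl refl (subst (r <_) (trans row₁ row₂) (col⇒row y′ l))
  diag : ∀ {c} → r ≤ c → rowEnd S r ≡ c → r < rowEnd (S ⊕ (r , c)) c
  diag {c} r≤c p with m≤n⇒m<n∨m≡n r≤c
  ... | inj₂ refl = ≤-reflexive (sym (trans (rowEnd-⊕ S (r , r) refl) (cong suc p)))
  diag {suc c₀} _ p | inj₁ (s≤s r≤c₀) = ∈-⊕⁺ {S} (r , suc c₀) (suc c₀ , r)
    (reflect⁺ σ r≤c₀ (subst (c₀ <_) (sym p) ≤-refl))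
  lb : c < colEnd (S ⊕ b) r
  lb = row⇒col y′ (diag r≤c p)

τ-Addable-off : ∀ {S} b → IsShifted S → AddableΔ S b → proj₁ b < proj₂ b → Addable S (τ b)
τ-Addable-off {S} b σ B@(r≤c , _) r<c with τ-Addable b σ B
... | p , q = trans (sym (rowEnd-⊕-≢ S b (<⇒≢ (s≤s r≤c)))) p
            , trans (sym (colEnd-⊕-≢ S b (≢-sym (<⇒≢ r<c)))) q

upper≢τ : ∀ {a b : Box} → proj₁ a ≤ proj₂ a → proj₁ b ≤ proj₂ b → a ≢ τ b
upper≢τ {a} {r , c} a≤ b≤ refl = <-irrefl refl (≤-trans a≤ b≤)

IsShifted-∅ : IsShifted ∅
IsShifted-∅ = record { isYoung = IsYoung-∅ ; reflect⁺ = λ _ () ; reflect⁻ = λ _ () }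

IsShifted-⊞ : ∀ {S} b → IsShifted S → AddableΔ S b → IsShifted (S ⊞ b)
IsShifted-⊞ {S} b σ B@(r≤c , A) = record
  { isYoung = IsYoung-⊕ (τ b) (IsYoung-⊕ b (isYoung σ) A) T
  ; reflect⁺ = λ {r′} {c′} l m → r⁺ l (∈-⊞⁻ (r′ , c′) m)
  ; reflect⁻ = λ {r′} {c′} l m → r⁻ l (∈-⊞⁻ (suc c′ , r′) m) }
  where
  T = τ-Addable b σ B
  ∈-⊞⁻ : ∀ x → x ∈ᵈ S ⊞ b → (x ∈ᵈ S ⊎ x ≡ b) ⊎ x ≡ τ b
  ∈-⊞⁻ x m with ∈-⊕⁻ {S ⊕ b} x T m
  ... | inj₂ e = inj₂ e
  ... | inj₁ m′ = inj₁ (∈-⊕⁻ {S} x A m′)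
  up : ∀ x → x ∈ᵈ S → x ∈ᵈ S ⊞ b
  up x = ∈-⊕⁺ {S ⊕ b} (τ b) x ∘ ∈-⊕⁺ {S} b x
  r⁺ : ∀ {r′ c′} → r′ ≤ c′ →
    ((r′ , c′) ∈ᵈ S ⊎ (r′ , c′) ≡ b) ⊎ (r′ , c′) ≡ τ b → (suc c′ , r′) ∈ᵈ S ⊞ b
  r⁺ l (inj₁ (inj₁ m))    = up _ (reflect⁺ σ l m)
  r⁺ l (inj₁ (inj₂ refl)) = ∈-⊕-new {S ⊕ b} (τ b) T
  r⁺ l (inj₂ e)           = contradiction e (upper≢τ l r≤c)
  r⁻ : ∀ {r′ c′} → r′ ≤ c′ →
    ((suc c′ , r′) ∈ᵈ S ⊎ (suc c′ , r′) ≡ b) ⊎ (suc c′ , r′) ≡ τ b → (r′ , c′) ∈ᵈ S ⊞ b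
  r⁻ l (inj₁ (inj₁ m))    = up _ (reflect⁻ σ l m)
  r⁻ l (inj₁ (inj₂ refl)) = ⊥-<-refl (≤-trans r≤c l)
  r⁻ l (inj₂ refl)        = ∈-⊕⁺ {S ⊕ b} (τ b) _ (∈-⊕-new {S} b A)

AddableΔ-⊞ : ∀ {S a b} → IsShifted S → AddableΔ S a → AddableΔ S b → a ≢ b → AddableΔ (S ⊞ a) b
AddableΔ-⊞ {S} {a} {b} σ A@(a≤ , A′) (b≤ , B) p = b≤ ,
  Addable-⊕ {S ⊕ a} (τ-Addable a σ A) (Addable-⊕ {S} A′ B p) (upper≢τ b≤ a≤ ∘ sym)

⊞-cong : ∀ {S S′} b → S ≈ S′ → S ⊞ b ≈ S′ ⊞ b
⊞-cong b e = ⊕-cong (τ b) (⊕-cong b e)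

⊕-⊞-comm : ∀ S a b → S ⊕ a ⊞ b ≈ S ⊞ b ⊕ a
⊕-⊞-comm S a b = ≈-trans (⊕-cong (τ b) (⊕-comm S a b)) (⊕-comm (S ⊕ b) a (τ b))

⊞-comm : ∀ S a b → S ⊞ a ⊞ b ≈ S ⊞ b ⊞ a
⊞-comm S a b = ≈-trans (⊕-⊞-comm (S ⊕ a) (τ a) b) (⊕-cong (τ a) (⊕-⊞-comm S a b))

-- Cells of shifted tableaux

Cell : Set
Cell = Box × X′

lineEnd : Diagram → Line → Box
lineEnd S (inRow r)    = r , rowEnd S r
lineEnd S (inColumn c) = colEnd S c , c

nextCell : Diagram → Cell → Cell
nextCell S (b , l) = lineEnd S (proj₁ (next b l)) , proj₂ (next b l)

Valid : Cell → Set
Valid ((r , c) , primed _)   = r < c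
Valid ((r , c) , unprimed _) = r ≤ c

Valid⇒≤ : ∀ c → Valid c → proj₁ (proj₁ c) ≤ proj₂ (proj₁ c)
Valid⇒≤ (_ , primed _)   v = <⇒≤ v
Valid⇒≤ (_ , unprimed _) v = v

-- The end of the next line can be read off in `S`, before the growth: neither the box left nor its
-- reflection lies on that line.
data Bump (S : Diagram) : Cell → Cell → Set where
  down     : ∀ {r c x} → r < c →
             Bump S ((r , c) , unprimed x) ((suc r , rowEnd S (suc r)) , unprimed x)
  diagonal : ∀ {r c x} → r ≡ c → Bump S ((r , c) , unprimed x) ((colEnd S (suc c) , suc c) , primed x)
  right    : ∀ {r c x} → r < c →
             Bump S ((r , c) , primed x) ((colEnd S (suc c) , suc c) , primed x)

bump : ∀ S c → Valid c → Bump S c (nextCell S c)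
bump S ((r , c) , primed x) v = right v
bump S ((r , c) , unprimed x) v with r ≟ c
... | yes p = diagonal p
... | no p  = down (≤∧≢⇒< v p)

AddableCell : Diagram → Cell → Set
AddableCell S c = Valid c × Addable S (proj₁ c)

cellΔ : ∀ {S} c → AddableCell S c → AddableΔ S (proj₁ c)
cellΔ c (v , A) = Valid⇒≤ c v , A

IsShifted-cell : ∀ {S} c → IsShifted S → AddableCell S c → IsShifted (S ⊞ proj₁ c)
IsShifted-cell {S} c σ C = IsShifted-⊞ (proj₁ c) σ (cellΔ {S} c C)

nextCol≤ : ∀ {S r c} → IsYoung S → Addable S (r , c) → colEnd S (suc c) ≤ r
nextCol≤ y (refl , _) = ≮⇒≥ λ l → <-irrefl refl (<-trans (n<1+n _) (col⇒row y l))

-- `(r , r)` lies in `S`, hence so does its reflection `(suc r , r)`. Thus the row end in the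
-- doubled diagram is a box of the shifted half.
nextRow≥ : ∀ {S r c} → IsShifted S → Addable S (r , c) → r < c → suc r ≤ rowEnd S (suc r)
nextRow≥ σ (refl , _) r<c = reflect⁺ σ ≤-refl r<c

Bump-Addable : ∀ {S b l c′} → IsShifted S → AddableCell S (b , l) → Bump S (b , l) c′ →
  AddableCell (S ⊞ b) c′
Bump-Addable {S} {b} σ (_ , B) (down r<c) = nextRow≥ σ B r<c ,
  Addable-⊕ {S ⊕ b} (τ-Addable b σ (<⇒≤ r<c , B)) (below-Addable b (isYoung σ) B)
    λ e → <⇒≢ r<c (suc-injective (sym (cong proj₁ e)))
Bump-Addable {S} {b} σ (_ , B) (diagonal refl) = s≤s (nextCol≤ (isYoung σ) B) ,
  Addable-⊕ {S ⊕ b} (τ-Addable b σ (≤-refl , B)) (next→-Addable rightward b (isYoung σ) B)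
    λ e → 1+n≢n (sym (cong proj₂ e))
Bump-Addable {S} {b} σ (_ , B) (right r<c) = s≤s (≤-trans (nextCol≤ (isYoung σ) B) (<⇒≤ r<c)) ,
  Addable-⊕ {S ⊕ b} (τ-Addable b σ (<⇒≤ r<c , B)) (next→-Addable rightward b (isYoung σ) B)
    λ e → <⇒≢ (m<n⇒m<1+n r<c) (cong proj₂ e)

-- CellStep S a c c′ a′: while the diagram S of the smaller cells grows by
-- a, the cell c becomes c′ and the diagram including it grows by a′.
data CellStep (S : Diagram) (a : Box) : Cell → Cell → Box → Set where
  miss : ∀ {b l} → b ≢ a → CellStep S a (b , l) (b , l) a
  hit  : ∀ {l c′} → Bump S (a , l) c′ → CellStep S a (a , l) c′ (proj₁ c′)

cellStep : ∀ S a c → Valid c → ∃[ c′ ] ∃[ a′ ] CellStep S a c c′ a′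
cellStep S a c v with proj₁ c ≟ᵇ a
... | yes refl = _ , _ , hit (bump S c v)
... | no p     = _ , _ , miss p

CellStep-Addable : ∀ {S a c c′ a′} → IsShifted S → AddableΔ S a → AddableCell S c →
  CellStep S a c c′ a′ →
  AddableCell (S ⊞ a) c′ × AddableΔ (S ⊞ proj₁ c) a′ × (S ⊞ a ⊞ proj₁ c′ ≈ S ⊞ proj₁ c ⊞ a′)
CellStep-Addable {S} {a} {c} σ A C (miss p) =
  (proj₁ C , proj₂ (AddableΔ-⊞ σ A (cellΔ {S} c C) (p ∘ sym))) , AddableΔ-⊞ σ (cellΔ {S} c C) A p , ⊞-comm S a (proj₁ c)
CellStep-Addable {S} {a} {c′ = c′} σ A C (hit b) with Bump-Addable σ C b
... | C′ = C′ , cellΔ {S ⊞ a} c′ C′ , ≈-refl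

-- The unprimed letter x in the box b corresponds to a downward letter in b
-- and a rightward one in τ b, and conversely for primed x.
rowBox colBox : Cell → Box
rowBox (b , unprimed _) = b
rowBox (b , primed _)   = τ b
colBox (b , unprimed _) = τ b
colBox (b , primed _)   = b

rowBox-Addable : ∀ {S} c → IsShifted S → AddableCell S c → Addable S (rowBox c)
rowBox-Addable (b , unprimed _) σ (_ , B) = B
rowBox-Addable (b , primed _)   σ (v , B) = τ-Addable-off b σ (<⇒≤ v , B) v

-- The growth by `a` and `τ a` passes the downward copy of the letter, which turns it into `y₁` and
-- `y₂`, and then the rightward copy, which must turn these into `a′` and `τ a′`. So the growth is
-- again a box with its reflection when it leaves the cell.
record DoubleStep (S : Diagram) (a : Box) (c c′ : Cell) (a′ : Box) : Set where
  field
    {r₁ c₁ y₁ y₂} : Box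
    row₁ : Step downward S a (rowBox c) r₁ y₁
    row₂ : Step downward (S ⊕ a) (τ a) r₁ (rowBox c′) y₂
    col₁ : Step rightward (S ⊕ rowBox c) y₁ (colBox c) c₁ a′
    col₂ : Step rightward (S ⊕ rowBox c ⊕ y₁) y₂ c₁ (colBox c′) (τ a′)

τ-injective : ∀ {a b} → τ a ≡ τ b → a ≡ b
τ-injective refl = refl

CellStep-double : ∀ {S a c c′ a′} → IsShifted S → AddableΔ S a → AddableCell S c →
  CellStep S a c c′ a′ → DoubleStep S a c c′ a′
CellStep-double {a = a} {b , unprimed x} σ (a≤ , _) (v , _) (miss p) = record
  { row₁ = miss p ; row₂ = miss (upper≢τ v a≤)
  ; col₁ = miss (upper≢τ a≤ v ∘ sym) ; col₂ = miss (p ∘ τ-injective) }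
CellStep-double {a = a} {b , primed x} σ (a≤ , _) (v , _) (miss p) = record
  { row₁ = miss (upper≢τ a≤ (<⇒≤ v) ∘ sym) ; row₂ = miss (p ∘ τ-injective)
  ; col₁ = miss p ; col₂ = miss (upper≢τ (<⇒≤ v) a≤) }
CellStep-double {S} {a@(r , k)} σ A C (hit (down {x = x} r<k)) = record
  { row₁ = hit refl
  ; row₂ = miss (upper≢τ v′ (<⇒≤ r<k))
  ; col₁ = miss (upper≢τ v′ (<⇒≤ r<k) ∘ sym)
  ; col₂ = hit (cong (_, suc r) (trans (sym (proj₂ T))
      (cong (δ (rowEnd S (suc r)) (suc r) +_) (colEnd-⊕-≢ (S ⊕ a) (τ a) (1+n≢n ∘ sym))))) }
  where
  C′ = Bump-Addable {l = unprimed x} σ C (down r<k)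
  a′ = suc r , rowEnd S (suc r)
  v′ = proj₁ C′
  T = τ-Addable a′ (IsShifted-⊞ a σ A) C′
-- On the diagonal the downward copy is hit twice: `a` sends it to `τ a`, and the growth by `τ a`
-- sends it further to `τ a′`. It has crossed to the reflected half and the rightward copy to the
-- upper one, which is what priming records.
CellStep-double {S} {a@(r , .r)} σ A C (hit (diagonal {x = x} refl)) = record
  { row₁ = hit {b′ = τ a} (cong (suc r ,_) (sym (trans (sym (rowEnd-⊕-≢ S a (1+n≢n ∘ sym))) (proj₁ (τ-Addable a σ A)))))
  ; row₂ = hit {b′ = τ a′} (cong (2 + r ,_) (trans (sym (proj₁ T))
       (trans (rowEnd-⊕-≢ (S ⊕ a ⊕ τ a) a′ (<⇒≢ (<-trans v′ (n<1+n _))))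
              (rowEnd-⊕-≢ (S ⊕ a) (τ a) (1+n≢n ∘ sym)))))
  ; col₁ = hit {b′ = a′} (cong (_, suc r) (sym (colEnd-⊕-≢ S a (1+n≢n ∘ sym))))
  ; col₂ = miss (upper≢τ (<⇒≤ v′) (<⇒≤ v′)) }
  where
  a′ = colEnd S (suc r) , suc r
  C′ = Bump-Addable {l = unprimed x} σ C (diagonal refl)
  v′ = proj₁ C′
  T = τ-Addable a′ (IsShifted-⊞ a σ A) (<⇒≤ v′ , proj₂ C′)
CellStep-double {S} {a@(r , k)} σ A C (hit (right {x = x} r<k)) = record
  { row₁ = miss (upper≢τ (<⇒≤ r<k) (<⇒≤ r<k) ∘ sym)
  ; row₂ = hit {b′ = τ a′} (cong (2 + k ,_) (trans (sym (proj₁ T))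
       (trans (rowEnd-⊕-≢ (S ⊕ a ⊕ τ a) a′ (<⇒≢ (<-trans v′ (n<1+n _))))
              (rowEnd-⊕-≢ (S ⊕ a) (τ a) (1+n≢n ∘ sym)))))
  ; col₁ = hit {b′ = a′} (cong (_, suc k) (sym (colEnd-⊕-≢ S (τ a) (<⇒≢ (m<n⇒m<1+n r<k)))))
  ; col₂ = miss (upper≢τ (<⇒≤ v′) (<⇒≤ v′)) }
  where
  a′ = colEnd S (suc k) , suc k
  C′ = Bump-Addable {l = primed x} σ C (right r<k)
  v′ = proj₁ C′
  T = τ-Addable a′ (IsShifted-⊞ a σ A) (<⇒≤ v′ , proj₂ C′)

-- Traces of mixed insertion; the letters carry labels making them distinct

Letter : Set
Letter = X × ℕ

infixl 5 _⊞*_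

_⊞*_ : ∀ {A} → Diagram → Trace A → Diagram
S ⊞* []            = S
S ⊞* ((_ , b) ∷ L) = S ⊞ b ⊞* L

data AddableΔ* {A : Set} : Diagram → Trace A → Set where
  []  : ∀ {S} → AddableΔ* S []
  _∷_ : ∀ {S x b L} → AddableΔ S b → AddableΔ* (S ⊞ b) L → AddableΔ* S ((x , b) ∷ L)

data CellRun {A : Set} : Diagram → Cell → Trace A → Trace A → Cell → Set where
  []  : ∀ {S c} → CellRun S c [] [] c
  _∷_ : ∀ {S c c′ c″ x a a′ L L′} → CellStep S a c c′ a′ → CellRun (S ⊞ a) c′ L L′ c″ →
        CellRun S c ((x , a) ∷ L) ((x , a′) ∷ L′) c″

data CellInsert (m : Letter) : Diagram → Trace Letter → Trace Letter → Cell → Set where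
  here  : ∀ {S L L′ c} → All (λ x → value (proj₁ x) < value (proj₁ m)) (letters L) →
          CellRun S ((0 , rowEnd S 0) , unprimed (proj₁ m)) L L′ c →
          CellInsert m S L ((m , 0 , rowEnd S 0) ∷ L′) c
  there : ∀ {S x b L L′ c} → value (proj₁ x) ≤ value (proj₁ m) → CellInsert m (S ⊞ b) L L′ c →
          CellInsert m S ((x , b) ∷ L) ((x , b) ∷ L′) c

-- `-[1+ k ]` is the integer -(k+1), so that the label 0 also gives two letters. The positive copy
-- comes first, lest an increasing subsequence use both.
double : Trace Letter → Trace ℤ.ℤ
double []                  = []
double (((_ , k) , b) ∷ L) = (ℤ.+ k , b) ∷ (ℤ.-[1+ k ] , τ b) ∷ double L

CellRun-double : ∀ {S c L L′ c″} → IsShifted S → AddableΔ* S L → AddableCell S c →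
  CellRun S c L L′ c″ →
  ∃[ M ] Run downward S (rowBox c) (double L) M × Run rightward (S ⊕ rowBox c) (colBox c) M (double L′)
CellRun-double σ [] C [] = [] , [] , []
CellRun-double {S} {c} σ (_∷_ {b = a} A As) C (_∷_ {c′ = c′} s r)
  with CellStep-double σ A C s | CellStep-Addable σ A C s
... | D | C′ , _ , _ with CellRun-double (IsShifted-⊞ a σ A) As C′ r
... | M , t , t′ = _ , row₁ ∷ row₂ ∷ t , col₁ ∷ col₂ ∷ Run-≈ e t′
  where
  open DoubleStep D
  R = rowBox-Addable c σ C
  y = isYoung σ
  e₁ = Step-Addable y (proj₂ A) R row₁
  e₂ = Step-Addable (IsYoung-⊕ a y (proj₂ A)) (τ-Addable a σ A) (proj₁ e₁) row₂
  e : S ⊞ a ⊕ rowBox c′ ≈ S ⊕ rowBox c ⊕ y₁ ⊕ y₂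
  e = ≈-trans (proj₂ (proj₂ e₂)) (⊕-cong y₂ (proj₂ (proj₂ e₁)))

newΔ : ∀ {S} → IsShifted S → AddableΔ S (0 , rowEnd S 0)
newΔ σ = z≤n , first→-Addable downward (isYoung σ)

CellInsert-double : ∀ {x k S L L′ c} → IsShifted S → AddableΔ* S L → CellInsert (x , k) S L L′ c →
  ∃[ M ] Insert downward (ℤ.+ k) S (double L) M × Insert rightward ℤ.-[1+ k ] S M (double L′)
CellInsert-double {S = S} σ As (here _ r) with CellRun-double σ As (newΔ σ) r
... | M , t , t′ = _ , here refl t
    , there (here (cong (_, 0) (sym (proj₂ (τ-Addable (0 , rowEnd S 0) σ (newΔ σ))))) t′)
CellInsert-double σ (A ∷ As) (there {b = b} _ i) with CellInsert-double (IsShifted-⊞ b σ A) As i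
... | M , t , t′ = _ , there (there t) , there (there t′)

Bump-≈ : ∀ {S S′ c c′} → S ≈ S′ → Bump S c c′ → Bump S′ c c′
Bump-≈ {S′ = S′} (p , q) (down {r} {c} {x} l) =
  subst (λ z → Bump S′ ((r , c) , unprimed x) ((suc r , z) , unprimed x)) (sym (p (suc r))) (down l)
Bump-≈ {S′ = S′} (p , q) (diagonal {r} {c} {x} e) =
  subst (λ z → Bump S′ ((r , c) , unprimed x) ((z , suc c) , primed x)) (sym (q (suc c))) (diagonal e)
Bump-≈ {S′ = S′} (p , q) (right {r} {c} {x} l) =
  subst (λ z → Bump S′ ((r , c) , primed x) ((z , suc c) , primed x)) (sym (q (suc c))) (right l)

CellStep-≈ : ∀ {S S′ a c c′ a′} → S ≈ S′ → CellStep S a c c′ a′ → CellStep S′ a c c′ a′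
CellStep-≈ e (miss p) = miss p
CellStep-≈ e (hit b)  = hit (Bump-≈ e b)

AddableΔ-≈ : ∀ {S S′} b → S ≈ S′ → AddableΔ S b → AddableΔ S′ b
AddableΔ-≈ b e (l , A) = l , Addable-≈ b e A

AddableCell-≈ : ∀ {S S′} c → S ≈ S′ → AddableCell S c → AddableCell S′ c
AddableCell-≈ c e (v , A) = v , Addable-≈ (proj₁ c) e A

IsShifted-≈ : ∀ {S S′} → S ≈ S′ → IsShifted S → IsShifted S′
IsShifted-≈ e@(p , _) σ = record
  { isYoung = IsYoung-≈ e (isYoung σ)
  ; reflect⁺ = λ {r} {c} l m → subst (r <_) (p (suc c)) (reflect⁺ σ l (subst (c <_) (sym (p r)) m))
  ; reflect⁻ = λ {r} {c} l m → subst (c <_) (p r) (reflect⁻ σ l (subst (r <_) (sym (p (suc c))) m)) }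

-- Shifted tableaux as lists of cells in increasing order of the letters

value′ : X′ → ℕ
value′ (primed x)   = value x
value′ (unprimed x) = value x

cellValue : Cell → ℕ
cellValue (_ , l) = value′ l

infixl 5 _⊞ᶜ_

_⊞ᶜ_ : Diagram → List Cell → Diagram
S ⊞ᶜ []       = S
S ⊞ᶜ (c ∷ cs) = S ⊞ proj₁ c ⊞ᶜ cs

⊞ᶜ-cong : ∀ {S S′} cs → S ≈ S′ → S ⊞ᶜ cs ≈ S′ ⊞ᶜ cs
⊞ᶜ-cong []       e = e
⊞ᶜ-cong (c ∷ cs) e = ⊞ᶜ-cong cs (⊞-cong (proj₁ c) e)

data AddableCells : Diagram → List Cell → Set where
  []  : ∀ {S} → AddableCells S []
  _∷_ : ∀ {S c cs} → AddableCell S c → AddableCells (S ⊞ proj₁ c) cs → AddableCells S (c ∷ cs)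

AddableCells-≈ : ∀ {S S′ cs} → S ≈ S′ → AddableCells S cs → AddableCells S′ cs
AddableCells-≈ e [] = []
AddableCells-≈ e (_∷_ {c = c} C Cs) = AddableCell-≈ c e C ∷ AddableCells-≈ (⊞-cong (proj₁ c) e) Cs

IsShifted-⊞ᶜ : ∀ {S cs} → IsShifted S → AddableCells S cs → IsShifted (S ⊞ᶜ cs)
IsShifted-⊞ᶜ σ [] = σ
IsShifted-⊞ᶜ {S} σ (_∷_ {c = c} C Cs) = IsShifted-⊞ᶜ (IsShifted-cell c σ C) Cs

-- Push S a cs cs′ o: adding the box a to the diagram S of the cells smaller
-- than those in cs turns the latter into cs′ and adds the box o in total.
data Push : Diagram → Box → List Cell → List Cell → Box → Set where
  []  : ∀ {S a} → Push S a [] [] a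
  _∷_ : ∀ {S a c c′ a′ cs cs′ o} → CellStep S a c c′ a′ → Push (S ⊞ proj₁ c) a′ cs cs′ o →
        Push S a (c ∷ cs) (c′ ∷ cs′) o

newCell : Diagram → X → Cell
newCell S x = (0 , rowEnd S 0) , unprimed x

data Ins (x : X) : Diagram → List Cell → List Cell → Box → Set where
  here  : ∀ {S cs cs′ o} → All (λ c → value x < cellValue c) cs →
          Push S (0 , rowEnd S 0) cs cs′ o → Ins x S cs (newCell S x ∷ cs′) o
  there : ∀ {S c cs cs′ o} → cellValue c ≤ value x → Ins x (S ⊞ proj₁ c) cs cs′ o →
          Ins x S (c ∷ cs) (c ∷ cs′) o

Push-Addable : ∀ {S a cs cs′ o} → IsShifted S → AddableΔ S a → AddableCells S cs → Push S a cs cs′ o →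
  AddableCells (S ⊞ a) cs′ × AddableΔ (S ⊞ᶜ cs) o × (S ⊞ a ⊞ᶜ cs′ ≈ S ⊞ᶜ cs ⊞ o)
Push-Addable σ A [] [] = [] , A , ≈-refl
Push-Addable {S} σ A (_∷_ {c = c} C Cs) (_∷_ {cs′ = cs′} s p) with CellStep-Addable σ A C s
... | C′ , A′ , e with Push-Addable (IsShifted-cell c σ C) A′ Cs p
... | Cs′ , O , e′ = C′ ∷ AddableCells-≈ (≈-sym e) Cs′ , O , ≈-trans (⊞ᶜ-cong cs′ e) e′

Ins-Addable : ∀ {x S cs cs′ o} → IsShifted S → AddableCells S cs → Ins x S cs cs′ o →
  AddableCells S cs′ × AddableΔ (S ⊞ᶜ cs) o × (S ⊞ᶜ cs′ ≈ S ⊞ᶜ cs ⊞ o)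
Ins-Addable σ Cs (here _ p) with Push-Addable σ (newΔ σ) Cs p
... | Cs′ , O , e = newΔ σ ∷ Cs′ , O , e
Ins-Addable {S = S} σ (_∷_ {c = c} C Cs) (there _ i) with
  Ins-Addable (IsShifted-cell c σ C) Cs i
... | Cs′ , O , e = C ∷ Cs′ , O , e

CellStep-value : ∀ {S a c c′ a′} → CellStep S a c c′ a′ → cellValue c′ ≡ cellValue c
CellStep-value (miss _) = refl
CellStep-value (hit (down _)) = refl
CellStep-value (hit (diagonal _)) = refl
CellStep-value (hit (right _)) = refl

Push-value : ∀ {P : ℕ → Set} {S a cs cs′ o} → Push S a cs cs′ o →
  All (P ∘ cellValue) cs → All (P ∘ cellValue) cs′
Push-value [] [] = []
Push-value {P} (s ∷ p) (q ∷ qs) = subst P (sym (CellStep-value s)) q ∷ Push-value {P} p qs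

Ins-value : ∀ {P : ℕ → Set} {x S cs cs′ o} → Ins x S cs cs′ o → P (value x) →
  All (P ∘ cellValue) cs → All (P ∘ cellValue) cs′
Ins-value {P} (here _ p)  v qs       = v ∷ Push-value {P} p qs
Ins-value {P} (there _ i) v (q ∷ qs) = q ∷ Ins-value {P} i v qs

-- Among equal letters the later cell d has its downward letter weakly higher.

rowIndex : Cell → ℕ
rowIndex c = proj₁ (rowBox c)

_≼_ : Cell → Cell → Set
c ≼ d = cellValue c < cellValue d ⊎ (cellValue c ≡ cellValue d × rowIndex d ≤ rowIndex c)

≼-trans : ∀ {c d e} → c ≼ d → d ≼ e → c ≼ e
≼-trans (inj₁ p) (inj₁ q) = inj₁ (<-trans p q)
≼-trans (inj₁ p) (inj₂ (q , _)) = inj₁ (<-≤-trans p (≤-reflexive q))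
≼-trans (inj₂ (p , _)) (inj₁ q) = inj₁ (≤-<-trans (≤-reflexive p) q)
≼-trans (inj₂ (p , p′)) (inj₂ (q , q′)) = inj₂ (trans p q , ≤-trans q′ p′)

private
  -- The row index of a cell under CellStep, when the diagram grows by
  -- (r , k) before and by (r′ , k′) after.
  data Move (r k : ℕ) : ℕ → ℕ → ℕ → ℕ → Set where
    stay     : ∀ {ρ} → ρ ≢ r → ρ ≢ suc k → Move r k ρ ρ r k
    down     : ∀ {k′} → r < k → suc r ≤ k′ → Move r k r (suc r) (suc r) k′
    diagonal : ∀ {x} → r ≡ k → x ≤ r → Move r k r (2 + r) x (suc r)
    right    : ∀ {x} → x ≤ r → r < k → Move r k (suc k) (2 + k) x (suc k)

  ≤-skip : ∀ {m n} → m ≤ n → n ≢ m → suc m ≤ n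
  ≤-skip p q = ≤∧≢⇒< p (q ∘ sym)

  -- The later letter, in row `σ`, moves only out of the two rows of the growth. If the earlier one
  -- stayed, it is in neither row, so there is room between them. If it moved, it now stands in one
  -- of the two rows of the new growth; the later letter, being higher, can at most be moved out of
  -- the other row, by one.
  Move-mono : ∀ {r k ρ ρ′ r′ k′ σ σ′ r″ k″} →
    Move r k ρ ρ′ r′ k′ → Move r′ k′ σ σ′ r″ k″ → σ ≤ ρ → σ′ ≤ ρ′
  Move-mono (stay p q) (stay _ _) l = l
  Move-mono (stay p q) (down _ _) l = ≤-skip l p
  Move-mono (stay p q) (diagonal refl _) l = ≤-skip (≤-skip l p) q
  Move-mono (stay p q) (right _ _) l = ≤-skip l q
  Move-mono (down _ _) (stay _ _) l = m≤n⇒m≤1+n l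
  Move-mono (down _ _) (down _ _) l = ⊥-<-refl l
  Move-mono (down _ _) (diagonal _ _) l = ⊥-<-refl l
  Move-mono (down _ q) (right _ _) l = ⊥-<-refl (≤-trans l (≤-trans (n≤1+n _) q))
  Move-mono (diagonal _ _) (stay _ _) l = ≤-trans l (m≤n+m _ 2)
  Move-mono (diagonal _ p) (down _ _) _ = s≤s (m≤n⇒m≤1+n p)
  Move-mono (diagonal _ p) (diagonal refl _) _ = ⊥-<-refl p
  Move-mono (diagonal _ _) (right _ _) l = ⊥-<-refl (≤-trans (n≤1+n _) l)
  Move-mono (right _ _) (stay _ _) l = m≤n⇒m≤1+n l
  Move-mono (right p q) (down _ _) _ = s≤s (m≤n⇒m≤1+n (≤-trans p (<⇒≤ q)))
  Move-mono (right p q) (diagonal refl _) l = ⊥-<-refl (<-≤-trans q (≤-trans (n≤1+n _) p))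
  Move-mono (right _ _) (right _ _) l = ⊥-<-refl l

  CellStep-Move : ∀ {S r k c c′ r′ k′} → IsShifted S → AddableΔ S (r , k) → AddableCell S c →
    CellStep S (r , k) c c′ (r′ , k′) → Move r k (rowIndex c) (rowIndex c′) r′ k′
  CellStep-Move {S} {r} {k} {c} σ A C s@(miss {b} {l} p) = stay
    (ne ∘ Addable-sameRow {S} R (proj₂ A))
    (ne′ l ∘ Addable-sameRow {S ⊕ (r , k)} (Addable-⊕ {S} (proj₂ A) R (ne ∘ sym)) (τ-Addable (r , k) σ A))
    where
    R = rowBox-Addable c σ C
    ne″ : ∀ l → rowBox (b , l) ≢ (r , k)
    ne″ (primed _)   = upper≢τ (proj₁ A) (Valid⇒≤ c (proj₁ C)) ∘ sym
    ne″ (unprimed _) = p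
    ne = ne″ l
    ne′ : ∀ l → rowBox (b , l) ≢ τ (r , k)
    ne′ (primed _)   = p ∘ τ-injective
    ne′ (unprimed _) = upper≢τ (Valid⇒≤ c (proj₁ C)) (proj₁ A)
  CellStep-Move σ A C (hit (down r<k))  = down r<k (nextRow≥ σ (proj₂ A) r<k)
  CellStep-Move σ A C (hit (diagonal refl))    = diagonal refl (nextCol≤ (isYoung σ) (proj₂ A))
  CellStep-Move σ A C (hit (right r<k)) = right (nextCol≤ (isYoung σ) (proj₂ A)) r<k

CellStep-≼ : ∀ {S a c c′ a′ d d′ a″} → IsShifted S → AddableΔ S a → AddableCell S c →
  AddableCell (S ⊞ proj₁ c) d →
  CellStep S a c c′ a′ → CellStep (S ⊞ proj₁ c) a′ d d′ a″ → c ≼ d → c′ ≼ d′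
CellStep-≼ {S} {c = c} σ A C D s t c≼d
  rewrite CellStep-value s | CellStep-value t with c≼d
... | inj₁ p       = inj₁ p
... | inj₂ (p , q) = inj₂ (p , Move-mono (CellStep-Move σ A C s)
  (CellStep-Move (IsShifted-cell c σ C) (proj₁ (proj₂ (CellStep-Addable σ A C s))) D t) q)

Push-≼ : ∀ {S a c c′ a′ cs cs′ o} → IsShifted S → AddableΔ S a → AddableCells S (c ∷ cs) →
  CellStep S a c c′ a′ → Push (S ⊞ proj₁ c) a′ cs cs′ o → Linked _≼_ (c ∷ cs) → Linked _≼_ (c′ ∷ cs′)
Push-≼ σ A _ s [] _ = [-]
Push-≼ {S} {c = c} σ A (C ∷ D ∷ Ds) s (t ∷ p) (l ∷ ls) =
  CellStep-≼ σ A C D s t l ∷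
  Push-≼ (IsShifted-cell c σ C) (proj₁ (proj₂ (CellStep-Addable σ A C s))) (D ∷ Ds) t p ls

private
  Push-≼′ : ∀ {S a cs cs′ o} → IsShifted S → AddableΔ S a → AddableCells S cs →
    Push S a cs cs′ o → Linked _≼_ cs → Linked _≼_ cs′
  Push-≼′ σ A _  []      _  = []
  Push-≼′ σ A Cs (s ∷ p) ls = Push-≼ σ A Cs s p ls

  linked-∷ : ∀ {x cs} → All (λ c → value x < cellValue c) cs → Linked _≼_ cs → ∀ b → Linked _≼_ ((b , unprimed x) ∷ cs)
  linked-∷ []      _  _ = [-]
  linked-∷ (p ∷ _) ls _ = inj₁ p ∷ ls

  new-≼ : ∀ S c x → cellValue c ≤ value x → c ≼ newCell S x
  new-≼ S c x p with m≤n⇒m<n∨m≡n p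
  ... | inj₁ q = inj₁ q
  ... | inj₂ e = inj₂ (e , z≤n)

Ins-≼ : ∀ {x S cs cs′ o} → IsShifted S → AddableCells S cs → Ins x S cs cs′ o →
  Linked _≼_ cs → Linked _≼_ cs′
Ins-≼ {x} σ Cs (here x< p) ls = linked-∷ {x} (Push-value {value x <_} p x<) (Push-≼′ σ (newΔ σ) Cs p ls) _
Ins-≼ {x} {S} σ (_∷_ {c = c} C Cs) (there c≤x i@(here _ _)) ls =
  new-≼ (S ⊞ proj₁ c) c x c≤x ∷ Ins-≼ (IsShifted-cell c σ C) Cs i (Linked.tail ls)
Ins-≼ {S = S} σ (_∷_ {c = c} C Cs) (there c≤x i@(there _ _)) (l ∷ ls) =
  l ∷ Ins-≼ (IsShifted-cell c σ C) Cs i ls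

-- Growth of the cells, and adding a new maximal letter to a word

data Grow : List Cell → Trace Letter → List Cell → Set where
  []  : ∀ {cs} → Grow cs [] cs
  _∷_ : ∀ {cs cs₁ cs₂ m o L} → Ins (proj₁ m) ∅ cs cs₁ o → Grow cs₁ L cs₂ → Grow cs ((m , o) ∷ L) cs₂

record IsTableau (cs : List Cell) : Set where
  field
    cells  : AddableCells ∅ cs
    sorted : Linked _≼_ cs
open IsTableau public

IsTableau-[] : IsTableau []
IsTableau-[] = record { cells = [] ; sorted = [] }

Ins-IsTableau : ∀ {x cs cs′ o} → IsTableau cs → Ins x ∅ cs cs′ o → IsTableau cs′
Ins-IsTableau t i = record
  { cells = proj₁ (Ins-Addable IsShifted-∅ (cells t) i)
  ; sorted = Ins-≼ IsShifted-∅ (cells t) i (sorted t) }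

Grow-IsTableau : ∀ {cs L cs′} → IsTableau cs → Grow cs L cs′ → IsTableau cs′
Grow-IsTableau t []      = t
Grow-IsTableau t (i ∷ g) = Grow-IsTableau (Ins-IsTableau t i) g

⊞*-cong : ∀ {A S S′} (L : Trace A) → S ≈ S′ → S ⊞* L ≈ S′ ⊞* L
⊞*-cong []            e = e
⊞*-cong ((_ , b) ∷ L) e = ⊞*-cong L (⊞-cong b e)

AddableΔ*-≈ : ∀ {A S S′} {L : Trace A} → S ≈ S′ → AddableΔ* S L → AddableΔ* S′ L
AddableΔ*-≈ e [] = []
AddableΔ*-≈ e (_∷_ {b = b} A As) = AddableΔ-≈ b e A ∷ AddableΔ*-≈ (⊞-cong b e) As

Grow-Addable : ∀ {cs L cs′} → IsTableau cs → Grow cs L cs′ →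
  AddableΔ* (∅ ⊞ᶜ cs) L × (∅ ⊞ᶜ cs ⊞* L ≈ ∅ ⊞ᶜ cs′)
Grow-Addable t [] = [] , ≈-refl
Grow-Addable t (_∷_ {L = L} i g) with Ins-Addable IsShifted-∅ (cells t) i | Grow-Addable (Ins-IsTableau t i) g
... | _ , O , e | As , e′ = O ∷ AddableΔ*-≈ e As , ≈-trans (⊞*-cong L (≈-sym e)) e′

private
  Push-snoc : ∀ {S a cs cs′ o c c′ o′} → Push S a cs cs′ o → CellStep (S ⊞ᶜ cs) o c c′ o′ →
    Push S a (cs ∷ʳ c) (cs′ ∷ʳ c′) o′
  Push-snoc []      s = s ∷ []
  Push-snoc (t ∷ p) s = t ∷ Push-snoc p s

  Ins-snoc : ∀ {x S cs cs′ o c c′ o′} → Ins x S cs cs′ o → value x < cellValue c →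
    CellStep (S ⊞ᶜ cs) o c c′ o′ → Ins x S (cs ∷ʳ c) (cs′ ∷ʳ c′) o′
  Ins-snoc (here q p)  x<c s = here (All.++⁺ q (x<c ∷ [])) (Push-snoc p s)
  Ins-snoc (there q i) x<c s = there q (Ins-snoc i x<c s)

  Ins-max : ∀ {x S cs} → All (λ c → cellValue c ≤ value x) cs →
    Ins x S cs (cs ∷ʳ newCell (S ⊞ᶜ cs) x) (0 , rowEnd (S ⊞ᶜ cs) 0)
  Ins-max []       = here [] []
  Ins-max (q ∷ qs) = there q (Ins-max qs)

  Grow-snoc : ∀ {S cs L cs₁ c} → IsTableau cs → ∅ ⊞ᶜ cs ≈ S → Grow cs L cs₁ →
    All (λ m → value (proj₁ m) < cellValue c) (letters L) → AddableCell S c →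
    ∃[ L′ ] ∃[ c′ ] (CellRun S c L L′ c′ × Grow (cs ∷ʳ c) L′ (cs₁ ∷ʳ c′))
  Grow-snoc t e [] _ C = [] , _ , [] , []
  Grow-snoc {S} {cs} {c = c} t e (_∷_ {cs₁ = cs₁} {m = m} {o} i g) (q ∷ qs) C
    with Ins-Addable IsShifted-∅ (cells t) i | cellStep S o c (proj₁ C)
  ... | _ , O , e₁ | c′ , o′ , s
    with CellStep-Addable (IsShifted-≈ e (IsShifted-⊞ᶜ IsShifted-∅ (cells t))) (AddableΔ-≈ o e O) C s
  ... | C′ , _ , _ with Grow-snoc (Ins-IsTableau t i) (≈-trans e₁ (⊞-cong o e)) g
                          (subst (λ v → All (λ m → value (proj₁ m) < v) _) (sym (CellStep-value s)) qs) C′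
  ... | L′ , c″ , r , g′ = (m , o′) ∷ L′ , c″ , s ∷ r , Ins-snoc i q (CellStep-≈ (≈-sym e) s) ∷ g′

CellRun-letters : ∀ {A S c c′} {L L′ : Trace A} → CellRun S c L L′ c′ → letters L′ ≡ letters L
CellRun-letters []      = refl
CellRun-letters (_ ∷ r) = cong (_ ∷_) (CellRun-letters r)

-- Before its place nothing changes. There `p` becomes the last cell, and as all later letters are
-- strictly smaller, each of their scans meets it last: its cell stays at the end of the list.
Grow-insert : ∀ {S cs L cs₁} (α : List Letter) {β} (p : Letter) → IsTableau cs → ∅ ⊞ᶜ cs ≈ S →
  Grow cs L cs₁ → letters L ≡ α ++ β →
  All (λ c → cellValue c ≤ value (proj₁ p)) cs →
  All (λ m → value (proj₁ m) ≤ value (proj₁ p)) α → All (λ m → value (proj₁ m) < value (proj₁ p)) β →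
  ∃[ L′ ] ∃[ c ] (CellInsert p S L L′ c × Grow cs L′ (cs₁ ∷ʳ c) × letters L′ ≡ α ++ p ∷ β)
Grow-insert {S} {cs} {L} [] p@(x , _) t e g refl cs≤ [] β<
  with Grow-snoc {c = newCell S x} t e g β< (newΔ (IsShifted-≈ e (IsShifted-⊞ᶜ IsShifted-∅ (cells t))))
... | L′ , c , r , g′ = _ , c , here β< r , new ∷ g′ , cong (p ∷_) (CellRun-letters r)
  where
  new : Ins x ∅ cs (cs ∷ʳ newCell S x) (0 , rowEnd S 0)
  new = subst (λ z → Ins x ∅ cs (cs ∷ʳ ((0 , z) , unprimed x)) (0 , z)) (proj₁ e 0) (Ins-max cs≤)
Grow-insert (a ∷ α) p t e (_∷_ {m = m} {o} i g) eq cs≤ (a≤ ∷ α≤) β< with ∷-injectiveˡ eq | ∷-injectiveʳ eq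
... | refl | eq′ with Grow-insert α p (Ins-IsTableau t i)
        (≈-trans (proj₂ (proj₂ (Ins-Addable IsShifted-∅ (cells t) i))) (⊞-cong o e))
        g eq′ (Ins-value {λ v → v ≤ value (proj₁ p)} i a≤ cs≤) α≤ β<
... | L′ , c , j , g′ , e′ = _ , c , there a≤ j , i ∷ g′ , cong (a ∷_) e′

-- Standardization: labels order the letters by value, then by position.

data Agree : Letter → Letter → Set where
  ascent  : ∀ {x y i j} → value x ≤ value y → i < j → Agree (x , i) (y , j)
  descent : ∀ {x y i j} → value y < value x → j < i → Agree (x , i) (y , j)

Standard : List Letter → Set
Standard = AllPairs Agree

_⊴_ _◁_ : Letter → Letter → Set
(x , i) ⊴ (y , j) = value x ≤ value y × i < j
(x , i) ◁ (y , j) = value x < value y × i < j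

◁-trans : ∀ {p q r} → p ⊴ q → q ◁ r → p ◁ r
◁-trans (a , b) (c , d) = ≤-<-trans a c , <-trans b d

Standard-max : ∀ p Z → Standard (p ∷ Z) →
  ∃[ α ] ∃[ q ] ∃[ β ] (p ∷ Z ≡ α ++ q ∷ β × All (_⊴ q) α × All (_◁ q) β × Standard (α ++ β))
Standard-max p [] _ = [] , p , [] , refl , [] , [] , []
Standard-max p (z ∷ Z) (as ∷ s) with Standard-max z Z s
... | α , q , β , e , α⊴ , β◁ , s′ with subst (All (Agree p)) e as
...   | as′ with All-insert⁻ α as′
...     | ascent a b , as″ = p ∷ α , q , β , cong (p ∷_) e , (a , b) ∷ α⊴ , β◁ , as″ ∷ s′
...     | descent a b , _ = [] , p , z ∷ Z , refl , []
  , subst (All (_◁ p)) (sym e)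
      (All-insert⁺ α (a , b) (All.++⁺ (All.map (λ {r} x → ◁-trans {r} {q} {p} x (a , b)) α⊴)
        (All.map (λ {r} x → ◁-trans {r} {q} {p} (<⇒≤ (proj₁ x) , proj₂ x) (a , b)) β◁))) , s

-- Peaks

Rightward Downward : Box → Box → Set
Rightward (r , c) (r′ , c′) = r′ ≤ r × c < c′
Downward  (r , c) (r′ , c′) = r < r′ × c′ ≤ c

down-closed : ∀ {S r c r′ c′} → IsYoung S → r′ ≤ r → c′ ≤ c → (r , c) ∈ᵈ S → (r′ , c′) ∈ᵈ S
down-closed y r′≤r c′≤c l = col⇒row y (≤-<-trans r′≤r (row⇒col y (≤-<-trans c′≤c l)))

∈-⊞-new : ∀ {S} b → AddableΔ S b → b ∈ᵈ S ⊞ b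
∈-⊞-new {S} b (_ , B) = ∈-⊕⁺ {S ⊕ b} (τ b) b (∈-⊕-new {S} b B)

rowEnd-⊞ : ∀ {S r c} → AddableΔ S (r , c) → rowEnd (S ⊞ (r , c)) r ≡ suc c
rowEnd-⊞ {S} {r} {c} (l , p , _) = trans (rowEnd-⊕-≢ (S ⊕ (r , c)) (suc c , r) (≢-sym (<⇒≢ (s≤s l))))
  (trans (rowEnd-⊕ S (r , c) refl) (cong suc p))

turn : ∀ {S a b} → IsShifted S → AddableΔ S a → AddableΔ (S ⊞ a) b → Rightward a b ⊎ Downward a b
turn {S} {a@(r , c)} {b@(r′ , c′)} σ A B with <-≤-connex r r′
... | inj₂ r′≤r = inj₁ (r′≤r , ≰⇒> λ c′≤c →
  ∈⇒¬Addable {S ⊞ a} (proj₂ B) (down-closed y r′≤r c′≤c (∈-⊞-new {S} a A)))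
  where y = isYoung (IsShifted-⊞ a σ A)
... | inj₁ r<r′ = inj₂ (r<r′ , s≤s⁻¹ (subst (c′ <_) (rowEnd-⊞ {S} A)
        (col⇒row (isYoung (IsShifted-⊞ a σ A)) (subst (r <_) (sym (proj₂ (proj₂ B))) r<r′))))

not-both : ∀ {a b} → Rightward a b → Downward a b → ⊥
not-both (p , _) (q , _) = <-irrefl refl (<-≤-trans q p)

-- Two successive growths pass the same cell and leave it as `a′` and `b′`, whose relative position
-- is to be compared with that of `a` and `b`.
record Two (S : Diagram) (c : Cell) (a b : Box) (a′ b′ : Box) : Set where
  field
    {c₁ c₂} : Cell
    σ  : IsShifted S
    C  : AddableCell S c
    A  : AddableΔ S a
    B  : AddableΔ (S ⊞ a) b
    s  : CellStep S a c c₁ a′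
    t  : CellStep (S ⊞ a) b c₁ c₂ b′

private
  out : ∀ {S c a b a′ b′} → Two S c a b a′ b′ → Rightward a′ b′ ⊎ Downward a′ b′
  out {S} {c} {a} {b} {a′} {b′} T with CellStep-Addable σ A C s
    where open Two T
  ... | C₁ , A′ , e with CellStep-Addable (IsShifted-⊞ a σ A) B C₁ t
    where open Two T
  ... | _ , B′ , _ = turn (IsShifted-cell c σ C) A′ (AddableΔ-≈ b′ e B′)
    where open Two T

  right-by-row : ∀ {a b} → Rightward a b ⊎ Downward a b → proj₁ b ≤ proj₁ a → Rightward a b
  right-by-row (inj₁ r) _ = r
  right-by-row (inj₂ (d , _)) l = ⊥-<-refl (<-≤-trans d l)

  right-by-col : ∀ {a b} → Rightward a b ⊎ Downward a b → proj₂ a < proj₂ b → Rightward a b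
  right-by-col (inj₁ r) _ = r
  right-by-col (inj₂ (_ , d)) l = ⊥-<-refl (<-≤-trans l d)

  down-by-row : ∀ {a b} → Rightward a b ⊎ Downward a b → proj₁ a < proj₁ b → Downward a b
  down-by-row (inj₂ d) _ = d
  down-by-row (inj₁ (d , _)) l = ⊥-<-refl (<-≤-trans l d)

  down-by-col : ∀ {a b} → Rightward a b ⊎ Downward a b → proj₂ b ≤ proj₂ a → Downward a b
  down-by-col (inj₂ d) _ = d
  down-by-col (inj₁ (_ , d)) l = ⊥-<-refl (<-≤-trans d l)

  C₁-Addable : ∀ {S c a b a′ b′} (T : Two S c a b a′ b′) → AddableCell (S ⊞ a) (Two.c₁ T)
  C₁-Addable T = proj₁ (CellStep-Addable σ A C s)
    where open Two T

-- By `turn`, only two relative positions of `a′` and `b′` are possible, so in each case one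
-- coordinate decides.
right-preserved : ∀ {S c a b a′ b′} → Two S c a b a′ b′ → Rightward a b → Rightward a′ b′
right-preserved {S} {c} {a} {b} T (p , q) = go s t (out T)
  where
  open Two T using (σ; C; A; B; s; t; c₁; c₂)
  go : ∀ {a′ b′} → CellStep S a c c₁ a′ → CellStep (S ⊞ a) b c₁ c₂ b′ →
    Rightward a′ b′ ⊎ Downward a′ b′ → Rightward a′ b′
  go (miss n) (miss _)         o = p , q
  go (miss n) (hit (down _))   o = right-by-row o (≤∧≢⇒< p (n ∘ Addable-sameRow {S} (proj₂ C) (proj₂ A)))
  go (miss n) (hit (diagonal _))   o = right-by-col o (m<n⇒m<1+n q)
  go (miss n) (hit (right _))  o = right-by-col o (m<n⇒m<1+n q)
  go (hit (down _)) (miss _)   o = right-by-row o (m≤n⇒m≤1+n p)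
  go (hit (down _)) (hit _)    o = ⊥-<-refl p
  go (hit (diagonal _)) (miss n)   o = right-by-col o (≤∧≢⇒< q (n ∘ Addable-sameCol {S ⊞ a} (proj₂ (C₁-Addable T)) (proj₂ B)))
  go (hit (right _)) (miss n)  o = right-by-col o (≤∧≢⇒< q (n ∘ Addable-sameCol {S ⊞ a} (proj₂ (C₁-Addable T)) (proj₂ B)))
  go (hit (diagonal _)) (hit (right _))  o = right-by-col o ≤-refl
  go (hit (right _)) (hit (right _)) o = right-by-col o ≤-refl

-- The exception: a letter bumped from its row lands on the diagonal and is
-- bumped again at once.
Exceptional : Cell → Box → Box → Set
Exceptional c a b = (∃[ x ] c ≡ (a , unprimed x)) × b ≡ (suc (proj₁ a) , suc (proj₁ a))

down-preserved : ∀ {S c a b a′ b′} → Two S c a b a′ b′ → Downward a b → Downward a′ b′ ⊎ Exceptional c a b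
down-preserved {S} {c} {a} {b} T (p , q) = go s t (out T)
  where
  open Two T using (σ; C; A; B; s; t; c₁; c₂)
  go : ∀ {a′ b′} → CellStep S a c c₁ a′ → CellStep (S ⊞ a) b c₁ c₂ b′ →
    Rightward a′ b′ ⊎ Downward a′ b′ → Downward a′ b′ ⊎ Exceptional c a b
  go (miss n) (miss _)         o = inj₁ (p , q)
  go (miss n) (hit (down _))   o = inj₁ (down-by-row o (m<n⇒m<1+n p))
  go (miss n) (hit (diagonal _))   o = inj₁ (down-by-col o (≤∧≢⇒< q (n ∘ Addable-sameCol {S} (proj₂ C) (proj₂ A))))
  go (miss n) (hit (right _))  o = inj₁ (down-by-col o (≤∧≢⇒< q (n ∘ Addable-sameCol {S} (proj₂ C) (proj₂ A))))
  go (hit (down _)) (miss n)   o = inj₁ (down-by-row o (≤∧≢⇒< p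
    (n ∘ Addable-sameRow {S ⊞ a} (proj₂ (C₁-Addable T)) (proj₂ B))))
  go (hit (down _)) (hit (down _))   o = inj₁ (down-by-row o ≤-refl)
  go (hit (down {x = x} r<c)) (hit (diagonal e)) o = inj₂ ((x , refl) , cong (_ ,_) (sym e))
  go (hit (diagonal _)) (miss n)   o = inj₁ (down-by-col o (m≤n⇒m≤1+n q))
  go (hit (right _)) (miss n)  o = inj₁ (down-by-col o (m≤n⇒m≤1+n q))
  go (hit (diagonal _)) (hit (right _))  o = ⊥-<-refl q
  go (hit (right _)) (hit (right _)) o = ⊥-<-refl q

Peak : Box → Box → Box → Set
Peak a b d = Rightward a b × Downward b d

private
  -- The exception would need the cell in `b` and `d` as the diagonal box of the next row. If `b` is
  -- higher than `a`, then `d` is weakly north-west of `a` and already taken. If `b` is in the row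
  -- of `a`, then `a` would have hit the cell. Had the cell just been bumped down to `b`, then `b`
  -- would lie below `a`.
  peak-preserved : ∀ {S c a b d a′ b′ d′} (T : Two S c a b a′ b′) →
    Two (S ⊞ a) (Two.c₁ T) b d b′ d′ → Peak a b d → Peak a′ b′ d′
  peak-preserved {S} {c} {a} {b} {d} T U (p , q) with down-preserved U q
  ... | inj₁ q′ = right-preserved T p , q′
  ... | inj₂ ((x , e) , f) = ⊥-elim (impossible s e)
    where
    open Two T using (σ; C; A; B; s; c₁)
    low : ∀ {r} → d ≡ (suc r , suc r) → r < proj₁ a → ⊥
    low refl l = ∈⇒¬Addable {S ⊞ a ⊞ b} (proj₂ (Two.B U))
      (∈-⊕⁺ {S ⊞ a ⊕ b} (τ b) d (∈-⊕⁺ {S ⊞ a} b d (down-closed (isYoung (IsShifted-⊞ a σ A)) l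
        (≤-trans l (proj₁ A)) (∈-⊞-new {S} a A))))
    impossible : ∀ {c₁ a′} → CellStep S a c c₁ a′ → c₁ ≡ (b , unprimed x) → ⊥
    impossible (miss n) refl with m≤n⇒m<n∨m≡n (proj₁ p)
    ... | inj₁ l = low f l
    ... | inj₂ r = n (Addable-sameRow {S} (proj₂ C) (proj₂ A) r)
    impossible (hit (down _)) refl = <-irrefl refl (proj₁ p)

  peak-reflected : ∀ {S c a b d a′ b′ d′} (T : Two S c a b a′ b′) →
    Two (S ⊞ a) (Two.c₁ T) b d b′ d′ → Peak a′ b′ d′ → Peak a b d
  peak-reflected {S} {a = a} T U (p , q) with turn (Two.σ U) (Two.A U) (Two.B U)
  ... | inj₁ r = ⊥-elim (not-both (right-preserved U r) q)
  ... | inj₂ r with turn (Two.σ T) (Two.A T) (Two.B T)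
  ...   | inj₁ l = l , r
  ...   | inj₂ l with down-preserved T l
  ...     | inj₁ l′ = ⊥-elim (not-both p l′)
  -- The exception puts `b` on the diagonal, where no box is below and weakly to the left.
  ...     | inj₂ (_ , refl) = contradiction (≤-trans (proj₁ r) (proj₁ (Two.B U)))
              (λ z → <-irrefl refl (≤-trans z (proj₂ r)))

WordPeak : Letter → Letter → Letter → Set
WordPeak (x , _) (y , _) (z , _) = value x ≤ value y × value z < value y

Peaks : Trace Letter → Set
Peaks ((x , a) ∷ L@((y , b) ∷ (z , d) ∷ _)) =
  (WordPeak x y z → Peak a b d) × (Peak a b d → WordPeak x y z) × Peaks L
Peaks _ = ⊤

Peaks-tail : ∀ m L → Peaks (m ∷ L) → Peaks L
Peaks-tail _ []          _           = tt
Peaks-tail _ (_ ∷ [])    _           = tt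
Peaks-tail _ (_ ∷ _ ∷ _) (_ , _ , p) = p

CellRun-Peaks : ∀ {S c L L′ c′} → IsShifted S → AddableΔ* S L → AddableCell S c →
  CellRun S c L L′ c′ → Peaks L → Peaks L′
CellRun-Peaks σ As C [] _ = tt
CellRun-Peaks σ As C (s ∷ []) _ = tt
CellRun-Peaks σ As C (s ∷ t ∷ []) _ = tt
CellRun-Peaks {S} {c} σ (_∷_ {b = a} A As@(_∷_ {b = b} B (D ∷ _))) C (s ∷ r@(t ∷ u ∷ _)) (f , g , ps) =
    (peak-preserved T U ∘ f) , (g ∘ peak-reflected T U)
  , CellRun-Peaks (IsShifted-⊞ a σ A) As C₁ r ps
  where
  C₁ = proj₁ (CellStep-Addable σ A C s)
  T = record { σ = σ ; C = C ; A = A ; B = B ; s = s ; t = t }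
  U = record { σ = IsShifted-⊞ a σ A ; C = C₁ ; A = B ; B = D ; s = t ; t = u }

private
  -- A letter pushed out of the top row by its successor goes down, unless
  -- it was the first box of the diagram.
  first-right : ∀ {S x a c a′} → IsShifted S → AddableΔ S a → CellStep S a (newCell S x) c a′ →
    Rightward (0 , rowEnd S 0) a′ → rowEnd S 0 ≡ 0 × a ≡ (0 , 0) × a′ ≡ (0 , 1) × ∃[ y ] c ≡ ((0 , 1) , primed y)
  first-right {S} σ A (miss n) (z≤n , q) =
    contradiction (sym (Addable-sameRow {S} (proj₂ A) (proj₂ (newΔ σ)) refl)) n
  first-right {S} σ A (hit (diagonal {x = x} e)) (p , q) =
    sym e , cong (0 ,_) (sym e) , cong₂ (λ u v → u , suc v) (n≤0⇒n≡0 p) (sym e) , x , cong₂ (λ u v → (u , suc v) , primed x) (n≤0⇒n≡0 p) (sym e)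

  front : ∀ {S p L L′ c} → IsShifted S → AddableΔ* S L →
    All (λ x → value (proj₁ x) < value (proj₁ p)) (letters L) →
    CellRun S (newCell S (proj₁ p)) L L′ c → Peaks L → Peaks ((p , 0 , rowEnd S 0) ∷ L′)
  front σ As <p [] _ = tt
  front σ As <p (s ∷ []) _ = tt
  front {S} σ As@(_∷_ {b = a} A (_∷_ {b = b} B _)) (l ∷ _) r@(s ∷ t ∷ _) ps =
      (λ w → ⊥-<-refl (<-≤-trans l (proj₁ w)))
    , ⊥-elim ∘ no-peak , CellRun-Peaks σ As (newΔ σ) r ps
    where
    S₁ = S ⊞ a
    -- The exceptional case of `first-right`, with the new letter primed in `(0 , 1)`. A next box
    -- below it and weakly to the left would be in its column; but there the growth can only be the
    -- box of the letter itself, which then moves it to the right.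
    second : ∀ {y c b′} → AddableΔ S₁ b → Addable S₁ (0 , 1) → CellStep S₁ b ((0 , 1) , primed y) c b′ →
      proj₁ b′ ≤ proj₂ b′ → Downward (0 , 1) b′ → ⊥
    second B E (miss n) b≤ (d , d′) = n (sym (Addable-sameCol {S₁} (proj₂ B) E
      (≤-antisym d′ (≤-trans d b≤))))
    second B E (hit (right _)) _ (_ , s≤s ())
    no-peak : Peak (0 , rowEnd S 0) _ _ → ⊥
    no-peak (p , q) with first-right σ A s p
    ... | e , refl , refl , y , refl with CellStep-Addable σ A (newΔ σ) s
    ...   | C₁ , _ , _ with CellStep-Addable (IsShifted-⊞ a σ A) B C₁ t
    ...     | _ , B′ , _ = second B (proj₂ C₁) t (proj₁ B′) q

  insertedRight : ∀ {S b} → IsShifted S → AddableΔ S b → Rightward b (0 , rowEnd (S ⊞ b) 0)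
  insertedRight {S} {b} σ B with turn σ B (newΔ (IsShifted-⊞ b σ B))
  ... | inj₁ r = r

  insertedDown : ∀ {S b x a c a′} → IsShifted S → AddableΔ S b → AddableΔ (S ⊞ b) a →
    CellStep (S ⊞ b) a (newCell (S ⊞ b) x) c a′ → Downward (0 , rowEnd (S ⊞ b) 0) a′
  insertedDown {S} {b} {a = a} σ B A s
    with CellStep-Addable (IsShifted-⊞ b σ B) A (newΔ (IsShifted-⊞ b σ B)) s
  ... | _ , A′ , _ with turn (IsShifted-⊞ b σ B) (newΔ (IsShifted-⊞ b σ B)) A′
  ...   | inj₂ d = d
  ...   | inj₁ r = contradiction (subst (proj₂ b <_) (proj₁ (first-right (IsShifted-⊞ b σ B) A s r))
                     (proj₂ (insertedRight σ B))) λ ()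

-- The new letter follows weakly smaller letters and precedes strictly smaller ones: with neighbours
-- on both sides it is the top of a peak, and it belongs to no other peak. The boxes must show the
-- same.
CellInsert-Peaks : ∀ {S p L L′ c} → IsShifted S → AddableΔ* S L → CellInsert p S L L′ c → Peaks L → Peaks L′
CellInsert-Peaks σ As (here <p r) ps = front σ As <p r ps
CellInsert-Peaks σ (A ∷ []) (there _ (here _ [])) ps = tt
CellInsert-Peaks σ (_∷_ {b = b} B As@(A ∷ _)) (there {x = x} x≤p (here <p@(l ∷ _) r@(s ∷ _))) ps =
    (λ _ → insertedRight σ B , insertedDown σ B A s) , (λ _ → x≤p , l)
  , front (IsShifted-⊞ b σ B) As <p r (Peaks-tail _ _ ps)
CellInsert-Peaks {L = _ ∷ L} σ (_∷_ {b = b} B As@(_∷_ {b = b′} B′ _)) (there _ i@(there y≤p j@(here _ _))) ps =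
    (λ w → ⊥-<-refl (<-≤-trans (proj₂ w) y≤p))
  , (λ w → contradiction (proj₁ (proj₂ w)) λ ())
  , CellInsert-Peaks (IsShifted-⊞ b σ B) As i (Peaks-tail _ L ps)
CellInsert-Peaks σ (_∷_ {b = b} B As) (there _ i@(there _ (there _ _))) (f , g , ps) =
  f , g , CellInsert-Peaks (IsShifted-⊞ b σ B) As i ps

-- Traces of standardized words

record Traced (Z : List Letter) : Set where
  field
    trace   : Trace Letter
    cs      : List Cell
    spells  : letters trace ≡ Z
    grows   : Grow [] trace cs
    doubles : Grown (double trace)
    peaks   : Peaks trace

private
  double-below : ∀ {k} L → All (λ x → proj₂ x < k) (letters L) →
    All (ℤ._< ℤ.+ k) (letters (double L)) × All (ℤ.-[1+ k ] ℤ.<_) (letters (double L))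
  double-below []      []       = [] , []
  double-below (_ ∷ L) (l ∷ ls) with double-below L ls
  ... | p , q = ℤ.+<+ l ∷ ℤ.-<+ ∷ p , ℤ.-<+ ∷ ℤ.-<- l ∷ q

  double-insert : ∀ {p L L′ c} → AddableΔ* ∅ L → CellInsert p ∅ L L′ c →
    All (λ x → proj₂ x < proj₂ p) (letters L) → Grown (double L) → Grown (double L′)
  double-insert {p} {L} As i <p g with CellInsert-double IsShifted-∅ As i | double-below L <p
  ... | M , j , j′ | <k , k< with Insert-letters j
  ... | xs , ys , e , e′ = add {rightward} (add {downward} g <k j)
    (subst (All _) (sym e′) (All-insert⁺ xs ℤ.-<+ (subst (All _) e k<))) j′

  traced′ : ∀ n Z → length Z ≤ n → Standard Z → Traced Z
  traced′ _ [] _ _ = record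
    { trace = [] ; cs = [] ; spells = refl ; grows = [] ; doubles = [] ; peaks = tt }
  traced′ (suc n) (z ∷ Z) (s≤s le) s with Standard-max z Z s
  ... | α , p , β , e , α⊴ , β◁ , s′
    with traced′ n (α ++ β) (≤-trans (≤-reflexive (suc-injective (trans (sym (length-insert α)) (cong length (sym e))))) le) s′
    where
    length-insert : ∀ α {β} → length (α ++ p ∷ β) ≡ suc (length (α ++ β))
    length-insert α {β} = trans (length-++ α) (trans (+-suc (length α) _) (cong suc (sym (length-++ α))))
  ... | t with Grow-insert α p IsTableau-[] ≈-refl (Traced.grows t) (Traced.spells t) []
                 (All.map proj₁ α⊴) (All.map proj₁ β◁)
  ... | L′ , c , i , g , e′ = record
    { trace = L′ ; cs = _ ; spells = trans e′ (sym e) ; grows = g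
    ; doubles = double-insert As i (subst (All _) (sym (Traced.spells t))
        (All.++⁺ (All.map proj₂ α⊴) (All.map proj₂ β◁))) (Traced.doubles t)
    ; peaks = CellInsert-Peaks IsShifted-∅ As i (Traced.peaks t) }
    where
    As = proj₁ (Grow-Addable IsTableau-[] (Traced.grows t))

traced : ∀ Z → Standard Z → Traced Z
traced Z = traced′ (length Z) Z ≤-refl

-- Hook subwords and increasing subsequences of the doubled word

private
  -- With `N` the length of the whole word, `i` stays below `N`; so the value decides first and the
  -- position breaks ties.
  labelled : ℕ → ℕ → Word → List Letter
  labelled N i []      = []
  labelled N i (x ∷ w) = (x , value x * N + i) ∷ labelled N (suc i) w

  labelled-word : ∀ N i w → map proj₁ (labelled N i w) ≡ w
  labelled-word N i []      = refl
  labelled-word N i (x ∷ w) = cong (x ∷_) (labelled-word N (suc i) w)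

  labelled-agree : ∀ N x {i} j w → i < j → length w + j ≤ N →
    All (Agree (x , value x * N + i)) (labelled N j w)
  labelled-agree N x j [] _ _ = []
  labelled-agree N x {i} j (y ∷ w) i<j le = agree ∷ labelled-agree N x (suc j) w (m<n⇒m<1+n i<j)
      (≤-trans (≤-reflexive (+-suc (length w) j)) le)
    where
    j<N : j < N
    j<N = ≤-trans (s≤s (m≤n+m j (length w))) le
    agree : Agree (x , value x * N + i) (y , value y * N + j)
    agree with ≤-<-connex (value x) (value y)
    ... | inj₁ x≤y = ascent x≤y (+-mono-≤-< (*-monoˡ-≤ N x≤y) i<j)
    ... | inj₂ y<x = descent y<x (begin-strict
      value y * N + j   <⟨ +-monoʳ-< (value y * N) j<N ⟩
      value y * N + N   ≡⟨ +-comm (value y * N) N ⟩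
      suc (value y) * N ≤⟨ *-monoˡ-≤ N y<x ⟩
      value x * N       ≤⟨ m≤m+n _ i ⟩
      value x * N + i   ∎)
      where open ≤-Reasoning

  labelled-standard : ∀ N i w → length w + i ≤ N → Standard (labelled N i w)
  labelled-standard N i []      _  = []
  labelled-standard N i (x ∷ w) le = labelled-agree N x (suc i) w ≤-refl le′ ∷ labelled-standard N (suc i) w le′
    where le′ = ≤-trans (≤-reflexive (+-suc (length w) i)) le

standardize : ∀ w → ∃[ Z ] (map proj₁ Z ≡ w × Standard Z)
standardize w = labelled (length w) 0 w , labelled-word _ 0 w
  , labelled-standard _ 0 w (≤-reflexive (+-identityʳ _))

doubleWord : List Letter → List ℤ.ℤ
doubleWord []            = []
doubleWord ((_ , k) ∷ Z) = ℤ.+ k ∷ ℤ.-[1+ k ] ∷ doubleWord Z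

letters-double : ∀ L → letters (double L) ≡ doubleWord (letters L)
letters-double []      = refl
letters-double (_ ∷ L) = cong (λ z → _ ∷ _ ∷ z) (letters-double L)

AllPairs-⊆ : ∀ {A : Set} {R : A → A → Set} {xs ys} → xs ⊆ ys → AllPairs R ys → AllPairs R xs
AllPairs-⊆ []         _        = []
AllPairs-⊆ (_ ∷ˢ s)   (_ ∷ rs) = AllPairs-⊆ s rs
AllPairs-⊆ (refl ∷ s) (r ∷ rs) = ⊆.All-resp-⊆ s r ∷ AllPairs-⊆ s rs

⊆-map⁻ : ∀ {A B : Set} (f : A → B) {v} Z → v ⊆ map f Z → ∃[ V ] (V ⊆ Z × map f V ≡ v)
⊆-map⁻ f []      []         = [] , [] , refl
⊆-map⁻ f (z ∷ Z) (_ ∷ˢ s)   with ⊆-map⁻ f Z s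
... | V , t , e = V , z ∷ˢ t , e
⊆-map⁻ f (z ∷ Z) (refl ∷ s) with ⊆-map⁻ f Z s
... | V , t , e = z ∷ V , refl ∷ t , cong (f z ∷_) e

map-++⁻ : ∀ {A B : Set} (f : A → B) V xs {ys} → map f V ≡ xs ++ ys →
  ∃[ V₁ ] ∃[ V₂ ] (V ≡ V₁ ++ V₂ × map f V₁ ≡ xs × map f V₂ ≡ ys)
map-++⁻ f V       []       e = [] , V , refl , refl , e
map-++⁻ f []      (x ∷ xs) ()
map-++⁻ f (v ∷ V) (x ∷ xs) e with map-++⁻ f V xs (cong (List.drop 1) e) | cong List.head e
... | V₁ , V₂ , refl , e₁ , e₂ | refl = v ∷ V₁ , V₂ , refl , cong (f v ∷_) e₁ , e₂

private
  pos neg : Letter → ℤ.ℤ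
  pos (_ , k) = ℤ.+ k
  neg (_ , k) = ℤ.-[1+ k ]

  _>ᴸ_ _<ᴸ_ : Letter → Letter → Set
  p >ᴸ q = proj₂ q < proj₂ p
  p <ᴸ q = proj₂ p < proj₂ q

  neg-⊆ : ∀ Z → map neg Z ⊆ doubleWord Z
  neg-⊆ []      = []
  neg-⊆ (_ ∷ Z) = _ ∷ˢ refl ∷ neg-⊆ Z

  pos-⊆ : ∀ Z → map pos Z ⊆ doubleWord Z
  pos-⊆ []      = []
  pos-⊆ (_ ∷ Z) = refl ∷ _ ∷ˢ pos-⊆ Z

  doubleWord-++ : ∀ Y Z → doubleWord (Y ++ Z) ≡ doubleWord Y ++ doubleWord Z
  doubleWord-++ []      Z = refl
  doubleWord-++ (_ ∷ Y) Z = cong (λ z → _ ∷ _ ∷ z) (doubleWord-++ Y Z)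

  doubleWord-⊆ : ∀ {Y Z} → Y ⊆ Z → doubleWord Y ⊆ doubleWord Z
  doubleWord-⊆ []         = []
  doubleWord-⊆ (_ ∷ˢ s)   = _ ∷ˢ _ ∷ˢ doubleWord-⊆ s
  doubleWord-⊆ (refl ∷ s) = refl ∷ refl ∷ doubleWord-⊆ s

  increasing-hook : ∀ D P → AllPairs _>ᴸ_ D → AllPairs _<ᴸ_ P → Increasing (map neg D ++ map pos P)
  increasing-hook D P d p = AllPairs.++⁺ (AllPairs.map⁺ (AllPairs.map ℤ.-<- d))
    (AllPairs.map⁺ (AllPairs.map ℤ.+<+ p))
    (All.map⁺ (All.universal (λ _ → All.map⁺ (All.universal (λ _ → ℤ.-<+) P)) D))

  agree-> : ∀ {p q} → Agree p q → proj₁ p >ˣ proj₁ q → p >ᴸ q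
  agree-> (descent _ l) _ = l
  agree-> (ascent l _)  g = ⊥-<-refl (<-≤-trans g l)

  agree-≤ : ∀ {p q} → Agree p q → proj₁ p ≤ˣ proj₁ q → p <ᴸ q
  agree-≤ (ascent _ l)  _ = l
  agree-≤ (descent l _) g = ⊥-<-refl (<-≤-trans l g)

  agree->⁻ : ∀ {p q} → Agree p q → p >ᴸ q → proj₁ p >ˣ proj₁ q
  agree->⁻ (descent l _) _ = l
  agree->⁻ (ascent _ l)  g = ⊥-<-refl (<-trans g l)

  agree-≤⁻ : ∀ {p q} → Agree p q → p <ᴸ q → proj₁ p ≤ˣ proj₁ q
  agree-≤⁻ (ascent l _)  _ = l
  agree-≤⁻ (descent _ l) g = ⊥-<-refl (<-trans g l)

-- Negative copies are taken in the descending part and positive copies from the turning point on,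
-- which is counted once.
hook⇒increasing : ∀ {Z u} → Standard Z → IsHookSubword u (map proj₁ Z) →
  ∃[ v ] (v ⊆ doubleWord Z × Increasing v × length v ≡ length u)
hook⇒increasing {Z} {u} s record { subsequence = sub ; hook = ds , x , is , refl , dec , inc }
  with ⊆-map⁻ proj₁ Z sub
... | V , t , e with map-++⁻ proj₁ V ds e
... | D , P , refl , refl , e₂ =
    map neg D ++ map pos P
  , ⊆-trans (subst (map neg D ++ map pos P ⊆_) (sym (doubleWord-++ D P)) (⊆.++⁺ (neg-⊆ D) (pos-⊆ P))) (doubleWord-⊆ t)
  , increasing-hook D P
      (AllPairs.zipWith (λ (a , b) → agree-> a b) (proj₁ sDP ,
        AllPairs.map⁻ (proj₁ (AllPairs-++⁻ (map proj₁ D) (Linked⇒AllPairs (λ p q → <-trans q p) dec)))))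
      (AllPairs.zipWith (λ (a , b) → agree-≤ a b) (proj₂ sDP ,
        AllPairs.map⁻ (subst (AllPairs _≤ˣ_) (sym e₂) (Linked⇒AllPairs ≤-trans inc))))
  , len
  where
  sDP = AllPairs-++⁻ D (AllPairs-⊆ t s)
  len : length (map neg D ++ map pos P) ≡ length (map proj₁ D ++ x ∷ is)
  len = trans (length-++ (map neg D)) (trans (cong₂ _+_ (trans (length-map neg D) (sym (length-map proj₁ D)))
    (trans (length-map pos P) (trans (sym (length-map proj₁ P)) (cong length e₂)))) (sym (length-++ (map proj₁ D))))

HookLike : {A : Set} (D R : A → A → Set) → List A → Set
HookLike D R w = ∃[ ds ] ∃[ x ] ∃[ is ] (w ≡ ds ++ x ∷ is × Linked D (ds ∷ʳ x) × Linked R (x ∷ is))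

hook-∷ : ∀ {A : Set} {D R : A → A → Set} {x y w} → D x y → HookLike D R (y ∷ w) → HookLike D R (x ∷ y ∷ w)
hook-∷ d ([]     , _ , _  , refl , _ , r) = _ ∷ [] , _ , _ , refl , d ∷ [-] , r
hook-∷ d (_ ∷ ds , _ , is , refl , l , r) = _ ∷ _ ∷ ds , _ , is , refl , d ∷ l , r

private
  ascending-hook : ∀ x w → AllPairs _≤ˣ_ (x ∷ w) → HookWord (x ∷ w)
  ascending-hook x w p = [] , x , w , refl , [-] , AllPairs⇒Linked p

  -- The turning point is the smaller of the two letters where `ds` and `is` meet, and the former in
  -- case of a tie.
  hookWord : ∀ ds is → ds ++ is ≢ [] → AllPairs _>ˣ_ ds → AllPairs _≤ˣ_ is → HookWord (ds ++ is)
  hookWord []            []       ne _ _ = contradiction refl ne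
  hookWord []            (x ∷ is) _ _ p = ascending-hook x is p
  hookWord (d ∷ [])      []       _ _ _ = [] , d , [] , refl , [-] , [-]
  hookWord (d ∷ [])      (x ∷ is) _ _ p with ≤-<-connex (value d) (value x)
  ... | inj₁ d≤x = [] , d , x ∷ is , refl , [-] , d≤x ∷ AllPairs⇒Linked p
  ... | inj₂ x<d = hook-∷ x<d (ascending-hook x is p)
  hookWord (d ∷ d′ ∷ ds) is       _ ((l ∷ _) ∷ q) p = hook-∷ l (hookWord (d′ ∷ ds) is (λ ()) q p)

  lowerBound : ∀ v → ∃[ k ] All (ℤ.-[1+ k ] ℤ.<_) v
  lowerBound [] = 0 , []
  lowerBound (z ∷ v) with lowerBound v
  lowerBound (ℤ.+ n ∷ v)      | k , b = k , ℤ.-<+ ∷ b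
  lowerBound (ℤ.-[1+ n ] ∷ v) | k , b = k ⊔ suc n
    , ℤ.-<- (m≤n⊔m k (suc n))
    ∷ All.map (ℤ.≤-<-trans (ℤ.-≤- (m≤m⊔n k (suc n)))) b

  ascending-part : ∀ {k} Z {v} → v ⊆ doubleWord Z → Increasing v → All (ℤ.+ k ℤ.<_) v →
    ∃[ P ] (P ⊆ Z × length P ≡ length v × AllPairs _<ᴸ_ P × All (λ p → k < proj₂ p) P)
  ascending-part [] [] _ _ = [] , [] , refl , [] , []
  ascending-part (z ∷ Z) (_ ∷ˢ _ ∷ˢ s) inc b with ascending-part Z s inc b
  ... | P , t , e , a , c = P , z ∷ˢ t , e , a , c
  ascending-part (z ∷ Z) (_ ∷ˢ refl ∷ s) inc (() ∷ _)
  ascending-part (z ∷ Z) (refl ∷ refl ∷ s) ((() ∷ _) ∷ _) _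
  ascending-part ((x , l) ∷ Z) (refl ∷ _ ∷ˢ s) (i ∷ inc) (ℤ.+<+ q ∷ _) with ascending-part {l} Z s inc i
  ... | P , t , e , a , c = (x , l) ∷ P , refl ∷ t , cong suc e , c ∷ a , q ∷ All.map (<-trans q) c

  -- In an increasing sequence no negative letter follows a positive one, so `v` splits into
  -- negative copies and then positive ones. The bound by `k` makes the labels of the negative part
  -- descend.
  hook-part : ∀ {k} Z {v} → v ⊆ doubleWord Z → Increasing v → All (ℤ.-[1+ k ] ℤ.<_) v →
    ∃[ D ] ∃[ P ] (D ++ P ⊆ Z × length (D ++ P) ≡ length v × AllPairs _>ᴸ_ D ×
      All (λ p → proj₂ p < k) D × AllPairs _<ᴸ_ P)
  hook-part [] [] _ _ = [] , [] , [] , refl , [] , [] , []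
  hook-part (z ∷ Z) (_ ∷ˢ _ ∷ˢ s) inc b with hook-part Z s inc b
  ... | D , P , t , e , d , c , a = D , P , z ∷ˢ t , e , d , c , a
  -- The two copies of a letter form a descent, so `v` cannot contain both.
  hook-part (z ∷ Z) (refl ∷ refl ∷ s) ((() ∷ _) ∷ _) _
  hook-part ((x , l) ∷ Z) (refl ∷ _ ∷ˢ s) (i ∷ inc) b with ascending-part {l} Z s inc i
  ... | P , t , e , a , c = [] , (x , l) ∷ P , refl ∷ t , cong suc e , [] , [] , c ∷ a
  hook-part ((x , l) ∷ Z) (_ ∷ˢ refl ∷ s) (i ∷ inc) (ℤ.-<- q ∷ _) with hook-part {l} Z s inc i
  ... | D , P , t , e , d , c , a = (x , l) ∷ D , P , refl ∷ t , cong suc e , c ∷ d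
      , q ∷ All.map (λ r → <-trans r q) c , a

increasing⇒hook : ∀ {Z v} → Standard Z → v ⊆ doubleWord Z → Increasing v → v ≢ [] →
  ∃[ u ] (IsHookSubword u (map proj₁ Z) × length u ≡ length v)
increasing⇒hook {Z} {v} s sub inc ne with hook-part Z sub inc (proj₂ (lowerBound v))
... | D , P , t , e , d , _ , a = map proj₁ (D ++ P)
    , record { subsequence = ⊆.map⁺ proj₁ t ; hook = hook }
    , trans (length-map proj₁ (D ++ P)) e
  where
  sDP = AllPairs-++⁻ D (AllPairs-⊆ t s)
  nonempty : ∀ (xs : List Letter) → length xs ≡ length v → map proj₁ xs ≢ []
  nonempty []      eq _ = ne (length-0 (sym eq))
    where
    length-0 : ∀ {v : List ℤ.ℤ} → length v ≡ 0 → v ≡ []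
    length-0 {[]} _ = refl
  hook : HookWord (map proj₁ (D ++ P))
  hook = subst HookWord (sym (map-++ proj₁ D P)) (hookWord (map proj₁ D) (map proj₁ P)
    (nonempty (D ++ P) e ∘ trans (map-++ proj₁ D P))
    (AllPairs.map⁺ (AllPairs.zipWith (λ (x , y) → agree->⁻ x y) (proj₁ sDP , d)))
    (AllPairs.map⁺ (AllPairs.zipWith (λ (x , y) → agree-≤⁻ x y) (proj₂ sDP , a))))

-- The length of the first row

⊞*-double : ∀ S L → S ⊞* L ≡ S ⊕* double L
⊞*-double S []            = refl
⊞*-double S ((_ , b) ∷ L) = ⊞*-double (S ⊞ b) L

module _ {Z} (s : Standard Z) (t : Traced Z) where
  open Traced t

  firstRow : ℕ
  firstRow = rowEnd (∅ ⊞* trace) 0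

  firstRow-longest : IsLongest firstRow (doubleWord Z)
  firstRow-longest = subst₂ IsLongest
    (sym (trans (cong (λ S → rowEnd S 0) (⊞*-double ∅ trace))
      (trans (topLength-rowEnd ∅ (double trace)) (+-identityʳ _))))
    (trans (letters-double trace) (cong doubleWord spells)) (Grown-longest doubles)

  hook≤firstRow : ∀ u → IsHookSubword u (map proj₁ Z) → length u ≤ firstRow
  hook≤firstRow u h with hook⇒increasing s h
  ... | v , sub , inc , e = subst (_≤ firstRow) e (bound firstRow-longest v sub inc)

  firstRow-hook : Z ≢ [] → ∃[ u ] (IsHookSubword u (map proj₁ Z) × length u ≡ firstRow)
  firstRow-hook ne with attained firstRow-longest
  ... | v , sub , inc , e with increasing⇒hook s sub inc nonempty
    where
    some : ∀ {Z} → Z ≢ [] → ∃[ z ] [ z ] ⊆ doubleWord Z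
    some {[]}    ne = contradiction refl ne
    some {_ ∷ Z} _  = _ , refl ∷ ⊆.minimum _
    nonempty : v ≢ []
    nonempty refl = contradiction (subst (1 ≤_) (sym e)
      (bound firstRow-longest _ (proj₂ (some ne)) ([] ∷ []))) λ ()
  ...   | u , h , e′ = u , h , trans e′ e

-- Entries of fillings

at : {A : Set} → List A → ℕ → Maybe A
at l i = head (drop i l)

at-[] : ∀ {A : Set} i → at {A} [] i ≡ nothing
at-[] zero    = refl
at-[] (suc i) = refl

at-< : ∀ {A : Set} (l : List A) {i x} → at l i ≡ just x → i < length l
at-< []      {i} e = contradiction (trans (sym e) (at-[] i)) λ ()
at-< (y ∷ l) {zero}  e = z<s
at-< (y ∷ l) {suc i} e = s≤s (at-< l e)

at-just : ∀ {A : Set} (l : List A) {i} → i < length l → ∃[ x ] at l i ≡ just x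
at-just (y ∷ l) {zero}  _       = y , refl
at-just (y ∷ l) {suc i} (s≤s p) = at-just l p

at-put : ∀ {A : Set} (l : List A) i x → i ≤ length l → at (putInRow l i x) i ≡ just x
at-put []      zero    x _       = refl
at-put (y ∷ l) zero    x _       = refl
at-put (y ∷ l) (suc i) x (s≤s p) = at-put l i x p

at-put-≢ : ∀ {A : Set} (l : List A) {i j} x → i ≤ length l → j ≢ i → at (putInRow l i x) j ≡ at l j
at-put-≢ []      {zero}  {zero}  x _ n = contradiction refl n
at-put-≢ []      {zero}  {suc j} x _ n = at-[] j
at-put-≢ (y ∷ l) {zero}  {zero}  x _ n = contradiction refl n
at-put-≢ (y ∷ l) {zero}  {suc j} x _ n = refl
at-put-≢ (y ∷ l) {suc i} {zero}  x _ n = refl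
at-put-≢ (y ∷ l) {suc i} {suc j} x (s≤s p) n = at-put-≢ l x p (n ∘ cong suc)

putInRow-old : ∀ {A : Set} (l : List A) {i x} → i < length l → length (putInRow l i x) ≡ length l
putInRow-old (y ∷ l) {zero}  _       = refl
putInRow-old (y ∷ l) {suc i} (s≤s p) = cong suc (putInRow-old l p)

putInRow-new : ∀ {A : Set} (l : List A) {x} → putInRow l (length l) x ≡ l ++ [ x ]
putInRow-new []      = refl
putInRow-new (y ∷ l) = cong (y ∷_) (putInRow-new l)

entry-row : ∀ {A} (T : Filling A) r i → entry T (r , r + i) ≡ at (row T r) i
entry-row []      zero    i = sym (at-[] i)
entry-row []      (suc r) i = sym (at-[] i)
entry-row (ρ ∷ T) zero    i = refl
entry-row (ρ ∷ T) (suc r) i = entry-row T r i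

Fits : ∀ {A} → Filling A → Box → Set
Fits T (r , c) = r ≤ c × r ≤ length T × c ≤ r + length (row T r)

entry-Fits : ∀ {A} (T : Filling A) {b x} → entry T b ≡ just x →
  proj₁ b ≤ proj₂ b × proj₁ b < length T × proj₂ b < proj₁ b + length (row T (proj₁ b))
entry-Fits (ρ ∷ T) {zero  , c}     e = z≤n , z<s , at-< ρ e
entry-Fits (ρ ∷ T) {suc r , suc c} e with entry-Fits T e
... | p , q , s = s≤s p , s≤s q , s≤s s

entry-put : ∀ {A} (T : Filling A) b x → Fits T b → entry (put T b x) b ≡ just x
entry-put []      (zero  , zero)  x _ = refl
entry-put []      (zero  , suc c) x (_ , _ , ())
entry-put (ρ ∷ T) (zero  , c)     x (_ , _ , p) = at-put ρ c x p
entry-put (ρ ∷ T) (suc r , suc c) x (p , q , s) = entry-put T (r , c) x (s≤s⁻¹ p , s≤s⁻¹ q , s≤s⁻¹ s)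

entry-put-≢ : ∀ {A} (T : Filling A) {b b′} x → Fits T b → b′ ≢ b → entry (put T b x) b′ ≡ entry T b′
entry-put-≢ [] {zero , zero} {zero  , zero}  x f n = contradiction refl n
entry-put-≢ [] {zero , zero} {zero  , suc c} x f n = at-[] c
entry-put-≢ [] {zero , zero} {suc r , zero}  x f n = refl
entry-put-≢ [] {zero , zero} {suc r , suc c} x f n = refl
entry-put-≢ [] {zero , suc _} x (_ , _ , ()) n
entry-put-≢ (ρ ∷ T) {zero , c}  {zero  , c′} x (_ , _ , p) n = at-put-≢ ρ x p (n ∘ cong (0 ,_))
entry-put-≢ (ρ ∷ T) {zero , c}  {suc r′ , c′} x f n = agree c′
  where
  agree : ∀ c′ → entry (putInRow ρ c x ∷ T) (suc r′ , c′) ≡ entry (ρ ∷ T) (suc r′ , c′)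
  agree zero    = refl
  agree (suc _) = refl
entry-put-≢ (ρ ∷ T) {suc r , suc c} {zero   , c′}     x f n = refl
entry-put-≢ (ρ ∷ T) {suc r , suc c} {suc r′ , zero}   x f n = refl
entry-put-≢ (ρ ∷ T) {suc r , suc c} {suc r′ , suc c′} x (p , q , s) n =
  entry-put-≢ T x (s≤s⁻¹ p , s≤s⁻¹ q , s≤s⁻¹ s) λ { refl → n refl }

put-old-row : ∀ {A} (T : Filling A) {b x y} → entry T b ≡ just y → ∀ i →
  length (row (put T b x) i) ≡ length (row T i)
put-old-row (ρ ∷ T) {zero  , c}     e zero    = putInRow-old ρ (at-< ρ e)
put-old-row (ρ ∷ T) {zero  , c}     e (suc i) = refl
put-old-row (ρ ∷ T) {suc r , suc c} e zero    = refl
put-old-row (ρ ∷ T) {suc r , suc c} e (suc i) = put-old-row T e i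

put-old-shape : ∀ {A} (T : Filling A) {b x y} → entry T b ≡ just y → shape (put T b x) ≡ shape T
put-old-shape (ρ ∷ T) {zero  , c}     e = cong (_∷ _) (putInRow-old ρ (at-< ρ e))
put-old-shape (ρ ∷ T) {suc r , suc c} e = cong (_ ∷_) (put-old-shape T e)

size-∷ : ∀ {A} ρ (T : Filling A) → size (ρ ∷ T) ≡ length ρ + size T
size-∷ ρ T = length-++ ρ

put-old-size : ∀ {A} (T : Filling A) {b x y} → entry T b ≡ just y → size (put T b x) ≡ size T
put-old-size (ρ ∷ T) {zero  , c} {x} e = trans (size-∷ (putInRow ρ c x) T)
  (trans (cong (_+ size T) (putInRow-old ρ (at-< ρ e))) (sym (size-∷ ρ T)))
put-old-size (ρ ∷ T) {suc r , suc c} {x} e = trans (size-∷ ρ (put T (r , c) x))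
  (trans (cong (length ρ +_) (put-old-size T e)) (sym (size-∷ ρ T)))

AtEnd : ∀ {A} → Filling A → Box → Set
AtEnd T (r , c) = r ≤ length T × c ≡ r + length (row T r)

put-new-row : ∀ {A} (T : Filling A) {b} x → AtEnd T b → ∀ i →
  length (row (put T b x) i) ≡ δ (proj₁ b) i + length (row T i)
put-new-row [] {zero , _} x (_ , refl) zero    = refl
put-new-row [] {zero , _} x (_ , refl) (suc i) = refl
put-new-row (ρ ∷ T) {zero , _} x (_ , refl) zero    =
  trans (cong length (putInRow-new ρ)) (trans (length-++ ρ) (+-comm (length ρ) 1))
put-new-row (ρ ∷ T) {zero , _} x (_ , refl) (suc i) = refl
put-new-row (ρ ∷ T) {suc r , _} x (p , refl) zero    = refl
put-new-row (ρ ∷ T) {suc r , _} x (p , refl) (suc i) =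
  trans (put-new-row T {r , _} x (s≤s⁻¹ p , refl) i) (cong (_+ _) (δ-suc r i))
  where
  δ-suc : ∀ r i → δ r i ≡ δ (suc r) (suc i)
  δ-suc r i with r ≟ i
  ... | yes refl = sym (δ-refl (suc r))
  ... | no n     = sym (δ-≢ (n ∘ suc-injective))

put-new-nonZero : ∀ {A} (T : Filling A) {b} x → AtEnd T b → All NonZero (shape T) → All NonZero (shape (put T b x))
put-new-nonZero [] {zero , _} x _ _ = _ ∷ []
put-new-nonZero (ρ ∷ T) {zero , _} x (_ , refl) (_ ∷ ps) rewrite putInRow-new ρ {x} = nonZero-++ ρ ∷ ps
  where
  nonZero-++ : ∀ {A : Set} (l : List A) {x} → NonZero (length (l ++ [ x ]))
  nonZero-++ []      = _
  nonZero-++ (_ ∷ _) = _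
put-new-nonZero (ρ ∷ T) {suc r , _} x (p , refl) (q ∷ ps) = q ∷ put-new-nonZero T {r , _} x (s≤s⁻¹ p , refl) ps

put-new-concat : ∀ {A} (T : Filling A) {b} x → AtEnd T b → concat (put T b x) ↭ x ∷ concat T
put-new-concat [] {zero , _} x _ = ↭-refl
put-new-concat (ρ ∷ T) {zero , _} x (_ , refl) rewrite putInRow-new ρ {x} | ++-assoc ρ [ x ] (concat T) =
  shift x ρ (concat T)
put-new-concat (ρ ∷ T) {suc r , _} x (p , refl) =
  ↭-trans (++-prep ρ (put-new-concat T {r , _} x (s≤s⁻¹ p , refl))) (shift x ρ (concat T))
  where
  ++-prep : ∀ {A : Set} (xs : List A) {ys zs} → ys ↭ zs → xs ++ ys ↭ xs ++ zs
  ++-prep []       p = p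
  ++-prep (x ∷ xs) p = prep x (++-prep xs p)

-- S is a doubled diagram, so that the row i of T fills the columns from i to
-- rowEnd S i.
record Models {A : Set} (T : Filling A) (L : List (Box × A)) (S : Diagram) : Set where
  field
    sound    : ∀ {b x} → (b , x) ∈ L → entry T b ≡ just x
    complete : ∀ {b x} → entry T b ≡ just x → (b , x) ∈ L
    lengths  : ∀ i → length (row T i) ≡ rowEnd S i ∸ i
    noEmpty  : All NonZero (shape T)
    sized    : size T ≡ length L
open Models public

Models-[] : ∀ {A} → Models {A} [] [] ∅
Models-[] = record { sound = λ () ; complete = λ () ; lengths = λ i → sym (0∸n≡0 i) ; noEmpty = [] ; sized = refl }

Models-↭ : ∀ {A} {T : Filling A} {L L′ S} → L ↭ L′ → Models T L S → Models T L′ S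
Models-↭ p m = record
  { sound = sound m ∘ ∈-resp-↭ (↭-sym p) ; complete = ∈-resp-↭ p ∘ complete m
  ; lengths = lengths m ; noEmpty = noEmpty m ; sized = trans (sized m) (↭-length p) }

private
  rows-nonEmpty : ∀ {A} (T : Filling A) i → 0 < length (row T i) → i < length T
  rows-nonEmpty (ρ ∷ T) zero    _ = z<s
  rows-nonEmpty (ρ ∷ T) (suc i) p = s≤s (rows-nonEmpty T i p)

Models-AtEnd : ∀ {A} {T : Filling A} {L S} b → IsYoung S → Models T L S → AddableΔ S b → AtEnd T b
Models-AtEnd {T = T} {S = S} (r , c) y m (r≤c , p , q) = low r refl
  , trans (sym (m+[n∸m]≡n r≤c)) (cong (r +_) (trans (cong (_∸ r) (sym p)) (sym (lengths m r))))
  where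
  low : ∀ r′ → r′ ≡ r → r′ ≤ length T
  low zero     _    = z≤n
  low (suc r′) refl = rows-nonEmpty T r′ (subst (0 <_) (sym (lengths m r′)) (m<n⇒0<n∸m
    (≤-<-trans (<⇒≤ r≤c) (col⇒row y (subst (r′ <_) (sym q) ≤-refl)))))

AtEnd-Fits : ∀ {A} {T : Filling A} {b} → proj₁ b ≤ proj₂ b → AtEnd T b → Fits T b
AtEnd-Fits r≤c (p , q) = r≤c , p , ≤-reflexive q

put-new : ∀ {A} {T : Filling A} {L S} b x → IsShifted S → Models T L S → AddableΔ S b →
  (∀ {y} → ¬ (b , y) ∈ L) → Models (put T b x) ((b , x) ∷ L) (S ⊞ b)
put-new {A} {T} {L} {S} b@(r , c) x σ m B@(r≤c , _) ∉ = record
  { sound = snd ; complete = cmp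
  ; lengths = λ i → trans (put-new-row T x E i) (lens i)
  ; noEmpty = put-new-nonZero T x E (noEmpty m)
  ; sized = trans (↭-length (put-new-concat T x E)) (cong suc (sized m)) }
  where
  E = Models-AtEnd b (isYoung σ) m B
  F = AtEnd-Fits {T = T} r≤c E
  snd : ∀ {b′ z} → (b′ , z) ∈ (b , x) ∷ L → entry (put T b x) b′ ≡ just z
  snd (here refl) = entry-put T b x F
  snd {b′} (there p) with b′ ≟ᵇ b
  ... | yes refl = contradiction p ∉
  ... | no n     = trans (entry-put-≢ T x F n) (sound m p)
  cmp : ∀ {b′ z} → entry (put T b x) b′ ≡ just z → (b′ , z) ∈ (b , x) ∷ L
  cmp {b′} e with b′ ≟ᵇ b
  ... | yes refl = here (cong (b ,_) (just-injective (trans (sym e) (entry-put T b x F))))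
  ... | no n     = there (complete m (trans (sym (entry-put-≢ T x F n)) e))
  lens : ∀ i → δ r i + length (row T i) ≡ (δ (suc c) i + (δ r i + rowEnd S i)) ∸ i
  lens i rewrite lengths m i with r ≟ i | suc c ≟ i
  ... | yes refl | yes refl = ⊥-<-refl r≤c
  ... | yes refl | no _     = sym (+-∸-assoc 1 (subst (r ≤_) (sym (proj₁ (proj₂ B))) r≤c))
  ... | no _     | no _     = refl
  -- The reflected box lies in row `suc c`, left of the diagonal: both before and after, that row
  -- ends before the shifted half begins.
  ... | no n     | yes refl = trans (m≤n⇒m∸n≡0 (≤-trans (≤-reflexive R) (m≤n⇒m≤1+n r≤c)))
                                (sym (m≤n⇒m∸n≡0 (≤-trans (≤-reflexive R) r≤c)))
    where
    R : rowEnd S (suc c) ≡ r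
    R = trans (sym (rowEnd-⊕-≢ S b n)) (proj₁ (τ-Addable b σ B))

put-old : ∀ {A} {T : Filling A} {L S} b x {z} → Models T ((b , z) ∷ L) S →
  (∀ {y} → ¬ (b , y) ∈ L) → Models (put T b x) ((b , x) ∷ L) S
put-old {A} {T} {L} {S} b@(r , c) x {z} m ∉ = record
  { sound = snd ; complete = cmp
  ; lengths = λ i → trans (put-old-row T e i) (lengths m i)
  ; noEmpty = subst (All NonZero) (sym (put-old-shape T e)) (noEmpty m)
  ; sized = trans (put-old-size T e) (sized m) }
  where
  e = sound m (here refl)
  F : Fits T b
  F = let p , q , s = entry-Fits T e in p , <⇒≤ q , <⇒≤ s
  snd : ∀ {b′ z} → (b′ , z) ∈ (b , x) ∷ L → entry (put T b x) b′ ≡ just z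
  snd (here refl) = entry-put T b x F
  snd {b′} (there p) with b′ ≟ᵇ b
  ... | yes refl = contradiction p ∉
  ... | no n     = trans (entry-put-≢ T x F n) (sound m (there p))
  cmp : ∀ {b′ z} → entry (put T b x) b′ ≡ just z → (b′ , z) ∈ (b , x) ∷ L
  cmp {b′} e′ with b′ ≟ᵇ b
  ... | yes refl = here (cong (b ,_) (just-injective (trans (sym e′) (entry-put T b x F))))
  ... | no n with complete m (trans (sym (entry-put-≢ T x F n)) e′)
  ...   | here refl = contradiction refl n
  ...   | there p   = there p

-- Simulation of mixed insertion

takeWhile-length : ∀ {A : Set} {P : Pred A 0ℓ} (P? : Decidable P) l k →
  (∀ {i} → i < k → ∃[ x ] (at l i ≡ just x × P x)) →
  (at l k ≡ nothing ⊎ ∃[ x ] (at l k ≡ just x × ¬ P x)) → length (takeWhile P? l) ≡ k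
takeWhile-length P? [] zero    _ _ = refl
takeWhile-length P? [] (suc k) f _ with f {0} z<s
... | _ , () , _
takeWhile-length P? (y ∷ l) zero f (inj₂ (.y , refl , n)) with P? y
... | yes p = contradiction p n
... | no _  = refl
takeWhile-length P? (y ∷ l) (suc k) f g with P? y
... | yes p = cong suc (takeWhile-length P? l k (λ i<k → f (s≤s i<k)) g)
... | no n with f {0} z<s
...   | _ , refl , p = contradiction p n

takeWhile-mapMaybe : ∀ {A : Set} {P : Pred A 0ℓ} (P? : Decidable P) (f : ℕ → Maybe A) g n k → k ≤ n →
  (∀ {i} → i < k → ∃[ x ] (f (g i) ≡ just x × P x)) →
  (∀ {i} → k ≤ i → f (g i) ≡ nothing) ⊎ (k < n × ∃[ x ] (f (g k) ≡ just x × ¬ P x)) →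
  length (takeWhile P? (mapMaybe f (applyUpTo g n))) ≡ k
takeWhile-mapMaybe P? f g zero zero _ _ _ = refl
takeWhile-mapMaybe P? f g (suc n) zero _ _ (inj₁ q) rewrite q {0} z≤n =
  takeWhile-mapMaybe P? f (g ∘ suc) n zero z≤n (λ ()) (inj₁ λ _ → q z≤n)
takeWhile-mapMaybe P? f g (suc n) zero _ _ (inj₂ (_ , x , e , np)) rewrite e with P? x
... | yes p = contradiction p np
... | no _  = refl
takeWhile-mapMaybe P? f g (suc n) (suc k) (s≤s le) h q with h {0} z<s
... | x , e , p rewrite e with P? x
...   | no np = contradiction p np
...   | yes _ = cong suc (takeWhile-mapMaybe P? f (g ∘ suc) n k le (λ l → h (s≤s l)) (shifted q))
  where
  shifted : (∀ {i} → suc k ≤ i → f (g i) ≡ nothing) ⊎ (suc k < suc n × ∃[ x ] (f (g (suc k)) ≡ just x × ¬ _)) →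
    (∀ {i} → k ≤ i → f (g (suc i)) ≡ nothing) ⊎ (k < n × ∃[ x ] (f (g (suc k)) ≡ just x × ¬ _))
  shifted (inj₁ q) = inj₁ λ l → q (s≤s l)
  shifted (inj₂ (l , r)) = inj₂ (s≤s⁻¹ l , r)

data OnLine : Line → Box → Set where
  onRow    : ∀ {r c} → OnLine (inRow r) (r , c)
  onColumn : ∀ {r c} → OnLine (inColumn c) (r , c)

data Before : Line → Box → Box → Set where
  inRow    : ∀ {r c c′} → r ≤ c′ → c′ < c → Before (inRow r) (r , c′) (r , c)
  inColumn : ∀ {r r′ c} → r′ ≤ c → r′ < r → Before (inColumn c) (r′ , c) (r , c)

infix 4 _≤ʳ_
_≤ʳ_ : X′ → X′ → Set
x ≤ʳ y = rank x ≤ rank y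

Reaches : Filling X′ → Line → X′ → Box → Set
Reaches T ℓ y a = ∀ b → Before ℓ b a → ∃[ z ] (entry T b ≡ just z × z ≤ʳ y)

-- `column` discards absent entries, so a letter is put at the end of a column only if all boxes
-- further down are absent too.
Stops : Filling X′ → Line → X′ → Box → Set
Stops T ℓ y a = (entry T a ≡ nothing × (∀ {r} → proj₁ a ≤ r → entry T (r , proj₂ a) ≡ nothing)) ⊎
                (∃[ z ] (entry T a ≡ just z × ¬ (z ≤ʳ y)))

target-≡ : ∀ T ℓ y a → OnLine ℓ a → proj₁ a ≤ proj₂ a → Reaches T ℓ y a → Stops T ℓ y a → target T ℓ y ≡ a
target-≡ T (inRow r) y (.r , c) onRow r≤c R St = cong (r ,_)
  (trans (cong (r +_) (takeWhile-length (_≤′? y) (row T r) (c ∸ r) pre (stop St))) r+)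
  where
  r+ : r + (c ∸ r) ≡ c
  r+ = m+[n∸m]≡n r≤c
  e : entry T (r , c) ≡ at (row T r) (c ∸ r)
  e = trans (cong (λ z → entry T (r , z)) (sym r+)) (entry-row T r (c ∸ r))
  pre : ∀ {i} → i < c ∸ r → ∃[ x ] (at (row T r) i ≡ just x × x ≤ʳ y)
  pre {i} l with R (r , r + i) (inRow (m≤m+n r i) (subst (r + i <_) r+ (+-monoʳ-< r l)))
  ... | z , eq , p = z , trans (sym (entry-row T r i)) eq , p
  stop : Stops T (inRow r) y (r , c) → at (row T r) (c ∸ r) ≡ nothing ⊎ ∃[ x ] (at (row T r) (c ∸ r) ≡ just x × ¬ x ≤ʳ y)
  stop (inj₁ (p , _))     = inj₁ (trans (sym e) p)
  stop (inj₂ (z , p , n)) = inj₂ (z , trans (sym e) p , n)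
target-≡ T (inColumn c) y (r , .c) onColumn r≤c R St = cong (_, c)
  (takeWhile-mapMaybe (_≤′? y) (λ r → entry T (r , c)) id (suc c) r (m≤n⇒m≤1+n r≤c)
    (λ {i} l → R (i , c) (inColumn (≤-trans (<⇒≤ l) r≤c) l)) (stop St))
  where
  stop : Stops T (inColumn c) y (r , c) →
    (∀ {i} → r ≤ i → entry T (i , c) ≡ nothing) ⊎ (r < suc c × ∃[ x ] (entry T (r , c) ≡ just x × ¬ x ≤ʳ y))
  stop (inj₁ (_ , f)) = inj₁ f
  stop (inj₂ q)       = inj₂ (s≤s r≤c , q)

-- The order of the cells and the order of their ranks

_≰ᵇ_ : Cell → Cell → Set
c ≰ᵇ d = ¬ (proj₁ (proj₁ d) ≤ proj₁ (proj₁ c) × proj₂ (proj₁ d) ≤ proj₂ (proj₁ c))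

value<⇒rank< : ∀ x y → value′ x < value′ y → rank x < rank y
value<⇒rank< x y l = <-≤-trans (rank< x) (≤-trans (*-monoʳ-≤ 2 l) (≤rank y))
  where
  rank< : ∀ x → rank x < 2 * suc (value′ x)
  rank< (primed x)   = *-monoʳ-< 2 (n<1+n (value x))
  rank< (unprimed x) = ≤-reflexive (sym (*-suc 2 (value x)))
  ≤rank : ∀ y → 2 * value′ y ≤ rank y
  ≤rank (primed y)   = ≤-refl
  ≤rank (unprimed y) = n≤1+n _

-- The critical case is an unprimed letter before an equal primed one. By `≼`, the column of the
-- latter is then less than the row of the former, so the later cell would be north-west of the
-- earlier one.
≼⇒≤ʳ : ∀ c d → Valid c → Valid d → c ≼ d → c ≰ᵇ d → proj₂ c ≤ʳ proj₂ d
≼⇒≤ʳ (_ , x) (_ , y) _ _ (inj₁ l) _ = <⇒≤ (value<⇒rank< x y l)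
≼⇒≤ʳ (_ , primed x)   (_ , primed y)   _ _ (inj₂ (e , _)) _ = *-monoʳ-≤ 2 (≤-reflexive e)
≼⇒≤ʳ (_ , primed x)   (_ , unprimed y) _ _ (inj₂ (e , _)) _ = m≤n⇒m≤1+n (*-monoʳ-≤ 2 (≤-reflexive e))
≼⇒≤ʳ (_ , unprimed x) (_ , unprimed y) _ _ (inj₂ (e , _)) _ = s≤s (*-monoʳ-≤ 2 (≤-reflexive e))
≼⇒≤ʳ (_ , unprimed x) (_ , primed y)   v w (inj₂ (e , l)) n =
  contradiction (≤-trans (<⇒≤ w) (≤-trans (n≤1+n _) l) , ≤-trans (n≤1+n _) (≤-trans l v)) n

-- Insertion bumps strictly greater entries only, so equal letters need care. If `d` equals the
-- letter in hand as an entry and occupies its new box, its row index exceeds that of the old cell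
-- `c`, against `≼`.
Bump-< : ∀ {S c c′ d} → Valid d → IsShifted S → AddableCell S c → Bump S c c′ → c ≼ d → proj₁ d ≡ proj₁ c′ →
  rank (proj₂ c′) < rank (proj₂ d)
Bump-< {c = _ , x} {_ , x′} {_ , y} v σ C b (inj₁ l) e = value<⇒rank< x′ y (subst (_< value′ y) (bump-value b) l)
  where
  bump-value : ∀ {S c c′} → Bump S c c′ → cellValue c ≡ cellValue c′
  bump-value (down _)     = refl
  bump-value (diagonal _) = refl
  bump-value (right _)    = refl
Bump-< {d = _ , unprimed y} v σ C (down _)     (inj₂ (_ , l)) refl = ⊥-<-refl l
Bump-< {d = _ , primed y}   v σ C (down _)     (inj₂ (_ , l)) refl =
  contradiction (≤-trans (≤-trans v (n≤1+n _)) l) (λ z → <-irrefl refl (≤-trans (n≤1+n _) z))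
Bump-< {d = _ , unprimed y} v σ C (diagonal _) (inj₂ (p , l)) refl = s≤s (*-monoʳ-≤ 2 (≤-reflexive p))
Bump-< {d = _ , primed y}   v σ C (diagonal refl) (inj₂ (_ , l)) refl =
  ⊥-<-refl (≤-trans (n≤1+n _) l)
Bump-< {d = _ , unprimed y} v σ C (right _)    (inj₂ (p , l)) refl = s≤s (*-monoʳ-≤ 2 (≤-reflexive p))
Bump-< {d = _ , primed y}   v σ C (right _)    (inj₂ (_ , l)) refl = ⊥-<-refl l

Bump-next : ∀ {S b x c′} → Bump S (b , x) c′ →
  OnLine (proj₁ (next b x)) (proj₁ c′) × proj₁ c′ ≡ lineEnd S (proj₁ (next b x)) × proj₂ (next b x) ≡ proj₂ c′
Bump-next {b = r , c} (down l) with r ≟ c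
... | yes refl = ⊥-<-refl l
... | no _     = onRow , refl , refl
Bump-next {b = r , c} (diagonal refl) with r ≟ r
... | yes _ = onColumn , refl , refl
... | no n  = contradiction refl n
Bump-next (right _) = onColumn , refl , refl

Before-∈ : ∀ {S ℓ b a} → IsYoung S → Addable S a → Before ℓ b a → b ∈ᵈ S × proj₁ b ≤ proj₂ b
Before-∈ y (p , _) (inRow l m)    = subst (_ <_) (sym p) m , l
Before-∈ y (_ , q) (inColumn l m) = col⇒row y (subst (_ <_) (sym q) m) , l

-- Ensures that every box before the target on its line is occupied, and by one of the cells already
-- scanned.
record Fills {A : Set} (L : List (Box × A)) (S : Diagram) : Set where
  field
    inside  : ∀ {b x} → (b , x) ∈ L → b ∈ᵈ S
    covered : ∀ {b} → proj₁ b ≤ proj₂ b → b ∈ᵈ S → ∃[ x ] (b , x) ∈ L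
open Fills public

Fills-[] : ∀ {A} → Fills {A} [] ∅
Fills-[] = record { inside = λ () ; covered = λ _ () }

Fills-∷ : ∀ {A} {L : List (Box × A)} {S b x} → IsShifted S → AddableΔ S b → Fills L S → Fills ((b , x) ∷ L) (S ⊞ b)
Fills-∷ {S = S} {b} {x} σ B f = record { inside = ins ; covered = cov }
  where
  ins : ∀ {b′ y} → (b′ , y) ∈ (b , x) ∷ _ → b′ ∈ᵈ S ⊞ b
  ins (here refl) = ∈-⊞-new {S} b B
  ins {b′} (there p) = ∈-⊕⁺ {S ⊕ b} (τ b) b′ (∈-⊕⁺ {S} b b′ (inside f p))
  cov : ∀ {b′} → proj₁ b′ ≤ proj₂ b′ → b′ ∈ᵈ S ⊞ b → ∃[ y ] (b′ , y) ∈ (b , x) ∷ _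
  cov {b′} l m with ∈-⊕⁻ {S ⊕ b} b′ (τ-Addable b σ B) m
  ... | inj₂ e = contradiction e (upper≢τ l (proj₁ B))
  ... | inj₁ m′ with ∈-⊕⁻ {S} b′ (proj₂ B) m′
  ...   | inj₂ refl = x , here refl
  ...   | inj₁ m″ with covered f l m″
  ...     | y , p = y , there p

later-∉ : ∀ {S cs b x} → AddableCells S cs → (b , x) ∈ cs → ¬ b ∈ᵈ S
later-∉ {S} ((_ , B) ∷ _) (here refl) m = ∈⇒¬Addable {S} B m
later-∉ {S} (_∷_ {c = c} C Cs) (there {x = _} p) m =
  later-∉ Cs p (∈-⊕⁺ {S ⊕ proj₁ c} (τ (proj₁ c)) _ (∈-⊕⁺ {S} (proj₁ c) _ m))

_≤ᶜ_ : Cell → Cell → Set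
c ≤ᶜ d = proj₂ c ≤ʳ proj₂ d

insertFrom-step : ∀ {n T ℓ x b} → target T ℓ x ≡ b → entry T b ≡ nothing → insertFrom (suc n) T ℓ x ≡ (put T b x , b)
insertFrom-step refl e rewrite e = refl

insertFrom-bump : ∀ {n T ℓ x b a} → target T ℓ x ≡ b → entry T b ≡ just a →
  insertFrom (suc n) T ℓ x ≡ insertFrom n (put T b x) (proj₁ (next b a)) (proj₂ (next b a))
insertFrom-bump refl e rewrite e = refl

-- Apart from the letter y in hand, T has the cells in pre, which are those
-- with smaller letters, and in cs.
push-simulates : ∀ {S a cs cs′ o pre T ℓ y U n} → Push S a cs cs′ o → IsShifted S → AddableΔ S a →
  AddableCells S cs → AllPairs _≼_ cs → AllPairs _≤ᶜ_ cs′ → Models T (pre ++ cs) U → U ≈ S ⊞ᶜ cs → IsShifted U →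
  Fills pre S → All (λ c → All (c ≤ᶜ_) cs′) ((a , y) ∷ pre) → OnLine ℓ a → Reaches T ℓ y a →
  (∀ {d} → d ∈ cs → proj₁ d ≡ a → rank y < rank (proj₂ d)) → length cs < n →
  ∃[ T′ ] (insertFrom n T ℓ y ≡ (T′ , o) × Models T′ ((a , y) ∷ pre ++ cs′) (U ⊞ o))
push-simulates {S} {a} {pre = pre} {T} {ℓ} {y} {U} {suc n} [] σ A _ _ _ m e υ f _ on R _ _ =
  put T a y , insertFrom-step (target-≡ T ℓ y a on (proj₁ A) R (inj₁ (free ≤-refl , free))) (free ≤-refl)
  , put-new a y υ m (AddableΔ-≈ a (≈-sym e) A) (λ p → ∉ ≤-refl (subst (_ ∈_) (++-identityʳ pre) p))
  where
  ∉ : ∀ {r z} → proj₁ a ≤ r → ¬ ((r , proj₂ a) , z) ∈ pre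
  ∉ {r} l p = <-irrefl refl (<-≤-trans (subst (r <_) (proj₂ (proj₂ A)) (row⇒col (isYoung σ) (inside f p))) l)
  free : ∀ {r} → proj₁ a ≤ r → entry T (r , proj₂ a) ≡ nothing
  free {r} l with entry T (r , proj₂ a) in eq
  ... | nothing = refl
  ... | just z  = contradiction (subst (_ ∈_) (++-identityʳ pre) (complete m eq)) (∉ l)
-- The scan passes a cell that the actual insertion does not touch: the filling, the line and the
-- letter in hand stay the same.
push-simulates {S} {a} {c ∷ cs} {.c ∷ cs′} {pre = pre} {n = n} (miss n≢ ∷ p) σ A (C ∷ Cs)
    (_ ∷ ≼s) (≤c ∷ ≤s) m e υ f H on R hd lt
  with push-simulates {n = n} p (IsShifted-cell c σ C) (AddableΔ-⊞ σ (cellΔ {S} c C) A n≢) Cs ≼s ≤s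
         (Models-↭ (shift c pre cs) m) e υ (Fills-∷ σ (cellΔ {S} c C) f)
         (All.tail (All.head H) ∷ ≤c ∷ All.map All.tail (All.tail H)) on R (hd ∘ there) (≤-trans (n≤1+n _) lt)
... | T′ , eq , m′ = T′ , eq , Models-↭ (prep _ (↭-sym (shift c pre cs′))) m′
push-simulates {S} {a} {(.a , l) ∷ cs} {c′ ∷ cs′} {pre = pre} {T} {ℓ} {y} {U} {suc n} (hit b ∷ p) σ A (C ∷ Cs)
    (≼c ∷ ≼s) (≤c ∷ ≤s) m e υ f H on R hd (s≤s lt)
  with Bump-next b | Bump-Addable σ C b
... | on′ , _ , el | C′
  with push-simulates {pre = (a , y) ∷ pre} {T = put T a y} {y = proj₂ c′} {n = n} p
         (IsShifted-⊞ a σ A) (cellΔ {S ⊞ a} c′ C′) Cs ≼s ≤s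
         m₁ e υ (Fills-∷ σ A f) (≤c ∷ All.map All.tail H) on′ R′
         (λ {d} d∈ → Bump-< {d = d} (valid Cs d∈) σ C b (All.lookup ≼c d∈)) lt
  where
  valid : ∀ {S cs d} → AddableCells S cs → d ∈ cs → Valid d
  valid (C ∷ _)  (here refl) = proj₁ C
  valid (_ ∷ Cs) (there q)   = valid Cs q
  -- While the bumped letter is in hand the shape is unchanged, since `y` has taken over its box.
  m₁ : Models (put T a y) ((a , y) ∷ pre ++ cs) U
  m₁ = put-old a y (Models-↭ (shift (a , l) pre cs) m) λ q → case ∈-++⁻ pre q of λ
    { (inj₁ q) → ∈⇒¬Addable {S} (proj₂ A) (inside f q)
    ; (inj₂ q) → later-∉ Cs q (∈-⊞-new {S} a A) }
  R′ : Reaches (put T a y) (proj₁ (next a l)) (proj₂ c′) (proj₁ c′)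
  R′ b′ bf with Before-∈ (isYoung (IsShifted-⊞ a σ A)) (proj₂ C′) bf
  ... | b∈ , b≤ with covered (Fills-∷ {x = y} σ A f) b≤ b∈
  ...   | z , here refl = z , sound m₁ (here refl) , All.head (All.head H)
  ...   | z , there q   = z , sound m₁ (there (∈-++⁺ˡ q)) , All.head (All.lookup (All.tail H) q)
... | T′ , eq , m′ = T′
    , trans (insertFrom-bump (target-≡ T ℓ y a on (proj₁ A) R (inj₂ (l , ea , <⇒≱ (hd (here refl) refl)))) ea)
        (trans (cong (insertFrom n (put T a y) (proj₁ (next a l))) el) eq)
    , Models-↭ (↭-sym (shift c′ ((a , y) ∷ pre) cs′)) m′
    where
    ea = sound m (∈-++⁺ʳ pre (here refl))

ins-simulates : ∀ {S x cs cs′ o pre T U} → Ins x S cs cs′ o → IsShifted S →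
  AddableCells S cs → AllPairs _≼_ cs → AllPairs _≤ᶜ_ cs′ → Models T (pre ++ cs) U → U ≈ S ⊞ᶜ cs → IsShifted U →
  Fills pre S → All (λ c → All (c ≤ᶜ_) cs′) pre →
  ∃[ T′ ] (insert T x ≡ (T′ , o) × Models T′ (pre ++ cs′) (U ⊞ o))
ins-simulates {S} {x} {cs} {c ∷ cs′} {pre = pre} {T} (here x< p) σ Cs ≼s (≤c ∷ ≤s) m e υ f H
  with push-simulates {pre = pre} {y = unprimed x} p σ (newΔ σ) Cs ≼s ≤s m e υ f (≤c ∷ All.map All.tail H) onRow R
         (λ {d} d∈ _ → value<⇒rank< (unprimed x) (proj₂ d) (All.lookup x< d∈))
         -- `insert` allows `suc (size T)` steps, and only cells in `cs` can be bumped.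
         (s≤s (≤-trans (m≤n+m _ (length pre)) (≤-reflexive (trans (sym (length-++ pre)) (sym (sized m))))))
  where
  R : Reaches T (inRow 0) (unprimed x) (0 , rowEnd S 0)
  R b bf with Before-∈ (isYoung σ) (proj₂ (newΔ σ)) bf
  ... | b∈ , b≤ with covered f b≤ b∈
  ...   | z , q = z , sound m (∈-++⁺ˡ q) , All.head (All.lookup H q)
... | T′ , eq , m′ = T′ , eq , Models-↭ (↭-sym (shift c pre cs′)) m′
ins-simulates {S} {x} {c ∷ cs} {.c ∷ cs′} {pre = pre} (there _ i) σ (C ∷ Cs) (_ ∷ ≼s) (≤c ∷ ≤s) m e υ f H
  with ins-simulates {pre = c ∷ pre} i (IsShifted-cell c σ C) Cs ≼s ≤s
         (Models-↭ (shift c pre cs) m) e υ (Fills-∷ σ (cellΔ {S} c C) f) (≤c ∷ All.map All.tail H)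
... | T′ , eq , m′ = T′ , eq , Models-↭ (↭-sym (shift c pre cs′)) m′

AddableCells-≰ : ∀ {S cs} → IsShifted S → AddableCells S cs → AllPairs _≰ᵇ_ cs
AddableCells-≰ σ [] = []
AddableCells-≰ {S} σ (_∷_ {c = c} C Cs) = All.tabulate not-below ∷ AddableCells-≰ σ′ Cs
  where
  σ′ = IsShifted-cell c σ C
  not-below : ∀ {d} → d ∈ _ → c ≰ᵇ d
  not-below d∈ (p , q) = later-∉ Cs d∈ (down-closed (isYoung σ′) p q (∈-⊞-new {S} (proj₁ c) (cellΔ {S} c C)))

AddableCells-valid : ∀ {S cs} → AddableCells S cs → All Valid cs
AddableCells-valid []            = []
AddableCells-valid ((v , _) ∷ Cs) = v ∷ AddableCells-valid Cs

AllPairs-All : ∀ {A : Set} {P : A → Set} {xs} → All P xs → AllPairs (λ x y → P x × P y) xs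
AllPairs-All []       = []
AllPairs-All (p ∷ ps) = All.map (p ,_) ps ∷ AllPairs-All ps

≼-pairs : ∀ {cs} → IsTableau cs → AllPairs _≼_ cs
≼-pairs t = Linked⇒AllPairs (λ {c} {d} {e} → ≼-trans {c} {d} {e}) (sorted t)

≰-pairs : ∀ {cs} → IsTableau cs → AllPairs _≰ᵇ_ cs
≰-pairs t = AddableCells-≰ IsShifted-∅ (cells t)

≤ᶜ-pairs : ∀ {cs} → IsTableau cs → AllPairs _≤ᶜ_ cs
≤ᶜ-pairs t = AllPairs.zipWith (λ { {c} {d} ((p , q) , (v , w)) → ≼⇒≤ʳ c d v w p q })
  (AllPairs.zip (≼-pairs t , ≰-pairs t) , AllPairs-All (AddableCells-valid (cells t)))

-- The recording tableau holds i + 1 in the i-th box of the trace.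
stamp : ∀ {A} → List (Box × ℕ) → Trace A → List (Box × ℕ)
stamp N []            = N
stamp N ((_ , b) ∷ L) = stamp ((b , suc (length N)) ∷ N) L

applyUpTo-snoc : ∀ {A : Set} (f : ℕ → A) n → f n ∷ applyUpTo f n ↭ applyUpTo f (suc n)
applyUpTo-snoc f zero    = ↭-refl
applyUpTo-snoc f (suc n) = ↭-trans (_↭_.swap (f (suc n)) (f 0) ↭-refl) (prep (f 0) (applyUpTo-snoc (f ∘ suc) n))

record Simulates (PQ : Filling X′ × Filling ℕ) (cs : List Cell) (N : List (Box × ℕ)) (S : Diagram) : Set where
  field
    models-P   : Models (proj₁ PQ) cs S
    models-Q   : Models (proj₂ PQ) N S
    fills-Q    : Fills N S
    contents-Q : concat (proj₂ PQ) ↭ applyUpTo suc (size (proj₂ PQ))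
open Simulates public

words : Trace Letter → Word
words = map (proj₁ ∘ proj₁)

mixStep-≡ : ∀ {P Q x P′ b} → insert P x ≡ (P′ , b) → mixStep (P , Q) x ≡ (P′ , put Q b (suc (size Q)))
mixStep-≡ {P} {x = x} e with insert P x
mixStep-≡ refl | _ = refl

simulates : ∀ {cs L cs′ PQ N S} → Grow cs L cs′ → IsTableau cs → S ≈ ∅ ⊞ᶜ cs → IsShifted S →
  Simulates PQ cs N S → Simulates (foldl mixStep PQ (words L)) cs′ (stamp N L) (S ⊞* L)
simulates [] t e σ s = s
simulates {cs} {(m , o) ∷ L} {PQ = P , Q} {N} {S} (_∷_ {cs₁ = cs₁} i g) t e σ s
  with ins-simulates {pre = []} i IsShifted-∅ (cells t) (≼-pairs t) (≤ᶜ-pairs (Ins-IsTableau t i))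
         (models-P s) e σ Fills-[] []
     | Ins-Addable IsShifted-∅ (cells t) i
... | T′ , eq , mP | _ , O′ , e′ =
  simulates g (Ins-IsTableau t i) (≈-trans (⊞-cong o e) (≈-sym e′)) (IsShifted-⊞ o σ O)
    (subst (λ PQ → Simulates PQ cs₁ ((o , suc (length N)) ∷ N) (S ⊞ o)) (sym step-≡) record
      { models-P = mP ; models-Q = mQ ; fills-Q = Fills-∷ σ O (fills-Q s)
      ; contents-Q = subst (λ k → concat Q′ ↭ applyUpTo suc k) (sym sizeQ′)
          (↭-trans (put-new-concat Q (suc (size Q)) E)
            (↭-trans (prep _ (contents-Q s)) (applyUpTo-snoc suc (size Q)))) })
  where
  O = AddableΔ-≈ o (≈-sym e) O′
  E = Models-AtEnd o (isYoung σ) (models-Q s) O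
  Q′ = put Q o (suc (size Q))
  mQ : Models Q′ ((o , suc (length N)) ∷ N) (S ⊞ o)
  mQ = subst (λ k → Models (put Q o (suc k)) ((o , suc (length N)) ∷ N) (S ⊞ o)) (sym (sized (models-Q s)))
    (put-new o _ σ (models-Q s) O (∉ ∘ inside (fills-Q s)))
    where
    ∉ : ¬ o ∈ᵈ S
    ∉ = ∈⇒¬Addable {S} (proj₂ O)
  sizeQ′ : size Q′ ≡ suc (size Q)
  sizeQ′ = trans (sized mQ) (cong suc (sym (sized (models-Q s))))
  step-≡ : mixStep (P , Q) (proj₁ m) ≡ (T′ , Q′)
  step-≡ = mixStep-≡ {P} {Q} {proj₁ m} eq

mix-simulates : ∀ {L cs} → Grow [] L cs → Simulates (mix (words L)) cs (stamp [] L) (∅ ⊞* L)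
mix-simulates g = simulates g IsTableau-[] ≈-refl IsShifted-∅ record
  { models-P = Models-[] ; models-Q = Models-[] ; fills-Q = Fills-[] ; contents-Q = ↭-refl }

-- The shape of a filling

part : List ℕ → ℕ → ℕ
part []       _       = 0
part (n ∷ ns) zero    = n
part (n ∷ ns) (suc i) = part ns i

part-shape : ∀ {A} (T : Filling A) i → part (shape T) i ≡ length (row T i)
part-shape []      i       = refl
part-shape (ρ ∷ T) zero    = refl
part-shape (ρ ∷ T) (suc i) = part-shape T i

part-injective : ∀ {ms ns} → All NonZero ms → All NonZero ns → (∀ i → part ms i ≡ part ns i) → ms ≡ ns
part-injective []       []       e = refl
part-injective []       (q ∷ qs) e = contradiction (sym (e 0)) (≢-nonZero⁻¹ _ {{q}})
part-injective (p ∷ ps) []       e = contradiction (e 0) (≢-nonZero⁻¹ _ {{p}})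
part-injective (p ∷ ps) (q ∷ qs) e = cong₂ _∷_ (e 0) (part-injective ps qs (e ∘ suc))

sum-shape : ∀ {A} (T : Filling A) → sum (shape T) ≡ size T
sum-shape []      = refl
sum-shape (ρ ∷ T) = trans (cong (length ρ +_) (sum-shape T)) (sym (size-∷ ρ T))

Models-shape : ∀ {A B} {T : Filling A} {T′ : Filling B} {L L′ S} → Models T L S → Models T′ L′ S → shape T ≡ shape T′
Models-shape {T = T} {T′} m m′ = part-injective (noEmpty m) (noEmpty m′) λ i →
  trans (part-shape T i) (trans (lengths m i) (sym (trans (part-shape T′ i) (lengths m′ i))))

private
  decreasing : ∀ ns → All NonZero ns → (∀ i → 0 < part ns (suc i) → part ns (suc i) < part ns i) → Linked _>_ ns
  decreasing []           _            _ = []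
  decreasing (m ∷ [])     _            _ = [-]
  decreasing (m ∷ n ∷ ns) (_ ∷ q ∷ qs) f = f 0 (>-nonZero⁻¹ n {{q}}) ∷ decreasing (n ∷ ns) (q ∷ qs) (f ∘ suc)

Models-strict : ∀ {A} {T : Filling A} {L S} → IsYoung S → Models T L S → StrictPartition (shape T)
Models-strict {T = T} {S = S} y m = noEmpty m , decreasing (shape T) (noEmpty m) λ i p →
  subst₂ _<_ (sym (e (suc i))) (sym (e i)) (dec i (subst (0 <_) (e (suc i)) p))
  where
  e : ∀ i → part (shape T) i ≡ rowEnd S i ∸ i
  e i = trans (part-shape T i) (lengths m i)
  dec : ∀ i → 0 < rowEnd S (suc i) ∸ suc i → rowEnd S (suc i) ∸ suc i < rowEnd S i ∸ i
  dec i p = <-≤-trans (∸-monoʳ-< (n<1+n i) (<⇒≤ (m∸n≢0⇒n<m (>⇒≢ p))))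
    (∸-monoˡ-≤ i (≤-from-< λ {k} l → down-closed {S} {suc i} {k} y (n≤1+n i) ≤-refl l))

-- The insertion tableau

AllPairs-∈ : ∀ {A : Set} {R : A → A → Set} {xs x y} → AllPairs R xs → x ∈ xs → y ∈ xs → x ≡ y ⊎ R x y ⊎ R y x
AllPairs-∈ (r ∷ rs) (here refl) (here refl) = inj₁ refl
AllPairs-∈ (r ∷ rs) (here refl) (there q)   = inj₂ (inj₁ (All.lookup r q))
AllPairs-∈ (r ∷ rs) (there p)   (here refl) = inj₂ (inj₂ (All.lookup r p))
AllPairs-∈ (r ∷ rs) (there p)   (there q)   = AllPairs-∈ rs p q

module _ {T cs S} (t : IsTableau cs) (y : IsYoung S) (m : Models T cs S) where

  private
    ordered : ∀ {b b′ x x′} → entry T b ≡ just x → entry T b′ ≡ just x′ →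
      proj₁ b ≤ proj₁ b′ → proj₂ b ≤ proj₂ b′ → b ≢ b′ → (b , x) ≼ (b′ , x′) × x ≤ʳ x′
    ordered e e′ p q n with AllPairs-∈ (AllPairs.zip (AllPairs.zip (≼-pairs t , ≤ᶜ-pairs t) , ≰-pairs t))
                              (complete m e) (complete m e′)
    ... | inj₁ refl              = contradiction refl n
    ... | inj₂ (inj₁ (r , _))    = r
    ... | inj₂ (inj₂ (_ , ≰))    = contradiction (p , q) ≰

    -- Further down a column, unprimed letters have greater row indices; further right in a row, so
    -- do primed letters, whose index is one more than the column. For equal values `≼` excludes
    -- both.
    once : ∀ {b b′ x x′} → entry T b ≡ just x → entry T b′ ≡ just x′ →
      proj₁ b ≤ proj₁ b′ → proj₂ b ≤ proj₂ b′ → b ≢ b′ → value′ x ≡ value′ x′ →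
      rowIndex (b′ , x′) ≤ rowIndex (b , x)
    once e e′ p q n v with proj₁ (ordered e e′ p q n)
    ... | inj₁ l       = contradiction l (<-irrefl v)
    ... | inj₂ (_ , l) = l

  isShiftedYoungTableau : IsShiftedYoungTableau T
  isShiftedYoungTableau = record
    { strict = Models-strict y m
    ; rows-increasing = λ l e e′ → proj₂ (ordered e e′ ≤-refl (<⇒≤ l) λ { refl → <-irrefl refl l })
    ; columns-increasing = λ l e e′ → proj₂ (ordered e e′ (<⇒≤ l) ≤-refl λ { refl → <-irrefl refl l })
    ; unprimed-once-per-column = unprimed-once
    ; primed-once-per-row = primed-once
    ; diagonal-unprimed = λ e → <-irrefl refl (All.lookup (AddableCells-valid (cells t)) (complete m e)) }
    where
    unprimed-once : ∀ {r r′ c k} → entry T (r , c) ≡ just (unprimed k) →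
      entry T (r′ , c) ≡ just (unprimed k) → r ≡ r′
    unprimed-once {r} {r′} e e′ with <-cmp r r′
    ... | tri≈ _ q _ = q
    ... | tri< l n _ = contradiction (once e e′ (<⇒≤ l) ≤-refl (n ∘ cong proj₁) refl) (<⇒≱ l)
    ... | tri> _ n l = contradiction (once e′ e (<⇒≤ l) ≤-refl (n ∘ sym ∘ cong proj₁) refl) (<⇒≱ l)
    primed-once : ∀ {r c c′ k} → entry T (r , c) ≡ just (primed k) →
      entry T (r , c′) ≡ just (primed k) → c ≡ c′
    primed-once {r} {c} {c′} e e′ with <-cmp c c′
    ... | tri≈ _ q _ = q
    ... | tri< l n _ = contradiction (once e e′ ≤-refl (<⇒≤ l) (n ∘ cong proj₂) refl) (<⇒≱ (s≤s l))
    ... | tri> _ n l = contradiction (once e′ e ≤-refl (<⇒≤ l) (n ∘ sym ∘ cong proj₂) refl) (<⇒≱ (s≤s l))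

-- The recording tableau

boxes : ∀ {A} → Trace A → List Box
boxes = map proj₂

infix 4 _≤ᵇᵒˣ_
_≤ᵇᵒˣ_ : Box → Box → Set
(r , c) ≤ᵇᵒˣ (r′ , c′) = r ≤ r′ × c ≤ c′

stamp-∈⁻ : ∀ {A} N (L : Trace A) {b e} → (b , e) ∈ stamp N L →
  (b , e) ∈ N ⊎ ∃[ i ] (at (boxes L) i ≡ just b × e ≡ suc (length N + i))
stamp-∈⁻ N []            p = inj₁ p
stamp-∈⁻ N ((_ , b) ∷ L) p with stamp-∈⁻ ((b , suc (length N)) ∷ N) L p
... | inj₁ (here refl)    = inj₂ (0 , refl , cong suc (sym (+-identityʳ _)))
... | inj₁ (there q)      = inj₁ q
... | inj₂ (i , q , refl) = inj₂ (suc i , q , cong suc (sym (+-suc (length N) i)))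

stamp-∈⁺ˡ : ∀ {A} N (L : Trace A) {x} → x ∈ N → x ∈ stamp N L
stamp-∈⁺ˡ N []      p = p
stamp-∈⁺ˡ N (_ ∷ L) p = stamp-∈⁺ˡ (_ ∷ N) L (there p)

stamp-∈⁺ : ∀ {A} N (L : Trace A) {b} i → at (boxes L) i ≡ just b → (b , suc (length N + i)) ∈ stamp N L
stamp-∈⁺ N []            i       e    = contradiction (trans (sym e) (at-[] i)) λ ()
stamp-∈⁺ N ((_ , b) ∷ L) zero    refl = stamp-∈⁺ˡ (_ ∷ N) L (here (cong (λ z → b , suc z) (+-identityʳ _)))
stamp-∈⁺ N ((_ , b) ∷ L) {b′} (suc i) e    =
  subst (λ z → (b′ , suc z) ∈ stamp ((b , suc (length N)) ∷ N) L) (sym (+-suc (length N) i)) (stamp-∈⁺ _ L i e)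

stamp-length : ∀ {A} N (L : Trace A) → length (stamp N L) ≡ length N + length L
stamp-length N []      = sym (+-identityʳ _)
stamp-length N (_ ∷ L) = trans (stamp-length (_ ∷ N) L) (sym (+-suc (length N) (length L)))

trace-∉ : ∀ {A S} {L : Trace A} {i b} → AddableΔ* S L → at (boxes L) i ≡ just b → ¬ b ∈ᵈ S
trace-∉ {i = i} [] e m = contradiction (trans (sym e) (at-[] i)) λ ()
trace-∉ {S = S} {i = zero}  ((_ , B) ∷ _) refl m = ∈⇒¬Addable {S} B m
trace-∉ {S = S} {i = suc i} {b} (_∷_ {b = a} A As) e m =
  trace-∉ {i = i} As e (∈-⊕⁺ {S ⊕ a} (τ a) b (∈-⊕⁺ {S} a b m))

trace-∈ : ∀ {A S} (L : Trace A) {b} → b ∈ᵈ S → b ∈ᵈ S ⊞* L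
trace-∈ []            m = m
trace-∈ {S = S} ((_ , a) ∷ L) {b} m = trace-∈ L (∈-⊕⁺ {S ⊕ a} (τ a) b (∈-⊕⁺ {S} a b m))

trace-∈-new : ∀ {A S} {L : Trace A} i {b} → AddableΔ* S L → at (boxes L) i ≡ just b →
  b ∈ᵈ S ⊞* L × proj₁ b ≤ proj₂ b
trace-∈-new i [] e = contradiction (trans (sym e) (at-[] i)) λ ()
trace-∈-new {S = S} {(_ , b) ∷ L} zero (B ∷ _) refl = trace-∈ L (∈-⊞-new {S} b B) , proj₁ B
trace-∈-new (suc i) (_ ∷ As) e = trace-∈-new i As e

trace-∈⁻ : ∀ {A S} {L : Trace A} {b} → IsShifted S → AddableΔ* S L → proj₁ b ≤ proj₂ b → b ∈ᵈ S ⊞* L →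
  b ∈ᵈ S ⊎ ∃[ i ] at (boxes L) i ≡ just b
trace-∈⁻ σ [] l m = inj₁ m
trace-∈⁻ {S = S} {b = b} σ (_∷_ {b = a} A As) l m with trace-∈⁻ (IsShifted-⊞ a σ A) As l m
... | inj₂ (i , e) = inj₂ (suc i , e)
... | inj₁ m′ with ∈-⊕⁻ {S ⊕ a} b (τ-Addable a σ A) m′
...   | inj₂ e  = contradiction e (upper≢τ l (proj₁ A))
...   | inj₁ m″ with ∈-⊕⁻ {S} b (proj₂ A) m″
...     | inj₁ p    = inj₁ p
...     | inj₂ refl = inj₂ (0 , refl)

IsShifted-⊞* : ∀ {A S} {L : Trace A} → IsShifted S → AddableΔ* S L → IsShifted (S ⊞* L)
IsShifted-⊞* σ []                  = σ
IsShifted-⊞* σ (_∷_ {b = a} A As) = IsShifted-⊞* (IsShifted-⊞ a σ A) As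

trace-≰ : ∀ {A S} {L : Trace A} {i j b b′} → IsShifted S → AddableΔ* S L →
  at (boxes L) i ≡ just b → at (boxes L) j ≡ just b′ → i < j → ¬ b′ ≤ᵇᵒˣ b
trace-≰ {i = i} σ [] e _ _ _ = contradiction (trans (sym e) (at-[] i)) λ ()
trace-≰ {S = S} {i = zero} {suc j} σ (_∷_ {b = a} A As) refl e′ _ (p , q) =
  trace-∉ {i = j} As e′ (down-closed (isYoung (IsShifted-⊞ a σ A)) p q (∈-⊞-new {S} a A))
trace-≰ {i = suc i} {suc j} σ (_∷_ {b = a} A As) e e′ (s≤s l) = trace-≰ {i = i} {j} (IsShifted-⊞ a σ A) As e e′ l

trace-< : ∀ {A S} {L : Trace A} {i j b b′} → IsShifted S → AddableΔ* S L →
  at (boxes L) i ≡ just b → at (boxes L) j ≡ just b′ → b ≤ᵇᵒˣ b′ → b ≢ b′ → i < j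
trace-< {i = i} {j} σ As e e′ le n with <-cmp i j
... | tri< l _ _    = l
... | tri≈ _ refl _ = contradiction (just-injective (trans (sym e) e′)) n
... | tri> _ _ l    = contradiction le (trace-≰ {i = j} {i} σ As e′ e l)

record Records {A : Set} (Q : Filling ℕ) (L : Trace A) : Set where
  field
    addable  : AddableΔ* ∅ L
    entry⁻   : ∀ {b e} → entry Q b ≡ just e → ∃[ i ] (at (boxes L) i ≡ just b × e ≡ suc i)
    entry⁺   : ∀ {b} i → at (boxes L) i ≡ just b → entry Q b ≡ just (suc i)
open Records public

Simulates-Records : ∀ {L : Trace Letter} {PQ cs S} → AddableΔ* ∅ L → Simulates PQ cs (stamp [] L) S → Records (proj₂ PQ) L
Simulates-Records {L} As s = record
  { addable = As
  ; entry⁻ = λ e → case stamp-∈⁻ [] L (complete (models-Q s) e) of λ { (inj₂ r) → r }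
  ; entry⁺ = λ i e → sound (models-Q s) (stamp-∈⁺ [] L i e) }

isStandardShiftedTableau : ∀ {L : Trace Letter} {PQ cs} → AddableΔ* ∅ L → Simulates PQ cs (stamp [] L) (∅ ⊞* L) →
  IsStandardShiftedTableau (proj₂ PQ)
isStandardShiftedTableau {L} {PQ} As s = record
  { strict = Models-strict (isYoung (IsShifted-⊞* IsShifted-∅ As)) (models-Q s)
  ; contents = contents-Q s
  ; rows-increasing = λ l e e′ → inc e e′ (≤-refl , <⇒≤ l) λ { refl → <-irrefl refl l }
  ; columns-increasing = λ l e e′ → inc e e′ (<⇒≤ l , ≤-refl) λ { refl → <-irrefl refl l } }
  where
  R = Simulates-Records As s
  inc : ∀ {b b′ x y} → entry (proj₂ PQ) b ≡ just x → entry (proj₂ PQ) b′ ≡ just y → b ≤ᵇᵒˣ b′ → b ≢ b′ → x < y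
  inc e e′ le n with entry⁻ R e | entry⁻ R e′
  ... | i , p , refl | j , q , refl = s≤s (trace-< {i = i} {j} IsShifted-∅ As p q le n)

at-++ˡ : ∀ {A : Set} (xs : List A) {ys i} → i < length xs → at (xs ++ ys) i ≡ at xs i
at-++ˡ (x ∷ xs) {i = zero}  _       = refl
at-++ˡ (x ∷ xs) {i = suc i} (s≤s l) = at-++ˡ xs l

at-++ʳ : ∀ {A : Set} (xs : List A) {ys} i → at (xs ++ ys) (length xs + i) ≡ at ys i
at-++ʳ []       i = refl
at-++ʳ (x ∷ xs) i = at-++ʳ xs i

AllPairs-at : ∀ {A : Set} {R : A → A → Set} (xs : List A) {i j x y} → AllPairs R xs →
  at xs i ≡ just x → at xs j ≡ just y → i < j → R x y
AllPairs-at []       {i} _ e _ _ = contradiction (trans (sym e) (at-[] i)) λ ()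
AllPairs-at (x ∷ xs) {zero}  {suc j} (r ∷ _) refl e _ = All-at xs {j} r e
  where
  All-at : ∀ {A : Set} {P : A → Set} (xs : List A) {j y} → All P xs → at xs j ≡ just y → P y
  All-at []       {j} _ e = contradiction (trans (sym e) (at-[] j)) λ ()
  All-at (x ∷ xs) {zero}  (p ∷ _)  refl = p
  All-at (x ∷ xs) {suc j} (_ ∷ ps) e    = All-at xs {j} ps e
AllPairs-at (x ∷ xs) {suc i} {suc j} (_ ∷ rs) e e′ (s≤s l) = AllPairs-at xs {i} {j} rs e e′ l

Downward-trans : ∀ {a b c} → Downward a b → Downward b c → Downward a c
Downward-trans (p , q) (p′ , q′) = <-trans p p′ , ≤-trans q′ q

Rightward-trans : ∀ {a b c} → Rightward a b → Rightward b c → Rightward a c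
Rightward-trans (p , q) (p′ , q′) = ≤-trans p′ p , <-trans q q′

<-∸⇒+-< : ∀ {m} n {d} → d < m ∸ n → n + d < m
<-∸⇒+-< {m}     zero    l = l
<-∸⇒+-< {suc m} (suc n) l = s≤s (<-∸⇒+-< n l)

+-<⇒<-∸ : ∀ {m} n {d} → n + d < m → d < m ∸ n
+-<⇒<-∸ zero    l       = l
+-<⇒<-∸ (suc n) (s≤s l) = +-<⇒<-∸ n l

-- Growth by a hook word

module HookGrowth {A : Set} {S : Diagram} {L : Trace A} (σ : IsShifted S) (As : AddableΔ* S L)
  (H : HookLike Downward Rightward (boxes L)) where

  private
    B = boxes L
    S⁺ = S ⊞* L
    y⁺ = isYoung (IsShifted-⊞* σ As)
    ds = proj₁ H
    x = proj₁ (proj₂ H)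
    is = proj₁ (proj₂ (proj₂ H))
    eq : B ≡ ds ++ x ∷ is
    eq = proj₁ (proj₂ (proj₂ (proj₂ H)))

  mid : ℕ
  mid = length ds

  mid< : mid < length L
  mid< = subst (length ds <_) (trans (sym (length-++ ds)) (trans (cong length (sym eq)) (length-map proj₂ L)))
    (≤-trans (≤-reflexive (sym (+-comm (length ds) 1))) (+-monoʳ-≤ (length ds) (s≤s z≤n)))

  descending : ∀ {i j b b′} → at B i ≡ just b → at B j ≡ just b′ → i < j → j ≤ mid → Downward b b′
  descending {i} {j} e e′ i<j j≤ = AllPairs-at (ds ++ [ x ]) {i} {j}
      (Linked⇒AllPairs (λ {a} {b} {c} → Downward-trans {a} {b} {c}) (proj₁ (proj₂ (proj₂ (proj₂ (proj₂ H))))))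
      (at′ (≤-trans (<⇒≤ i<j) j≤) e) (at′ j≤ e′) i<j
    where
    at′ : ∀ {k b} → k ≤ length ds → at B k ≡ just b → at (ds ++ [ x ]) k ≡ just b
    at′ {k} l e = trans (sym (at-++ˡ (ds ++ [ x ]) (<-≤-trans (s≤s l)
        (≤-reflexive (sym (trans (length-++ ds) (+-comm (length ds) 1)))))))
      (trans (cong (λ z → at z k) (trans (++-assoc ds [ x ] is) (sym eq))) e)

  ascending : ∀ {i j b b′} → at B i ≡ just b → at B j ≡ just b′ → i < j → mid ≤ i → Rightward b b′
  ascending {i} {j} e e′ i<j ≤i = AllPairs-at (x ∷ is) {i ∸ length ds} {j ∸ length ds}
      (Linked⇒AllPairs (λ {a} {b} {c} → Rightward-trans {a} {b} {c}) (proj₂ (proj₂ (proj₂ (proj₂ (proj₂ H))))))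
      (at′ ≤i e) (at′ (≤-trans ≤i (<⇒≤ i<j)) e′) (∸-monoˡ-< i<j ≤i)
    where
    at′ : ∀ {k b} → length ds ≤ k → at B k ≡ just b → at (x ∷ is) (k ∸ length ds) ≡ just b
    at′ {k} l e = trans (sym (at-++ʳ ds (k ∸ length ds)))
      (trans (cong₂ at (sym eq) (m+[n∸m]≡n l)) e)

  -- If the corner box belongs to the descending part, so does the earlier box to its left, in the
  -- same row. Otherwise it belongs to the ascending part together with the later box below it, in
  -- the same column.
  no-corner : ∀ {i j k r c} → at B i ≡ just (r , c) → at B j ≡ just (r , suc c) →
    at B k ≡ just (suc r , suc c) → ⊥
  no-corner {i} {j} {k} {r} {c} e e′ e″ with ≤-total j mid
  ... | inj₁ j≤ = <-irrefl refl (proj₁ (descending {i} {j} e e′ i<j j≤))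
    where i<j = trace-< {i = i} {j} σ As e e′ (≤-refl , n≤1+n c) (λ p → 1+n≢n (sym (cong proj₂ p)))
  ... | inj₂ ≤j = <-irrefl refl (proj₂ (ascending {j} {k} e′ e″ j<k ≤j))
    where j<k = trace-< {i = j} {k} σ As e′ e″ (n≤1+n r , ≤-refl) (λ p → 1+n≢n (sym (cong proj₁ p)))

  added : ∀ {r c} → r ≤ c → (r , c) ∈ᵈ S⁺ → ¬ (r , c) ∈ᵈ S → ∃[ i ] at B i ≡ just (r , c)
  added l m n with trace-∈⁻ σ As l m
  ... | inj₁ p = contradiction p n
  ... | inj₂ p = p

  private
    -- The lower box forces the two further boxes of a corner at the upper one into the final shape.
    -- They are new because they lie south-east of a new box.
    diagonal-< : ∀ {i j r r′ d} → at B i ≡ just (r , r + d) → at B j ≡ just (r′ , r′ + d) → r < r′ → ⊥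
    diagonal-< {i} {j} {r} {r′} {d} e e′ l = no-corner {i} {proj₁ right′} {proj₁ corner} e (proj₂ right′) (proj₂ corner)
      where
      m : (r′ , r′ + d) ∈ᵈ S⁺
      m = proj₁ (trace-∈-new j As e′)
      below-left : (r , r + d) ∈ᵈ S → ⊥
      below-left = trace-∉ {i = i} As e
      right′ : ∃[ p ] at B p ≡ just (r , suc (r + d))
      right′ = added (m≤n⇒m≤1+n (m≤m+n r d)) (down-closed y⁺ (<⇒≤ l) (+-monoˡ-≤ d l) m)
        (λ n → below-left (<-trans (n<1+n _) n))
      corner : ∃[ p ] at B p ≡ just (suc r , suc (r + d))
      corner = added (s≤s (m≤m+n r d)) (down-closed y⁺ l (+-monoˡ-≤ d l) m)
        (λ n → below-left (down-closed (isYoung σ) (n≤1+n r) (n≤1+n _) n))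

  diagonal-injective : ∀ {i j r r′ d} → at B i ≡ just (r , r + d) → at B j ≡ just (r′ , r′ + d) → r ≡ r′
  diagonal-injective {i} {j} {r} {r′} e e′ with <-cmp r r′
  ... | tri≈ _ p _ = p
  ... | tri< l _ _ = ⊥-elim (diagonal-< {i} {j} e e′ l)
  ... | tri> _ _ l = ⊥-elim (diagonal-< {j} {i} e′ e l)

  -- As many boxes as the first row is long: one on every diagonal.
  module Full (full : length L ≡ rowEnd S⁺ 0) where

    onDiagonal : ∀ {i r c} → at B i ≡ just (r , c) → c ≡ r + (c ∸ r) × c ∸ r < length L
    onDiagonal {i} {r} {c} e with trace-∈-new i As e
    ... | m , r≤c = sym (m+[n∸m]≡n r≤c)
      , <-≤-trans (down-closed y⁺ z≤n (m∸n≤m c r) m) (≤-reflexive (sym full))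

    private
      boxAt : (k : Fin (length L)) → ∃[ b ] at B (toℕ k) ≡ just b
      boxAt k = at-just B (<-≤-trans (toℕ<n k) (≤-reflexive (sym (length-map proj₂ L))))

      rowOf content : Fin (length L) → ℕ
      rowOf k = proj₁ (proj₁ (boxAt k))
      content k = proj₂ (proj₁ (boxAt k)) ∸ rowOf k

      box-content : ∀ k → at B (toℕ k) ≡ just (rowOf k , rowOf k + content k)
      box-content k = trans (proj₂ (boxAt k)) (cong (λ z → just (rowOf k , z)) (proj₁ (onDiagonal {toℕ k} (proj₂ (boxAt k)))))

      content-injective : ∀ {k l} → content k ≡ content l → k ≡ l
      content-injective {k} {l} e = toℕ-injective (same (<-cmp (toℕ k) (toℕ l)))
        where
        el : at B (toℕ l) ≡ just (rowOf l , rowOf l + content k)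
        el = trans (box-content l) (cong (λ z → just (rowOf l , rowOf l + z)) (sym e))
        r≡ = diagonal-injective {toℕ k} {toℕ l} (box-content k) el
        ek : at B (toℕ l) ≡ just (rowOf k , rowOf k + content k)
        ek = trans el (cong (λ z → just (z , z + content k)) (sym r≡))
        same : _ → toℕ k ≡ toℕ l
        same (tri≈ _ p _) = p
        same (tri< p _ _) = contradiction (≤-refl , ≤-refl) (trace-≰ {i = toℕ k} {toℕ l} σ As (box-content k) ek p)
        same (tri> _ _ p) = contradiction (≤-refl , ≤-refl) (trace-≰ {i = toℕ l} {toℕ k} σ As ek (box-content k) p)

    every-diagonal : ∀ {d} → d < length L → ∃[ i ] ∃[ r ] at B i ≡ just (r , r + d)
    every-diagonal {d} d< with Fin.any? (λ k → content k ≟ d)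
    ... | yes (k , refl) = toℕ k , rowOf k , box-content k
    ... | no none = ⊥-elim (collision (pigeonhole (n<1+n _) f))
      where
      f : Fin (suc (length L)) → Fin (length L)
      -- The diagonal `d`, supposed to be missed, is the extra pigeon.
      f zero    = fromℕ< d<
      f (suc k) = fromℕ< (proj₂ (onDiagonal {toℕ k} (proj₂ (boxAt k))))
      collision : ¬ (∃[ k ] ∃[ l ] (k Fin.< l × f k ≡ f l))
      collision (zero  , suc l , _ , e) = none (l , sym (fromℕ<-injective _ _ _ _ e))
      collision (suc k , suc l , s≤s k<l , e) = <-irrefl (cong toℕ (content-injective {k} {l} (fromℕ<-injective _ _ _ _ e))) k<l

    -- If a box of row `suc r` is in the new shape and its north-west neighbour was not in the old
    -- one, its diagonal has gained both. Conversely, the diagonal of an old box has gained a box,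
    -- which can only lie further down.
    rows : ∀ r → rowEnd S⁺ (suc r) ∸ suc r ≡ rowEnd S r ∸ r
    rows r = ≤-antisym
      (≤-from-< λ {d} l → +-<⇒<-∸ r (upper d (<-∸⇒+-< (suc r) l)))
      (≤-from-< λ {d} l → +-<⇒<-∸ (suc r) (lower d (<-∸⇒+-< r l)))
      where
      upper : ∀ d → (suc r , suc r + d) ∈ᵈ S⁺ → (r , r + d) ∈ᵈ S
      upper d m with r + d <? rowEnd S r
      ... | yes p = p
      ... | no n with added (m≤m+n r d) (down-closed y⁺ (n≤1+n r) (n≤1+n _) m) n
                    | added (s≤s (m≤m+n r d)) m (n ∘ down-closed (isYoung σ) (n≤1+n r) (n≤1+n _))
      ...   | i , e | j , e′ = contradiction (diagonal-injective {i} {j} {d = d} e e′) (1+n≢n ∘ sym)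
      lower : ∀ d → (r , r + d) ∈ᵈ S → (suc r , suc r + d) ∈ᵈ S⁺
      lower d m with every-diagonal (<-≤-trans (down-closed y⁺ z≤n (m≤n+m d r) (trace-∈ L m)) (≤-reflexive (sym full)))
      ... | i , r′ , e with ≤-<-connex r′ r
      ...   | inj₁ r′≤r = contradiction (down-closed (isYoung σ) r′≤r (+-monoˡ-≤ d r′≤r) m) (trace-∉ {i = i} As e)
      ...   | inj₂ r<r′ = down-closed y⁺ r<r′ (+-monoˡ-≤ d r<r′) (proj₁ (trace-∈-new i As e))

    -- If the box on the next diagonal were anywhere else, one of the two diagonals would gain a
    -- second box.
    adjacent : ∀ {i j r r′ d} → at B i ≡ just (r , r + d) → at B j ≡ just (r′ , r′ + suc d) →
      r′ ≡ r ⊎ r ≡ suc r′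
    adjacent {i} {j} {r} {r′} {d} e e′ with <-cmp r r′
    ... | tri≈ _ p _ = inj₁ (sym p)
    ... | tri< l _ _ with added {suc r} {suc r + d} (m≤m+n (suc r) d)
            (down-closed y⁺ l (+-mono-≤ l (n≤1+n d)) (proj₁ (trace-∈-new j As e′)))
            (trace-∉ {i = i} As e ∘ down-closed (isYoung σ) (n≤1+n r) (n≤1+n _))
    ...   | k , e″ = contradiction (diagonal-injective {i} {k} {d = d} e e″) (1+n≢n ∘ sym)
    adjacent {i} {j} {r} {r′} {d} e e′ | tri> _ _ l with m≤n⇒m<n∨m≡n l
    ... | inj₂ p = inj₂ (sym p)
    ... | inj₁ l′ with added {suc r′} {suc r′ + suc d} (m≤m+n (suc r′) (suc d))
            (down-closed y⁺ l (≤-trans (≤-reflexive (cong suc (+-suc r′ d))) (+-monoˡ-≤ d l′)) (proj₁ (trace-∈-new i As e)))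
            (trace-∉ {i = j} As e′ ∘ down-closed (isYoung σ) (n≤1+n r′) (n≤1+n _))
    ...   | k , e″ = contradiction (diagonal-injective {j} {k} {d = suc d} e′ e″) (1+n≢n ∘ sym)

-- Vees in the recording tableau from growth by a hook

record Segment {A : Set} (Q : Filling ℕ) (a : ℕ) (L : Trace A) : Set where
  field
    segment⁺ : ∀ {b} i → at (boxes L) i ≡ just b → entry Q b ≡ just (suc (a + i))
    segment⁻ : ∀ {b e} → entry Q b ≡ just e → a < e → e ≤ a + length L →
      ∃[ i ] (at (boxes L) i ≡ just b × e ≡ suc (a + i))
open Segment public

module _ {A : Set} {S : Diagram} {L : Trace A} {Q : Filling ℕ} {a : ℕ} (σ : IsShifted S) (As : AddableΔ* S L)
  (H : HookLike Downward Rightward (boxes L)) (seg : Segment Q a L) where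

  open HookGrowth σ As H

  private
    B = boxes L
    k = a + length L

    at-unique : ∀ {i b b′} → at B i ≡ just b → at B i ≡ just b′ → b ≡ b′
    at-unique e e′ = just-injective (trans (sym e) e′)

    a+mid< : suc (a + mid) ≤ k
    a+mid< = ≤-trans (≤-reflexive (sym (+-suc a mid))) (+-monoʳ-≤ a mid<)

    strip : ∀ {b e i j} → _∈[_,_]_ Q b i j e → suc a ≤ i → j ≤ k → ∃[ n ] (at B n ≡ just b × e ≡ suc (a + n))
    strip (p , q , r) l m = segment⁻ seg p (≤-trans l q) (≤-trans r m)

    drop-a : ∀ {m n} → suc (a + m) ≤ suc (a + n) → m ≤ n
    drop-a l = +-cancelˡ-≤ a _ _ (s≤s⁻¹ l)

    top : ∀ {b e} → _∈[_,_]_ Q b (suc a) (suc (a + mid)) e → ∃[ n ] (at B n ≡ just b × e ≡ suc (a + n) × n ≤ mid)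
    top m@(_ , _ , u) with strip m ≤-refl a+mid<
    ... | n , p , refl = n , p , refl , drop-a u

    bottom : ∀ {b e} → _∈[_,_]_ Q b (suc (a + mid)) k e → ∃[ n ] (at B n ≡ just b × e ≡ suc (a + n) × mid ≤ n)
    bottom m@(_ , u , _) with strip m (s≤s (m≤m+n a mid)) ≤-refl
    ... | n , p , refl = n , p , refl , drop-a u

  isVee : IsVee Q (suc a) k
  isVee = record
    { borderStrip = λ r c ((_ , m₁) , (_ , m₂) , _ , (_ , m₃)) →
        corner (strip m₁ ≤-refl ≤-refl) (strip m₂ ≤-refl ≤-refl) (strip m₃ ≤-refl ≤-refl)
    -- The entry of the turning box of the hook: positions in the trace start from 0, entries of the
    -- segment from `suc a`.
    ; j = suc (a + mid) ; i≤j = s≤s (m≤m+n a mid) ; j≤k = a+mid<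
    ; vertical = record { one-per-row = one-row ; downward = down′ }
    ; horizontal = record { one-per-column = one-col ; rightward = right′ }
    ; left-of = left }
    where
    corner : ∀ {r c e f g} → ∃[ n ] (at B n ≡ just (r , c) × e ≡ suc (a + n)) →
      ∃[ n ] (at B n ≡ just (r , suc c) × f ≡ suc (a + n)) →
      ∃[ n ] (at B n ≡ just (suc r , suc c) × g ≡ suc (a + n)) → ⊥
    corner (i , p , _) (j , q , _) (l , s , _) = no-corner {i} {j} {l} p q s
    one-row : ∀ {r c c′} → InStrip Q (suc a) (suc (a + mid)) (r , c) → InStrip Q (suc a) (suc (a + mid)) (r , c′) → c ≡ c′
    one-row (_ , m) (_ , m′) with top m | top m′
    ... | n , p , _ , l | n′ , p′ , _ , l′ with <-cmp n n′
    ...   | tri≈ _ refl _ = cong proj₂ (at-unique {n} p p′)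
    ...   | tri< q _ _    = ⊥-<-refl (proj₁ (descending {n} {n′} p p′ q l′))
    ...   | tri> _ _ q    = ⊥-<-refl (proj₁ (descending {n′} {n} p′ p q l))
    down′ : ∀ {r c r′ c′ e e′} → r < r′ → _∈[_,_]_ Q (r , c) (suc a) (suc (a + mid)) e →
      _∈[_,_]_ Q (r′ , c′) (suc a) (suc (a + mid)) e′ → e < e′
    down′ r< m m′ with top m | top m′
    ... | n , p , refl , l | n′ , p′ , refl , l′ with <-cmp n n′
    ...   | tri≈ _ refl _ = contradiction r< (<-irrefl (cong proj₁ (at-unique {n} p p′)))
    ...   | tri< q _ _    = s≤s (+-monoʳ-< a q)
    ...   | tri> _ _ q    = contradiction (proj₁ (descending {n′} {n} p′ p q l)) (<⇒≯ r<)
    one-col : ∀ {r r′ c} → InStrip Q (suc (a + mid)) k (r , c) → InStrip Q (suc (a + mid)) k (r′ , c) → r ≡ r′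
    one-col (_ , m) (_ , m′) with bottom m | bottom m′
    ... | n , p , _ , l | n′ , p′ , _ , l′ with <-cmp n n′
    ...   | tri≈ _ refl _ = cong proj₁ (at-unique {n} p p′)
    ...   | tri< q _ _    = ⊥-<-refl (proj₂ (ascending {n} {n′} p p′ q l))
    ...   | tri> _ _ q    = ⊥-<-refl (proj₂ (ascending {n′} {n} p′ p q l′))
    right′ : ∀ {r c r′ c′ e e′} → c < c′ → _∈[_,_]_ Q (r , c) (suc (a + mid)) k e →
      _∈[_,_]_ Q (r′ , c′) (suc (a + mid)) k e′ → e < e′
    right′ c< m m′ with bottom m | bottom m′
    ... | n , p , refl , l | n′ , p′ , refl , l′ with <-cmp n n′
    ...   | tri≈ _ refl _ = contradiction c< (<-irrefl (cong proj₂ (at-unique {n} p p′)))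
    ...   | tri< q _ _    = s≤s (+-monoʳ-< a q)
    ...   | tri> _ _ q    = contradiction (proj₂ (ascending {n′} {n} p′ p q l′)) (<⇒≯ c<)
    left : ∀ {r c c′} → InStrip Q (suc a) (suc (a + mid)) (r , c) → InStrip Q (suc (a + mid)) k (r , c′) → c ≤ c′
    left (_ , m) (_ , m′) with top m | bottom m′
    ... | n , p , _ , l | n′ , p′ , _ , l′ with m≤n⇒m<n∨m≡n (≤-trans l l′)
    ...   | inj₂ refl = ≤-reflexive (cong proj₂ (at-unique {n} p p′))
    ...   | inj₁ q    = ≮⇒≥ λ c′<c → trace-≰ {i = n} {n′} σ As p p′ q (≤-refl , <⇒≤ c′<c)

  module _ (full : length L ≡ rowEnd (S ⊞* L) 0) where

    open Full full

    private
      Path : Box → Box → Set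
      Path = Star (λ p q → InStrip Q (suc a) k p × InStrip Q (suc a) k q × Adjacent p q)

      inStrip : ∀ {n b} → at B n ≡ just b → InStrip Q (suc a) k b
      inStrip {n} p = _ , segment⁺ seg n p , s≤s (m≤m+n a n)
        , ≤-trans (≤-reflexive (sym (+-suc a n))) (+-monoʳ-≤ a (<-≤-trans (at-< B {n} p) (≤-reflexive (length-map proj₂ L))))

      ∣1+n-n∣ : ∀ n → ∣ suc n - n ∣ ≡ 1
      ∣1+n-n∣ zero    = refl
      ∣1+n-n∣ (suc n) = ∣1+n-n∣ n

      neighbours : ∀ {r r′ d} → r′ ≡ r ⊎ r ≡ suc r′ →
        Adjacent (r , r + d) (r′ , r′ + suc d) × Adjacent (r′ , r′ + suc d) (r , r + d)
      neighbours {r} {.r} {d} (inj₁ refl) rewrite ∣n-n∣≡0 r | +-suc r d = trans (∣-∣-comm (r + d) _) (∣1+n-n∣ (r + d)) , ∣1+n-n∣ (r + d)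
      neighbours {.(suc r′)} {r′} {d} (inj₂ refl) rewrite +-suc r′ d | ∣n-n∣≡0 (r′ + d) =
        trans (+-identityʳ _) (∣1+n-n∣ r′) , trans (+-identityʳ _) (trans (∣-∣-comm r′ (suc r′)) (∣1+n-n∣ r′))

      -- Induction on the number of diagonals between the two boxes; each of them carries a box of
      -- the strip, and those on consecutive diagonals are neighbours.
      paths : ∀ m {n n′ r r′ d} → at B n ≡ just (r , r + d) → at B n′ ≡ just (r′ , r′ + (m + d)) →
        Path (r , r + d) (r′ , r′ + (m + d)) × Path (r′ , r′ + (m + d)) (r , r + d)
      paths zero {n} {n′} p p′ with diagonal-injective {n} {n′} p p′
      ... | refl = ε , ε
      paths (suc m) {n} {n′} {r} {r′} {d} p p′ with every-diagonal (≤-trans (s≤s (n≤1+n _))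
          (subst (_< length L) (m+n∸m≡n r′ (suc m + d)) (proj₂ (onDiagonal {n′} p′))))
      ... | n″ , r″ , p″ with paths m {n} {n″} p p″ | neighbours (adjacent {n″} {n′} p″ p′)
      ...   | there′ , back | to , from =
          there′ ◅◅ ((inStrip {n″} p″ , inStrip {n′} p′ , to) ◅ ε)
        , (inStrip {n′} p′ , inStrip {n″} p″ , from) ◅ back

    isConnectedVee : IsConnectedVee Q (suc a) k
    isConnectedVee = record { isVee = isVee ; connected = connect }
      where
      connect : IsConnected Q (suc a) k
      connect {r , c} {r′ , c′} (_ , m) (_ , m′) with strip m ≤-refl ≤-refl | strip m′ ≤-refl ≤-refl
      ... | n , p , _ | n′ , p′ , _ with proj₁ (onDiagonal {n} p) | proj₁ (onDiagonal {n′} p′)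
      ...   | e | e′ with ≤-total (c ∸ r) (c′ ∸ r′)
      ...     | inj₁ l = subst₂ (λ x y → Path (r , x) (r′ , y)) (sym e) (sym e″)
          (proj₁ (paths (c′ ∸ r′ ∸ (c ∸ r)) {n} {n′}
            (trans p (cong (λ z → just (r , z)) e)) (trans p′ (cong (λ z → just (r′ , z)) e″))))
        where
        e″ : c′ ≡ r′ + (c′ ∸ r′ ∸ (c ∸ r) + (c ∸ r))
        e″ = trans e′ (cong (r′ +_) (sym (m∸n+n≡m l)))
      ...     | inj₂ l = subst₂ (λ x y → Path (r , x) (r′ , y)) (sym e″) (sym e′)
          (proj₂ (paths (c ∸ r ∸ (c′ ∸ r′)) {n′} {n}
            (trans p′ (cong (λ z → just (r′ , z)) e′)) (trans p (cong (λ z → just (r , z)) e″))))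
        where
        e″ : c ≡ r + (c ∸ r ∸ (c′ ∸ r′) + (c′ ∸ r′))
        e″ = trans e (cong (r +_) (sym (m∸n+n≡m l)))

-- Hooks as sequences without peaks

NoPeak : {A : Set} (D R : A → A → Set) → List A → Set
NoPeak D R (x ∷ l@(y ∷ z ∷ _)) = ¬ (R x y × D y z) × NoPeak D R l
NoPeak D R _                   = ⊤

-- Any two consecutive members ascend or descend, and the absence of peaks means that no descent
-- follows an ascent.
noPeak⇒hook : ∀ {A : Set} {D R : A → A → Set} x w → Linked (λ x y → R x y ⊎ D x y) (x ∷ w) → NoPeak D R (x ∷ w) →
  HookLike D R (x ∷ w)
noPeak⇒hook x []      _ _ = [] , x , [] , refl , [-] , [-]
noPeak⇒hook x (y ∷ w) (inj₂ d ∷ l) n = hook-∷ d (noPeak⇒hook y w l (tail-noPeak w n))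
  where
  tail-noPeak : ∀ {A : Set} {D R : A → A → Set} {x y} w → NoPeak D R (x ∷ y ∷ w) → NoPeak D R (y ∷ w)
  tail-noPeak []      _       = tt
  tail-noPeak (_ ∷ _) (_ , n) = n
noPeak⇒hook x (y ∷ []) (inj₁ r ∷ l) n = [] , x , y ∷ [] , refl , [-] , r ∷ [-]
noPeak⇒hook x (y ∷ z ∷ w) (inj₁ r ∷ l) (n , n′) with noPeak⇒hook y (z ∷ w) l n′
... | []     , .y , is , refl , _ , a = [] , x , y ∷ is , refl , [-] , r ∷ a
... | d ∷ [] , z′ , is , refl , (q ∷ _) , a = contradiction (r , q) n
... | d ∷ d′ ∷ ds , z′ , is , refl , (q ∷ _) , a = contradiction (r , q) n

private
  hook-start : ∀ {A : Set} {D R : A → A → Set} → (∀ {x y} → R x y → ¬ D x y) → ∀ {x y z w} →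
    HookLike D R (x ∷ y ∷ z ∷ w) → ¬ (R x y × D y z) × HookLike D R (y ∷ z ∷ w)
  hook-start ex ([] , _ , _ , refl , _ , r ∷ r′ ∷ rs) =
    (λ (_ , q) → ex r′ q) , [] , _ , _ , refl , [-] , r′ ∷ rs
  hook-start ex (_ ∷ [] , _ , is , refl , d ∷ ds , rs) =
    (λ (p , _) → ex p d) , [] , _ , is , refl , ds , rs
  hook-start ex (_ ∷ _ ∷ ds , x , is , e , d ∷ l , rs)
    with ∷-injectiveˡ e | ∷-injectiveˡ (∷-injectiveʳ e)
  ... | refl | refl = (λ (p , _) → ex p d) , _ ∷ ds , x , is , ∷-injectiveʳ e , l , rs

hook⇒noPeak : ∀ {A : Set} {D R : A → A → Set} → (∀ {x y} → R x y → ¬ D x y) → ∀ w → HookLike D R w → NoPeak D R w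
hook⇒noPeak ex []               _ = tt
hook⇒noPeak ex (_ ∷ [])         _ = tt
hook⇒noPeak ex (_ ∷ _ ∷ [])     _ = tt
hook⇒noPeak ex (x ∷ y ∷ z ∷ w) h = proj₁ (hook-start ex h) , hook⇒noPeak ex (y ∷ z ∷ w) (proj₂ (hook-start ex h))

-- The middle box of a peak would lie in the vertical strip, which forbids the step to the right
-- before it, or in the horizontal strip, which forbids the step down after it.
vee⇒noPeak : ∀ {A} {Q a} {L : Trace A} → Segment Q a L → IsVee Q (suc a) (a + length L) →
  NoPeak Downward Rightward (boxes L)
vee⇒noPeak {Q = Q} {a} {L} seg v = build (boxes L) λ n p p′ p″ → refute n p p′ p″
  where
  open IsVee v
  open IsIncreasingVerticalStrip vertical using (one-per-row) renaming (downward to down<)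
  open IsIncreasingHorizontalStrip horizontal using (one-per-column) renaming (rightward to right<)
  build : ∀ bs → (∀ n {x y z} → at bs n ≡ just x → at bs (suc n) ≡ just y → at bs (2 + n) ≡ just z →
    ¬ (Rightward x y × Downward y z)) → NoPeak Downward Rightward bs
  build []               _ = tt
  build (_ ∷ [])         _ = tt
  build (_ ∷ _ ∷ [])     _ = tt
  build (_ ∷ _ ∷ _ ∷ bs) f = f 0 refl refl refl , build (_ ∷ _ ∷ bs) λ n → f (suc n)
  inside′ : ∀ n {b} → at (boxes L) n ≡ just b →
    entry Q b ≡ just (suc (a + n)) × suc a ≤ suc (a + n) × suc (a + n) ≤ a + length L
  inside′ n e = segment⁺ seg n e , s≤s (m≤m+n a n)
    , ≤-trans (≤-reflexive (sym (+-suc a n))) (+-monoʳ-≤ a (<-≤-trans (at-< (boxes L) {n} e) (≤-reflexive (length-map proj₂ L))))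
  refute : ∀ n {x y z} → at (boxes L) n ≡ just x → at (boxes L) (suc n) ≡ just y → at (boxes L) (2 + n) ≡ just z →
    ¬ (Rightward x y × Downward y z)
  refute n e e′ e″ ((p , q) , (p′ , q′)) with inside′ n e | inside′ (suc n) e′ | inside′ (2 + n) e″
  ... | f , l , u | f′ , l′ , u′ | f″ , l″ , u″ with ≤-<-connex (suc (a + suc n)) j
  ...   | inj₁ le with m≤n⇒m<n∨m≡n p
  ...     | inj₁ r< = contradiction (down< r< (f′ , l′ , le) (f , l , ≤-trans (s≤s (+-monoʳ-≤ a (n≤1+n n))) le))
                        (≤⇒≯ (s≤s (+-monoʳ-≤ a (n≤1+n n))))
  ...     | inj₂ refl = contradiction q (<-irrefl (one-per-row (_ , f , l , ≤-trans (s≤s (+-monoʳ-≤ a (n≤1+n n))) le) (_ , f′ , l′ , le)))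
  refute n e e′ e″ ((p , q) , (p′ , q′)) | f , l , u | f′ , l′ , u′ | f″ , l″ , u″ | inj₂ gt with m≤n⇒m<n∨m≡n q′
  ...     | inj₁ c< = contradiction (right< c< (f″ ,
                          ≤-trans (<⇒≤ gt) (s≤s (+-monoʳ-≤ a (n≤1+n (suc n)))) , u″) (f′ , <⇒≤ gt , u′))
                        (≤⇒≯ (s≤s (+-monoʳ-≤ a (n≤1+n (suc n)))))
  ...     | inj₂ refl = contradiction p′ (<-irrefl (one-per-column (_ , f′ , <⇒≤ gt , u′)
                          (_ , f″ , ≤-trans (<⇒≤ gt) (s≤s (+-monoʳ-≤ a (n≤1+n (suc n)))) , u″)))

Peaks-drop : ∀ L M → Peaks (L ++ M) → Peaks M
Peaks-drop []      M p = p
Peaks-drop (x ∷ L) M p = Peaks-drop L M (Peaks-tail x (L ++ M) p)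

Peaks-take : ∀ L {M} → Peaks (L ++ M) → Peaks L
Peaks-take []                _           = tt
Peaks-take (_ ∷ [])          _           = tt
Peaks-take (_ ∷ _ ∷ [])      _           = tt
Peaks-take (_ ∷ y ∷ z ∷ L)   (f , g , p) = f , g , Peaks-take (y ∷ z ∷ L) p

noPeak-boxes : ∀ L → Peaks L → NoPeak _>ˣ_ _≤ˣ_ (words L) → NoPeak Downward Rightward (boxes L)
noPeak-boxes []              _           _       = tt
noPeak-boxes (_ ∷ [])        _           _       = tt
noPeak-boxes (_ ∷ _ ∷ [])    _           _       = tt
noPeak-boxes (_ ∷ y ∷ z ∷ L) (f , g , p) (n , m) = n ∘ g , noPeak-boxes (y ∷ z ∷ L) p m

noPeak-words : ∀ L → Peaks L → NoPeak Downward Rightward (boxes L) → NoPeak _>ˣ_ _≤ˣ_ (words L)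
noPeak-words []              _           _       = tt
noPeak-words (_ ∷ [])        _           _       = tt
noPeak-words (_ ∷ _ ∷ [])    _           _       = tt
noPeak-words (_ ∷ y ∷ z ∷ L) (f , g , p) (n , m) = n ∘ f , noPeak-words (y ∷ z ∷ L) p m

boxes-turn : ∀ {A S} {L : Trace A} → IsShifted S → AddableΔ* S L →
  Linked (λ x y → Rightward x y ⊎ Downward x y) (boxes L)
boxes-turn σ []           = []
boxes-turn σ (A ∷ [])     = [-]
boxes-turn σ (_∷_ {b = a} A As@(B ∷ _)) = turn σ A B ∷ boxes-turn (IsShifted-⊞ a σ A) As

words-turn : ∀ w → Linked (λ x y → x ≤ˣ y ⊎ x >ˣ y) w
words-turn []          = []
words-turn (x ∷ [])    = [-]
words-turn (x ∷ y ∷ w) = ≤-<-connex (value x) (value y) ∷ words-turn (y ∷ w)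

hook-boxes : ∀ {S L} → IsShifted S → AddableΔ* S L → Peaks L → HookWord (words L) → HookLike Downward Rightward (boxes L)
hook-boxes {L = []}    σ As p ([] , _ , _ , () , _)
hook-boxes {L = []}    σ As p (_ ∷ _ , _ , _ , () , _)
hook-boxes {L = _ ∷ L} σ As p h = noPeak⇒hook _ (boxes L) (boxes-turn σ As)
  (noPeak-boxes (_ ∷ L) p (hook⇒noPeak (λ l g → <-irrefl refl (<-≤-trans g l)) _ h))

hook-words : ∀ L → Peaks L → NoPeak Downward Rightward (boxes L) → 0 < length L → HookWord (words L)
hook-words (_ ∷ L) p n _ = noPeak⇒hook _ (words L) (words-turn _) (noPeak-words (_ ∷ L) p n)

-- The first row of the insertion tableau

firstRowLength : Word → ℕ
firstRowLength w = length (row (Pmix w) 0)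

record WordTrace (w : Word) : Set where
  field
    {Z}      : List Letter
    standard : Standard Z
    tracedZ  : Traced Z
    spelling : map proj₁ Z ≡ w
  open Traced tracedZ public
  words≡ : words trace ≡ w
  words≡ = trans (map-∘ trace) (trans (cong (map proj₁) spells) spelling)
  firstRow≡ : rowEnd (∅ ⊞* trace) 0 ≡ firstRowLength w
  firstRow≡ = trans (sym (lengths (models-P (mix-simulates grows)) 0)) (cong firstRowLength words≡)

wordTrace : ∀ w → WordTrace w
wordTrace w with standardize w
... | Z , e , s = record { standard = s ; tracedZ = traced Z s ; spelling = e }

hook≤firstRowLength : ∀ {u w} → IsHookSubword u w → length u ≤ firstRowLength w
hook≤firstRowLength {u} {w} h = subst (length u ≤_) firstRow≡
  (hook≤firstRow standard tracedZ u (subst (IsHookSubword u) (sym spelling) h))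
  where open WordTrace (wordTrace w)

firstRowLength-hook : ∀ {w} → w ≢ [] → ∃[ u ] (IsHookSubword u w × length u ≡ firstRowLength w)
firstRowLength-hook {w} ne with firstRow-hook standard tracedZ (λ e → ne (trans (sym spelling) (cong (map proj₁) e)))
  where open WordTrace (wordTrace w)
... | u , h , e = u , subst (IsHookSubword u) spelling h , trans e firstRow≡
  where open WordTrace (wordTrace w)

maximumHook-length : ∀ {u w} → IsMaximumHookSubword u w → length u ≡ firstRowLength w
maximumHook-length {u} {w} m = ≤-antisym (hook≤firstRowLength isHookSubword) attained′
  where
  open IsMaximumHookSubword m
  nonEmpty : w ≢ []
  nonEmpty refl with IsHookSubword.subsequence isHookSubword | IsHookSubword.hook isHookSubword
  ... | ⊆.[] | [] , _ , _ , () , _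
  ... | ⊆.[] | _ ∷ _ , _ , _ , () , _
  attained′ : firstRowLength w ≤ length u
  attained′ with firstRowLength-hook nonEmpty
  ... | v , h , e = ≤-trans (≤-reflexive (sym e)) (maximum v h)

-- Appending a hook word as long as the first row

Grow-++ : ∀ {cs cs″} L {M} → Grow cs (L ++ M) cs″ → ∃[ cs′ ] (Grow cs L cs′ × Grow cs′ M cs″)
Grow-++ []      g       = _ , [] , g
Grow-++ (_ ∷ L) (i ∷ g) with Grow-++ L g
... | cs′ , g₁ , g₂ = cs′ , i ∷ g₁ , g₂

AddableΔ*-++ : ∀ {A S} (L : Trace A) {M} → AddableΔ* S (L ++ M) → AddableΔ* S L × AddableΔ* (S ⊞* L) M
AddableΔ*-++ []      As       = [] , As
AddableΔ*-++ (_ ∷ L) (A ∷ As) with AddableΔ*-++ L As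
... | p , q = A ∷ p , q

⊞*-++ : ∀ {A S} (L : Trace A) {M} → S ⊞* (L ++ M) ≡ S ⊞* L ⊞* M
⊞*-++ []      = refl
⊞*-++ (x ∷ L) = ⊞*-++ L

Grow-AddableΔ* : ∀ {L cs} → Grow [] L cs → AddableΔ* ∅ L
Grow-AddableΔ* g = proj₁ (Grow-Addable IsTableau-[] g)

module Append (L M : Trace Letter) {cs : List Cell} (g : Grow [] (L ++ M) cs) where

  private
    As = AddableΔ*-++ L (Grow-AddableΔ* g)

  addable-M : AddableΔ* (∅ ⊞* L) M
  addable-M = proj₂ As

  shifted-L : IsShifted (∅ ⊞* L)
  shifted-L = IsShifted-⊞* IsShifted-∅ (proj₁ As)

  full : length M ≡ firstRowLength (words (L ++ M)) → length M ≡ rowEnd (∅ ⊞* L ⊞* M) 0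
  full e = trans e (trans (lengths (models-P (mix-simulates g)) 0) (cong (λ S → rowEnd S 0) (⊞*-++ L)))

  module _ (hook : HookLike Downward Rightward (boxes M)) (e : length M ≡ firstRowLength (words (L ++ M))) where

    open HookGrowth shifted-L addable-M hook using (mid<; module Full)

    shape-append : shape (Pmix (words (L ++ M))) ≡ length M ∷ shape (Pmix (words L))
    shape-append = part-injective (noEmpty PM) (>-nonZero (≤-<-trans z≤n mid<) ∷ noEmpty PL) parts
      where
      PM = models-P (mix-simulates g)
      PL = models-P (mix-simulates (proj₁ (proj₂ (Grow-++ L g))))
      parts : ∀ i → part (shape (Pmix (words (L ++ M)))) i ≡ part (length M ∷ shape (Pmix (words L))) i
      parts zero    = trans (part-shape (Pmix (words (L ++ M))) 0) (sym e)
      parts (suc i) = begin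
        part (shape (Pmix (words (L ++ M)))) (suc i) ≡⟨ part-shape (Pmix (words (L ++ M))) (suc i) ⟩
        length (row (Pmix (words (L ++ M))) (suc i)) ≡⟨ lengths PM (suc i) ⟩
        rowEnd (∅ ⊞* (L ++ M)) (suc i) ∸ suc i       ≡⟨ cong (λ S → rowEnd S (suc i) ∸ suc i) (⊞*-++ L) ⟩
        rowEnd (∅ ⊞* L ⊞* M) (suc i) ∸ suc i         ≡⟨ Full.rows (full e) i ⟩
        rowEnd (∅ ⊞* L) i ∸ i                        ≡⟨ lengths PL i ⟨
        length (row (Pmix (words L)) i)              ≡⟨ part-shape (Pmix (words L)) i ⟨
        part (shape (Pmix (words L))) i              ∎
        where open ≡-Reasoning

-- Factorizations into maximum hook subwords

-- Maximality is also asked of `u_l`, whose product is `u_l` itself, so that recursions treat all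
-- factors alike.
data Factorization : List Word → Set where
  []  : Factorization []
  _∷_ : ∀ {u us} → IsMaximumHookSubword u (descendingProduct (u ∷ us)) → Factorization us → Factorization (u ∷ us)

descendingProduct-∷ : ∀ u us → descendingProduct (u ∷ us) ≡ descendingProduct us ++ u
descendingProduct-∷ u us = trans (cong concat (unfold-reverse u us))
  (trans (sym (concat-++ (reverse us) [ u ])) (cong (descendingProduct us ++_) (++-identityʳ u)))

length-descendingProduct : ∀ us → length (descendingProduct us) ≡ sum (map length us)
length-descendingProduct []       = refl
length-descendingProduct (u ∷ us) = trans (cong length (descendingProduct-∷ u us))
  (trans (length-++ (descendingProduct us)) (trans (+-comm _ (length u)) (cong (length u +_) (length-descendingProduct us))))

Factorization-drop : ∀ {us} n → Factorization us → Factorization (drop n us)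
Factorization-drop zero    f       = f
Factorization-drop (suc n) []      = []
Factorization-drop (suc n) (_ ∷ f) = Factorization-drop n f

private
  fromHooks : ∀ us → (∀ i → HookWord (lookup us i)) →
    (∀ i → suc (toℕ i) < length us → IsMaximumHookSubword (lookup us i) (descendingProduct (drop (toℕ i) us))) →
    Factorization us
  fromHooks []            _ _ = []
  fromHooks (u ∷ [])      h m = subst (IsMaximumHookSubword u) (sym (++-identityʳ u)) record
    { isHookSubword = record { subsequence = ⊆-refl ; hook = h zero }
    ; maximum = λ v s → ⊆.length-mono-≤ (IsHookSubword.subsequence s) } ∷ []
  fromHooks (u ∷ v ∷ us)  h m = m zero (s≤s z<s) ∷ fromHooks (v ∷ us) (h ∘ suc) (λ i l → m (suc i) (s≤s l))

factorization⁻ : ∀ {us w} → IsMaximumHookFactorization us w → Factorization us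
factorization⁻ {us} f = fromHooks us hooks maximum
  where open IsMaximumHookFactorization f

factorization⁺ : ∀ {us} → Factorization us → IsMaximumHookFactorization us (descendingProduct us)
factorization⁺ {us} f = record { factorization = refl
  ; hooks = λ i → IsHookSubword.hook (IsMaximumHookSubword.isHookSubword (maximum′ f i)) ; maximum = λ i _ → maximum′ f i }
  where
  maximum′ : ∀ {us} → Factorization us → ∀ i → IsMaximumHookSubword (lookup us i) (descendingProduct (drop (toℕ i) us))
  maximum′ (m ∷ _) zero    = m
  maximum′ (_ ∷ f) (suc i) = maximum′ f i

record LastFactor (u : Word) (us : List Word) (L : Trace Letter) (cs : List Cell) : Set where
  field
    {init last} : Trace Letter
    L≡      : L ≡ init ++ last
    words-i : words init ≡ descendingProduct us
    words-l : words last ≡ u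
    hook    : HookLike Downward Rightward (boxes last)
    first   : length last ≡ firstRowLength (words (init ++ last))

lastFactor : ∀ {u us L cs} → IsMaximumHookSubword u (descendingProduct (u ∷ us)) → words L ≡ descendingProduct (u ∷ us) →
  Grow [] L cs → Peaks L → LastFactor u us L cs
lastFactor {u} {us} {L} m e g p with map-++⁻ (proj₁ ∘ proj₁) L (descendingProduct us) (trans e (descendingProduct-∷ u us))
... | L₁ , L₂ , refl , e₁ , e₂ = record
  { L≡ = refl ; words-i = e₁ ; words-l = e₂
  ; hook = hook-boxes shifted-L addable-M (Peaks-drop L₁ L₂ p)
      (subst HookWord (sym e₂) (IsHookSubword.hook (IsMaximumHookSubword.isHookSubword m)))
  ; first = trans (sym (length-map _ L₂)) (trans (cong length e₂)
      (trans (maximumHook-length m) (cong firstRowLength (sym e)))) }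
  where open Append L₁ L₂ g

shape-trace : ∀ {us L cs} → Factorization us → words L ≡ descendingProduct us → Grow [] L cs → Peaks L →
  shape (Pmix (words L)) ≡ map length us
shape-trace {L = []} [] e g p = refl
shape-trace {u ∷ us} (m ∷ f) e g p with lastFactor {u} {us} m e g p
... | record { init = L₁ ; last = L₂ ; L≡ = refl ; words-i = e₁ ; words-l = e₂ ; hook = h ; first = l } =
  trans (shape-append h l) (cong₂ _∷_ (trans (sym (length-map _ L₂)) (cong length e₂))
    (shape-trace f e₁ (proj₁ (proj₂ (Grow-++ L₁ g))) (Peaks-take L₁ p)))
  where open Append L₁ L₂ g

shape-factorization : ∀ {us} → Factorization us → shape (Pmix (descendingProduct us)) ≡ map length us
shape-factorization {us} f = subst (λ w → shape (Pmix w) ≡ map length us) words≡ (shape-trace f words≡ grows peaks)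
  where open WordTrace (wordTrace (descendingProduct us))

-- The recording tableau of a factorized word

segment : ∀ {Q} (L M N : Trace Letter) → Records Q (L ++ (M ++ N)) → Segment Q (length L) M
segment {Q} L M N R = record { segment⁺ = seg⁺ ; segment⁻ = seg⁻ }
  where
  B≡ : boxes (L ++ (M ++ N)) ≡ boxes L ++ (boxes M ++ boxes N)
  B≡ = trans (map-++ proj₂ L (M ++ N)) (cong (boxes L ++_) (map-++ proj₂ M N))
  at≡ : ∀ {i} → i < length M → at (boxes (L ++ (M ++ N))) (length L + i) ≡ at (boxes M) i
  at≡ {i} l = trans (cong₂ at B≡ (cong (_+ i) (sym (length-map proj₂ L))))
    (trans (at-++ʳ (boxes L) i) (at-++ˡ (boxes M) (subst (i <_) (sym (length-map proj₂ M)) l)))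
  seg⁺ : ∀ {b} i → at (boxes M) i ≡ just b → entry Q b ≡ just (suc (length L + i))
  seg⁺ i e = entry⁺ R (length L + i) (trans (at≡ (subst (i <_) (length-map proj₂ M) (at-< (boxes M) {i} e))) e)
  seg⁻ : ∀ {b e} → entry Q b ≡ just e → length L < e → e ≤ length L + length M →
    ∃[ i ] (at (boxes M) i ≡ just b × e ≡ suc (length L + i))
  seg⁻ p l u with entry⁻ R p
  ... | n , q , refl = n ∸ length L
      , trans (sym (at≡ (+-cancelˡ-< (length L) _ _ (subst (_< length L + length M) (sym n≡) u))))
          (trans (cong (at (boxes (L ++ (M ++ N)))) n≡) q)
      , cong suc (sym n≡)
    where
    n≡ : length L + (n ∸ length L) ≡ n
    n≡ = m+[n∸m]≡n (s≤s⁻¹ l)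

-- `N` is the trace of the factors already split off on the right, so that `Q` remains the recording
-- tableau of the whole word in the recursion.
vees : ∀ {us L cs Q} N → Factorization us → words L ≡ descendingProduct us → Grow [] L cs → Peaks L →
  Records Q (L ++ N) → let λs = map length us in ∀ i → i < length λs →
  IsConnectedVee Q (suc (sum (drop (suc i) λs))) (sum (drop i λs))
vees N [] e g p R i ()
vees {u ∷ us} {Q = Q} N (m ∷ f) e g p R i i< with lastFactor {u} {us} m e g p
... | record { init = L₁ ; last = L₂ ; L≡ = refl ; words-i = e₁ ; words-l = e₂ ; hook = h ; first = l } = go i i<
  where
  open Append L₁ L₂ g
  R′ : Records Q (L₁ ++ (L₂ ++ N))
  R′ = subst (Records Q) (++-assoc L₁ L₂ N) R
  sum≡ : length L₁ ≡ sum (map length us)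
  sum≡ = trans (sym (length-map _ L₁)) (trans (cong length e₁) (length-descendingProduct us))
  go : ∀ i → i < length (map length (u ∷ us)) →
    IsConnectedVee Q (suc (sum (drop (suc i) (map length (u ∷ us))))) (sum (drop i (map length (u ∷ us))))
  go zero _ = subst₂ (λ a b → IsConnectedVee Q (suc a) b) sum≡
    (trans (+-comm (length L₁) (length L₂)) (cong₂ _+_ (trans (sym (length-map _ L₂)) (cong length e₂)) sum≡))
    (isConnectedVee shifted-L addable-M h (segment L₁ L₂ N R′) (full l))
  go (suc i) (s≤s i<) = vees (L₂ ++ N) f e₁ (proj₁ (proj₂ (Grow-++ L₁ g))) (Peaks-take L₁ p) R′ i i<

factorization⇒tableauWord : ∀ {us} → Factorization us → IsShiftedTableauWord (descendingProduct us)
factorization⇒tableauWord {us} f = subst IsShiftedTableauWord words≡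
  (Pmix (words trace) , isShiftedYoungTableau t (isYoung σ) (models-P sim) , refl , record
    { isStandard = isStandardShiftedTableau As sim
    ; hasShape = Models-shape (models-Q sim) (models-P sim)
    ; vees = subst (λ λs → ∀ i → i < length λs → IsConnectedVee (Qmix (words trace)) (suc (sum (drop (suc i) λs))) (sum (drop i λs)))
        (sym (shape-trace f words≡ grows peaks))
        (vees [] f words≡ grows peaks (subst (Records _) (sym (++-identityʳ trace)) (Simulates-Records As sim))) })
  where
  open WordTrace (wordTrace (descendingProduct us))
  t = Grow-IsTableau IsTableau-[] grows
  As = Grow-AddableΔ* grows
  σ = IsShifted-⊞* IsShifted-∅ As
  sim = mix-simulates grows

-- The factorization read off the recording tableau

size-trace : ∀ {L cs} → Grow [] L cs → sum (shape (Pmix (words L))) ≡ length L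
size-trace {L} g = begin
  sum (shape (Pmix (words L))) ≡⟨ cong sum (Models-shape (models-P sim) (models-Q sim)) ⟩
  sum (shape (Qmix (words L))) ≡⟨ sum-shape (Qmix (words L)) ⟩
  size (Qmix (words L))        ≡⟨ sized (models-Q sim) ⟩
  length (stamp [] L)          ≡⟨ stamp-length [] L ⟩
  length L                     ∎
  where
  open ≡-Reasoning
  sim = mix-simulates g

-- The last vee gives a hook word whose length is that of the first row, hence a maximum one. This
-- in turn makes `shape-append` applicable and yields the shape for the remaining letters.
factorize : ∀ λs {L cs Q} N → shape (Pmix (words L)) ≡ λs → Grow [] L cs → Peaks L → Records Q (L ++ N) →
  (∀ i → i < length λs → IsConnectedVee Q (suc (sum (drop (suc i) λs))) (sum (drop i λs))) →
  ∃[ us ] (Factorization us × words L ≡ descendingProduct us)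
factorize [] {[]} N e g p R v = [] , [] , refl
factorize [] {_ ∷ _} N e g p R v = contradiction (trans (sym (cong sum e)) (size-trace g)) λ ()
factorize (n ∷ λs) {L} {Q = Q} N e g p R v = go (take k L) (drop k L) (sym (take++drop≡id k L)) length-take′
  where
  k = sum λs
  length-L : length L ≡ n + k
  length-L = trans (sym (size-trace g)) (cong sum e)
  length-take′ : length (take k L) ≡ k
  length-take′ = trans (length-take k L) (m≤n⇒m⊓n≡m (≤-trans (m≤n+m k n) (≤-reflexive (sym length-L))))
  go : ∀ L₁ L₂ → L ≡ L₁ ++ L₂ → length L₁ ≡ k → ∃[ us ] (Factorization us × words L ≡ descendingProduct us)
  go L₁ L₂ refl len = u ∷ proj₁ rest , max ∷ proj₁ (proj₂ rest) , product
    where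
    open Append L₁ L₂ g
    u = words L₂
    len₂ : length L₂ ≡ n
    len₂ = +-cancelˡ-≡ k _ _ (trans (cong (_+ length L₂) (sym len)) (trans (sym (length-++ L₁)) (trans length-L (+-comm n k))))
    first : length L₂ ≡ firstRowLength (words (L₁ ++ L₂))
    first = trans len₂ (sym (trans (sym (part-shape (Pmix (words (L₁ ++ L₂))) 0)) (cong (λ ms → part ms 0) e)))
    R′ : Records Q (L₁ ++ (L₂ ++ N))
    R′ = subst (Records Q) (++-assoc L₁ L₂ N) R
    noPeak : NoPeak Downward Rightward (boxes L₂)
    noPeak = vee⇒noPeak (segment L₁ L₂ N R′) (subst₂ (λ a b → IsVee Q (suc a) b) (sym len)
      (trans (+-comm n k) (cong₂ _+_ (sym len) (sym len₂))) (IsConnectedVee.isVee (v 0 z<s)))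
    nonempty : 0 < length L₂
    nonempty = subst (0 <_) (sym len₂) (>-nonZero⁻¹ n {{All.head (subst (All NonZero) e (noEmpty (models-P (mix-simulates g))))}})
    hook : HookWord u
    hook = hook-words L₂ (Peaks-drop L₁ L₂ p) noPeak nonempty
    shape₁ : shape (Pmix (words L₁)) ≡ λs
    shape₁ = ∷-injectiveʳ (trans (sym (shape-append (hook-boxes shifted-L addable-M (Peaks-drop L₁ L₂ p) hook) first)) e)
    rest = factorize λs (L₂ ++ N) shape₁ (proj₁ (proj₂ (Grow-++ L₁ g))) (Peaks-take L₁ p) R′ (λ i l → v (suc i) (s≤s l))
    product : words (L₁ ++ L₂) ≡ descendingProduct (u ∷ proj₁ rest)
    product = trans (map-++ _ L₁ L₂) (trans (cong (_++ u) (proj₂ (proj₂ rest))) (sym (descendingProduct-∷ u (proj₁ rest))))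
    max : IsMaximumHookSubword u (descendingProduct (u ∷ proj₁ rest))
    max = subst (IsMaximumHookSubword u) product record
      { isHookSubword = record { subsequence = subst (u ⊆.⊆_) (sym (map-++ _ L₁ L₂)) (⊆.++⁺ˡ (words L₁) ⊆-refl) ; hook = hook }
      ; maximum = λ w h → ≤-trans (hook≤firstRowLength h) (≤-reflexive (trans (sym first) (sym (length-map _ L₂)))) }

tableauWord⇒factorization : ∀ {w} → IsShiftedTableauWord w → ∃[ us ] IsMaximumHookFactorization us w
tableauWord⇒factorization {w} (_ , _ , refl , special) with factorize (shape (Pmix w)) [] (cong (shape ∘ Pmix) words≡) grows peaks
    (subst₂ Records (cong Qmix words≡) (sym (++-identityʳ trace)) (Simulates-Records (Grow-AddableΔ* grows) (mix-simulates grows)))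
    (IsSpecialRecordingTableau.vees special)
  where open WordTrace (wordTrace w)
... | us , f , e = us , subst (IsMaximumHookFactorization us) (trans (sym e) words≡) (factorization⁺ f)
  where open WordTrace (wordTrace w)

mainTheorem14 : (w : Word) →
    (IsShiftedTableauWord w ⇔ (∃[ us ] IsMaximumHookFactorization us w))
    × (∀ us → IsMaximumHookFactorization us w →
    ((i : Fin (length us)) →
    shape (Pmix (descendingProduct (drop (toℕ i) us)))
    ≡ map length (drop (toℕ i) us))
    × shape (Pmix w) ≡ map length us)
mainTheorem14 w = mk⇔ tableauWord⇒factorization
    (λ (us , f) → subst IsShiftedTableauWord (sym (IsMaximumHookFactorization.factorization f))
      (factorization⇒tableauWord (factorization⁻ f)))
  , λ us f → (λ i → shape-factorization (Factorization-drop (toℕ i) (factorization⁻ f)))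
      , trans (cong (shape ∘ Pmix) (IsMaximumHookFactorization.factorization f)) (shape-factorization (factorization⁻ f))
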